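{- There is an absolute constant $c>0$ such that the following holds. Let $k,n\ge1$ and $\mathfrak s=[s_1,\dots,s_k]$ with integers $s_i\ge1$ and $\sum_i s_i\le n/2$. Let $\Pi$ be a $[c_1,\dots,c_k]$-bounded (deterministic) $k$-party protocol which solves the unique set-disjointness problem under input distribution $D_{\mathfrak s}$ with error at most $1\%$. Then $$\sum_{i=1}^k\frac{c_i}{s_i}\ \ge\ c.$$
   Context: Inputs: player $i$ holds $X_i\in\{0,1\}^n$ (a subset of $[n]$); $X^j=(X_1(j),\dots,X_k(j))$. $\mathcal F_0=\{X:\forall j,\ |X^j|\le1\}$ (disjoint, answer 0), $\mathcal F_1=\{X:\exists j,\ |X^j|=k,\ \forall j'\ne j,\ |X^{j'}|\le1\}$ (unique intersection, answer 1). $\mathcal F_{\mathfrak s}=\{X:\forall i,\ |X_i|=s_i\}$; for $b\in\{0,1\}$, $D^b_{\mathfrak s}$ is the uniform distribution on $\mathcal F_b\cap\mathcal F_{\mathfrak s}$, and $D_{\mathfrak s}$ samples a uniform bit $b$ and then $X\sim D^b_{\mathfrak s}$; error is the probability the output differs from $b$. Protocols are in the blackboard model; $[c_1,\dots,c_k]$-bounded means player $i$ sends at most $c_i$ bits in every transcript. -}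

module Defs where

open import Data.Bool using (Bool; true; false; if_then_else_; _≟_)
open import Data.Nat as ℕ using (ℕ; zero; suc; _≤_; _≤?_)
import Data.Nat.Properties as ℕP
open import Data.Fin using (Fin) renaming (zero to fzero; suc to fsuc)
import Data.Fin.Properties as FinP
open import Data.Integer using (+_)
open import Data.Rational using (ℚ; _/_; 0ℚ; ½) renaming (_+_ to _+ℚ_; _*_ to _*ℚ_)
open import Data.List using (List; []; _∷_; map; concatMap; filter; length)
open import Data.Product using (Σ; _×_; _,_; ∃)
open import Relation.Nullary using (Dec; does; ¬_; _×-dec_; _→-dec_; ¬?)
open import Relation.Binary.PropositionalEquality using (_≡_)
open import Function using (_∘_)

size : {m : ℕ} → (Fin m → Bool) → ℕ
size {zero}  f = 0
size {suc m} f = (if f fzero then 1 else 0) ℕ.+ size (f ∘ fsuc)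

-- Inputs: player i holds X i ⊆ [n];  column j is X^j = (X_1(j),…,X_k(j)).
Input : ℕ → ℕ → Set
Input k n = Fin k → Fin n → Bool

column : {k n : ℕ} → Input k n → Fin n → (Fin k → Bool)
column X j = λ i → X i j

F0 : {k n : ℕ} → Input k n → Set
F0 X = ∀ j → size (column X j) ≤ 1

F1 : {k n : ℕ} → Input k n → Set
F1 {k} X = ∃ λ j → size (column X j) ≡ k × (∀ j' → ¬ (j' ≡ j) → size (column X j') ≤ 1)

Fs : {k n : ℕ} → (Fin k → ℕ) → Input k n → Set
Fs s X = ∀ i → size (X i) ≡ s i

F0? : {k n : ℕ} (X : Input k n) → Dec (F0 X)
F0? X = FinP.all? (λ j → size (column X j) ≤? 1)

F1? : {k n : ℕ} (X : Input k n) → Dec (F1 X)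
F1? {k} X = FinP.any? (λ j → (size (column X j) ℕP.≟ k)
             ×-dec FinP.all? (λ j' → ¬? (j' FinP.≟ j) →-dec (size (column X j') ≤? 1)))

Fs? : {k n : ℕ} (s : Fin k → ℕ) (X : Input k n) → Dec (Fs s X)
Fs? s X = FinP.all? (λ i → size (X i) ℕP.≟ s i)

allFuns : {A : Set} → List A → (m : ℕ) → List (Fin m → A)
allFuns as zero    = (λ ()) ∷ []
allFuns as (suc m) = concatMap (λ a → map (λ f → λ { fzero → a ; (fsuc i) → f i }) (allFuns as m)) as

allInputs : (k n : ℕ) → List (Input k n)
allInputs k n = allFuns (allFuns (false ∷ true ∷ []) n) k

-- Deterministic k-party blackboard protocols (one bit per node).
-- At a node the speaking player i sends a bit that is a function of its
-- own input X_i (and of the transcript so far, i.e. the position in the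
-- tree); leaves carry the output.

data Protocol (k n : ℕ) : Set where
  leaf : Bool → Protocol k n
  node : (i : Fin k) → ((Fin n → Bool) → Bool) →
         (on0 : Protocol k n) → (on1 : Protocol k n) → Protocol k n

run : {k n : ℕ} → Protocol k n → Input k n → Bool
run (leaf b) X = b
run (node i f p q) X = if f (X i) then run q X else run p X

bitsSent : {k n : ℕ} → Protocol k n → Input k n → Fin k → ℕ
bitsSent (leaf b) X i = 0
bitsSent (node i' f p q) X i =
  (if does (i' FinP.≟ i) then 1 else 0) ℕ.+
  (if f (X i') then bitsSent q X i else bitsSent p X i)

Bounded : {k n : ℕ} → (Fin k → ℕ) → Protocol k n → Set
Bounded c Π = ∀ X i → bitsSent Π X i ≤ c i

-- a / d as a rational (d = 0 never occurs in uses below; set to 0 then)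
frac : ℕ → ℕ → ℚ
frac a zero    = 0ℚ
frac a (suc d) = (+ a) / suc d

supp0 supp1 : {k n : ℕ} → (Fin k → ℕ) → List (Input k n)
supp0 {k} {n} s = filter (λ X → F0? X ×-dec Fs? s X) (allInputs k n)
supp1 {k} {n} s = filter (λ X → F1? X ×-dec Fs? s X) (allInputs k n)

-- error of Π under D_s: ½ Pr_{D^0_s}[Π ≠ 0] + ½ Pr_{D^1_s}[Π ≠ 1]
errorD : {k n : ℕ} → (Fin k → ℕ) → Protocol k n → ℚ
errorD {k} {n} s Π =
  (½ *ℚ frac (length (filter (λ X → run Π X ≟ true)  (supp0 {k} {n} s))) (length (supp0 {k} {n} s)))
  +ℚ
  (½ *ℚ frac (length (filter (λ X → run Π X ≟ false) (supp1 {k} {n} s))) (length (supp1 {k} {n} s)))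

sumℚ : {k : ℕ} → (Fin k → ℚ) → ℚ
sumℚ {zero}  f = 0ℚ
sumℚ {suc k} f = f fzero +ℚ sumℚ (f ∘ fsuc)

sumℕ : {k : ℕ} → (Fin k → ℕ) → ℕ
sumℕ {zero}  f = 0
sumℕ {suc k} f = f fzero ℕ.+ sumℕ (f ∘ fsuc)

{-# OPTIONS --safe #-}
-- Place 2S slots (S = s₁ + … + sₖ) by a uniformly random bijection, grouped into S pairs of which player i
-- owns sᵢ, and let each player take one slot of each of his pairs, chosen by a fair coin. In one designated
-- pair of each player the true slot is replaced by a point common to all players. If the coins of the
-- designated pairs are all false, the input is uniform on F0 ∩ Fs; if they are all true, it is uniform on
-- F1 ∩ Fs; and given the placement, the inputs of the players are independent.
--
-- Let aᵢ and bᵢ be the probabilities that the input of player i lies in a given leaf rectangle when his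
-- designated coin is false, resp. true. The leaf has probability ∏ aᵢ in the first world and ∏ bᵢ in the
-- second. As in a Hellinger distance argument, but with rational expressions only, both are at least ½ ∏ aᵢ
-- minus a multiple of ∑ᵢ (aᵢ - bᵢ)² / (aᵢ + bᵢ) ∏_{j ≠ i} aⱼ, up to terms that cancel in the sum over all
-- leaves. In that i-th summand only player i sees the common point, which is by symmetry in a uniformly
-- random pair of his; and the cᵢ bits he sends bias his sᵢ coins by O(cᵢ) in total squared bias (entropy), so
-- that its sum over all leaves is at most 8 cᵢ / sᵢ on average. Hence the two error probabilities add up to at
-- least 1/2 - 80 ∑ cᵢ / sᵢ.
module Submission where

open import Defs
open import Algebra.Properties.CommutativeSemigroup using (interchange)
open import Data.Bool as 𝔹 using (Bool; true; false; if_then_else_; _∧_; not)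
import Data.Bool.Properties as Boolₚ
open import Data.Empty using (⊥)
open import Data.Fin using (Fin; punchIn; punchOut; splitAt; join; _↑ˡ_; _↑ʳ_) renaming (zero to fzero; suc to fsuc)
open import Data.Fin.Permutation as Perm using (Permutation′; _⟨$⟩ʳ_; _⟨$⟩ˡ_)
import Data.Fin.Permutation.Components as PC
import Data.Fin.Properties as Finₚ
import Data.Integer as ℤ
import Data.Integer.Properties as ℤₚ
open import Data.List using (List; []; _∷_; _++_; map; concatMap; filter; length)
open import Data.Nat as ℕ using (ℕ; zero; suc; z≤n; s≤s)
import Data.Nat.Properties as ℕₚ
open import Data.Product using (Σ; _×_; _,_; proj₁; proj₂; ∃)
open import Data.Rational
open import Data.Rational.Properties
import Data.Rational.Unnormalised as ℚᵘ
import Data.Rational.Unnormalised.Properties as ℚᵘₚ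
open import Data.Sum as Sum using (_⊎_; inj₁; inj₂; [_,_]′)
open import Data.Vec as Vec using (Vec; []; _∷_; lookup; tabulate) renaming (_[_]≔_ to _[_]≔ᵛ_)
open import Data.Vec.Functional using (updateAt)
open import Data.Vec.Functional.Properties using (updateAt-updates; updateAt-minimal)
import Data.Vec.Properties as Vecₚ
open import Function using (_∘_; const)
open import Function.Bundles using (mk⇔)
open import Relation.Binary using (DecidableEquality)
open import Relation.Binary.PropositionalEquality
open import Relation.Nullary using (¬_; Dec; yes; no; does; contradiction; _→-dec_; _×-dec_)
open import Relation.Nullary.Decidable using (dec⇒maybe; dec-true; does-⇔)
open import Relation.Unary using (Decidable)
open import Tactic.RingSolver using (solve-∀)
open import Tactic.RingSolver.Core.AlmostCommutativeRing using (AlmostCommutativeRing; fromCommutativeRing)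

-- Rational arithmetic

-- The difficulty at a leaf is the first-order term. With `aᵢ = mᵢ (1 - uᵢ)` and `bᵢ = mᵢ (1 + uᵢ)`,
-- put `q = ∏ (1 - uᵢ)` and `s = ∑ uᵢ`. Communication pays only for the squares `uᵢ²`, but `∏ bᵢ`
-- can fall far below `∏ aᵢ` when `s` is negative. The terms that cancel over the leaves compensate
-- for this: after division by `∏ mᵢ` they amount to `- 8 (1 - q (1 + s))` plus squares. Here
-- `1 - q (1 + s)` is nonnegative because `q ≤ exp (- s)`, and up to squares it outweighs `½ q`
-- wherever `∏ bᵢ` is too small. In the entropy argument the logarithm is replaced by finitely many
-- dyadic scales. This suffices because an event determined by `S` fair coins has probability 0 or
-- at least `2^-S`, so that no finer scale occurs.

ℚ-ring : AlmostCommutativeRing _ _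
ℚ-ring = fromCommutativeRing +-*-commutativeRing λ x → dec⇒maybe (0ℚ ≟ x)

2ℚ 4ℚ 8ℚ 10ℚ : ℚ
2ℚ = 1ℚ + 1ℚ
4ℚ = 2ℚ + 2ℚ
8ℚ = 4ℚ + 4ℚ
10ℚ = 8ℚ + 2ℚ

0≤1 : 0ℚ ≤ 1ℚ
0≤1 = nonNegative⁻¹ 1ℚ

0≤½ : 0ℚ ≤ ½
0≤½ = nonNegative⁻¹ ½

-- Most inequalities below are certificates: the ring solver identifies the difference of the two
-- sides with an expression whose terms are visibly nonnegative.
≤-by : ∀ {p q} e → q - p ≡ e → 0ℚ ≤ e → p ≤ q
≤-by {p} {q} e eq 0≤e = begin
  p            ≡⟨ sym (+-identityʳ p) ⟩
  p + 0ℚ       ≤⟨ +-monoʳ-≤ p 0≤e ⟩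
  p + e        ≡⟨ cong (p +_) (sym eq) ⟩
  p + (q - p)  ≡⟨ lem p q ⟩
  q            ∎
  where
  open ≤-Reasoning
  lem : ∀ p q → p + (q - p) ≡ q
  lem = solve-∀ ℚ-ring

0≤diff : ∀ {p q} → p ≤ q → 0ℚ ≤ q - p
0≤diff {p} {q} p≤q = subst (_≤ q - p) (+-inverseʳ p) (+-monoˡ-≤ (- p) p≤q)

0≤+ : ∀ {p q} → 0ℚ ≤ p → 0ℚ ≤ q → 0ℚ ≤ p + q
0≤+ = +-mono-≤

0≤* : ∀ {p q} → 0ℚ ≤ p → 0ℚ ≤ q → 0ℚ ≤ p * q
0≤* {p} {q} 0≤p 0≤q =
  nonNegative⁻¹ (p * q) {{nonNeg*nonNeg⇒nonNeg p {{nonNegative 0≤p}} q {{nonNegative 0≤q}}}}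

0≤sq : ∀ p → 0ℚ ≤ p * p
0≤sq p with ≤-total 0ℚ p
... | inj₁ 0≤p = 0≤* 0≤p 0≤p
... | inj₂ p≤0 = subst (0ℚ ≤_) (lem p) (0≤* 0≤-p 0≤-p)
  where
  0≤-p : 0ℚ ≤ - p
  0≤-p = neg-antimono-≤ p≤0
  lem : ∀ p → - p * - p ≡ p * p
  lem = solve-∀ ℚ-ring

*-mono-≤ˡ : ∀ {p q} r → 0ℚ ≤ r → p ≤ q → r * p ≤ r * q
*-mono-≤ˡ r 0≤r = *-monoˡ-≤-nonNeg r {{nonNegative 0≤r}}

*-mono-≤₂ : ∀ {p q r s} → 0ℚ ≤ q → 0ℚ ≤ r → p ≤ q → r ≤ s → p * r ≤ q * s
*-mono-≤₂ {p} {q} {r} {s} 0≤q 0≤r p≤q r≤s =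
  ≤-by ((q - p) * r + q * (s - r)) (lem p q r s)
    (0≤+ (0≤* (0≤diff p≤q) 0≤r) (0≤* 0≤q (0≤diff r≤s)))
  where
  lem : ∀ p q r s → q * s - p * r ≡ (q - p) * r + q * (s - r)
  lem = solve-∀ ℚ-ring

*-cancel-≤ : ∀ {p q} r → 0ℚ < r → r * p ≤ r * q → p ≤ q
*-cancel-≤ r 0<r = *-cancelˡ-≤-pos r {{positive 0<r}}

≤∧≢⇒< : ∀ {p q} → p ≤ q → ¬ p ≡ q → p < q
≤∧≢⇒< p≤q p≢q = ≰⇒> λ q≤p → p≢q (≤-antisym p≤q q≤p)

-- The value 0 at 0 makes `bias` and `tri` vanish when both probabilities do, so their identities
-- also hold at leaves of probability zero.
inv : ℚ → ℚ
inv p with p ≟ 0ℚ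
... | yes _  = 0ℚ
... | no p≢0 = (1/ p) {{≢-nonZero p≢0}}

*-inv : ∀ {p} → ¬ p ≡ 0ℚ → p * inv p ≡ 1ℚ
*-inv {p} p≢0 with p ≟ 0ℚ
... | yes p≡0 = contradiction p≡0 p≢0
... | no p≢0′ = *-inverseʳ p {{≢-nonZero p≢0′}}

0≤inv : ∀ {p} → 0ℚ ≤ p → 0ℚ ≤ inv p
0≤inv {p} 0≤p with p ≟ 0ℚ
... | yes _  = ≤-refl
... | no p≢0 = nonNegative⁻¹ 1/p {{pos⇒nonNeg 1/p {{1/pos⇒pos p {{positive (≤∧≢⇒< 0≤p (p≢0 ∘ sym))}}}}}}
  where
  1/p : ℚ
  1/p = (1/ p) {{≢-nonZero p≢0}}

-- Finite sums and products.

∑ : ∀ {k} → (Fin k → ℚ) → ℚ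
∑ = sumℚ

∏ : ∀ {k} → (Fin k → ℚ) → ℚ
∏ {zero}  f = 1ℚ
∏ {suc k} f = f fzero * ∏ (f ∘ fsuc)

∑-cong : ∀ {k} {f g : Fin k → ℚ} → (∀ i → f i ≡ g i) → ∑ f ≡ ∑ g
∑-cong {zero}  f≗g = refl
∑-cong {suc k} f≗g = cong₂ _+_ (f≗g fzero) (∑-cong (f≗g ∘ fsuc))

∑-mono : ∀ {k} {f g : Fin k → ℚ} → (∀ i → f i ≤ g i) → ∑ f ≤ ∑ g
∑-mono {zero}  f≤g = ≤-refl
∑-mono {suc k} f≤g = +-mono-≤ (f≤g fzero) (∑-mono (f≤g ∘ fsuc))

∑-0 : ∀ k → ∑ {k} (λ _ → 0ℚ) ≡ 0ℚ
∑-0 zero    = refl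
∑-0 (suc k) = trans (+-identityˡ _) (∑-0 k)

0≤∑ : ∀ {k} {f : Fin k → ℚ} → (∀ i → 0ℚ ≤ f i) → 0ℚ ≤ ∑ f
0≤∑ {k} {f} 0≤f = subst (_≤ ∑ f) (∑-0 k) (∑-mono 0≤f)

∑-+ : ∀ {k} (f g : Fin k → ℚ) → ∑ (λ i → f i + g i) ≡ ∑ f + ∑ g
∑-+ {zero}  f g = refl
∑-+ {suc k} f g = trans (cong (f fzero + g fzero +_) (∑-+ (f ∘ fsuc) (g ∘ fsuc)))
                        (lem (f fzero) (g fzero) (∑ (f ∘ fsuc)) (∑ (g ∘ fsuc)))
  where
  lem : ∀ a b c d → a + b + (c + d) ≡ a + c + (b + d)
  lem = solve-∀ ℚ-ring

∑-*ˡ : ∀ {k} c (f : Fin k → ℚ) → ∑ (λ i → c * f i) ≡ c * ∑ f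
∑-*ˡ {zero}  c f = sym (*-zeroʳ c)
∑-*ˡ {suc k} c f = trans (cong (c * f fzero +_) (∑-*ˡ c (f ∘ fsuc))) (sym (*-distribˡ-+ c _ _))

∏-cong : ∀ {k} {f g : Fin k → ℚ} → (∀ i → f i ≡ g i) → ∏ f ≡ ∏ g
∏-cong {zero}  f≗g = refl
∏-cong {suc k} f≗g = cong₂ _*_ (f≗g fzero) (∏-cong (f≗g ∘ fsuc))

∏-* : ∀ {k} (f g : Fin k → ℚ) → ∏ (λ i → f i * g i) ≡ ∏ f * ∏ g
∏-* {zero}  f g = refl
∏-* {suc k} f g = trans (cong (f fzero * g fzero *_) (∏-* (f ∘ fsuc) (g ∘ fsuc)))
                        (lem (f fzero) (g fzero) (∏ (f ∘ fsuc)) (∏ (g ∘ fsuc)))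
  where
  lem : ∀ a b c d → a * b * (c * d) ≡ a * c * (b * d)
  lem = solve-∀ ℚ-ring

0≤∏ : ∀ {k} {f : Fin k → ℚ} → (∀ i → 0ℚ ≤ f i) → 0ℚ ≤ ∏ f
0≤∏ {zero}  0≤f = 0≤1
0≤∏ {suc k} 0≤f = 0≤* (0≤f fzero) (0≤∏ (0≤f ∘ fsuc))

∏-mono : ∀ {k} {f g : Fin k → ℚ} → (∀ i → 0ℚ ≤ f i) → (∀ i → f i ≤ g i) → ∏ f ≤ ∏ g
∏-mono {zero}  0≤f f≤g = ≤-refl
∏-mono {suc k} 0≤f f≤g =
  *-mono-≤₂ (≤-trans (0≤f fzero) (f≤g fzero)) (0≤∏ (0≤f ∘ fsuc)) (f≤g fzero)
            (∏-mono (0≤f ∘ fsuc) (f≤g ∘ fsuc))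

infixl 10 _[_≔_]
_[_≔_] : ∀ {a} {A : Set a} {k} → (Fin k → A) → Fin k → A → Fin k → A
f [ i ≔ x ] = updateAt f i (const x)

∏-skip : ∀ {k} → (Fin k → ℚ) → Fin k → ℚ
∏-skip f i = ∏ (f [ i ≔ 1ℚ ])

∏-update : ∀ {k} (f : Fin k → ℚ) i x → ∏ (f [ i ≔ x ]) ≡ x * ∏-skip f i
∏-update f fzero    x = cong (x *_) (sym (*-identityˡ _))
∏-update f (fsuc i) x = trans (cong (f fzero *_) (∏-update (f ∘ fsuc) i x)) (lem (f fzero) x _)
  where
  lem : ∀ a x c → a * (x * c) ≡ x * (a * c)
  lem = solve-∀ ℚ-ring

∏-split : ∀ {k} (f : Fin k → ℚ) i → ∏ f ≡ f i * ∏-skip f i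
∏-split f fzero    = cong (f fzero *_) (sym (*-identityˡ _))
∏-split f (fsuc i) = trans (cong (f fzero *_) (∏-split (f ∘ fsuc) i)) (lem (f fzero) (f (fsuc i)) _)
  where
  lem : ∀ a x c → a * (x * c) ≡ x * (a * c)
  lem = solve-∀ ℚ-ring

0≤∏-skip : ∀ {k} {f : Fin k → ℚ} → (∀ i → 0ℚ ≤ f i) → ∀ i → 0ℚ ≤ ∏-skip f i
0≤∏-skip {f = f} 0≤f fzero    = 0≤* 0≤1 (0≤∏ (0≤f ∘ fsuc))
0≤∏-skip {f = f} 0≤f (fsuc i) = 0≤* (0≤f fzero) (0≤∏-skip (0≤f ∘ fsuc) i)

-- An index whose entry has the sign of t exists as soon as the sum does: this is what
-- makes the induction in ∏-exp go through.
∑-sign : ∀ {k} (f : Fin (suc k) → ℚ) t → 0ℚ ≤ t * ∑ f → ∃ λ i → 0ℚ ≤ t * f i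
∑-sign {zero}  f t h = fzero , subst (λ x → 0ℚ ≤ t * x) (+-identityʳ (f fzero)) h
∑-sign {suc k} f t h with ≤-total 0ℚ (t * f fzero)
... | inj₁ p = fzero , p
... | inj₂ p = let i , q = ∑-sign (f ∘ fsuc) t (≤-trans h tail≤) in fsuc i , q
  where
  lem : ∀ t a s → t * s - t * (a + s) ≡ - (t * a)
  lem = solve-∀ ℚ-ring
  tail≤ : t * ∑ f ≤ t * ∑ (f ∘ fsuc)
  tail≤ = ≤-by (- (t * f fzero)) (lem t (f fzero) _) (neg-antimono-≤ p)

∑-remove : ∀ {k} (f : Fin (suc k) → ℚ) i → ∑ f ≡ f i + ∑ (f ∘ punchIn i)
∑-remove         f fzero    = refl
∑-remove {suc k} f (fsuc i) = trans (cong (f fzero +_) (∑-remove (f ∘ fsuc) i)) (lem (f fzero) (f (fsuc i)) _)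
  where
  lem : ∀ a x c → a + (x + c) ≡ x + (a + c)
  lem = solve-∀ ℚ-ring

∏-remove : ∀ {k} (f : Fin (suc k) → ℚ) i → ∏ f ≡ f i * ∏ (f ∘ punchIn i)
∏-remove         f fzero    = refl
∏-remove {suc k} f (fsuc i) = trans (cong (f fzero *_) (∏-remove (f ∘ fsuc) i)) (lem (f fzero) (f (fsuc i)) _)
  where
  lem : ∀ a x c → a * (x * c) ≡ x * (a * c)
  lem = solve-∀ ℚ-ring

∏-1 : ∀ {k} (f : Fin k → ℚ) → (∀ i → f i ≡ 1ℚ) → ∏ f ≡ 1ℚ
∏-1 {zero}  f f≡1 = refl
∏-1 {suc k} f f≡1 = cong₂ _*_ (f≡1 fzero) (∏-1 (f ∘ fsuc) (f≡1 ∘ fsuc))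

-- The leaf inequality

-- Rational form of ∏ (1 - uᵢ) ≤ exp (- ∑ uᵢ) ≤ 1 / (1 + ∑ uᵢ).
∏-exp : ∀ {k} (u : Fin k → ℚ) → (∀ i → u i ≤ 1ℚ) → ∏ (λ i → 1ℚ - u i) * (1ℚ + ∑ u) ≤ 1ℚ
∏-exp {zero}  u u≤1 = ≤-refl
∏-exp {suc k} u u≤1 = ≤-trans remove (∏-exp (u ∘ punchIn i) (u≤1 ∘ punchIn i))
  where
  pick : ∃ λ i → 0ℚ ≤ ∑ u * u i
  pick = ∑-sign u (∑ u) (0≤sq (∑ u))
  i : Fin (suc k)
  i = proj₁ pick
  q s : ℚ
  q = ∏ (λ j → 1ℚ - u (punchIn i j))
  s = ∑ (u ∘ punchIn i)
  lem : ∀ q s x → q * (1ℚ + s) - (1ℚ - x) * q * (1ℚ + (x + s)) ≡ q * ((x + s) * x)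
  lem = solve-∀ ℚ-ring
  remove : ∏ (λ j → 1ℚ - u j) * (1ℚ + ∑ u) ≤ q * (1ℚ + s)
  remove = ≤-by (q * (∑ u * u i))
    (begin
      q * (1ℚ + s) - ∏ (λ j → 1ℚ - u j) * (1ℚ + ∑ u)
        ≡⟨ cong₂ (λ p t → q * (1ℚ + s) - p * (1ℚ + t)) (∏-remove (λ j → 1ℚ - u j) i) (∑-remove u i) ⟩
      q * (1ℚ + s) - (1ℚ - u i) * q * (1ℚ + (u i + s))
        ≡⟨ lem q s (u i) ⟩
      q * ((u i + s) * u i)
        ≡⟨ cong (λ t → q * (t * u i)) (sym (∑-remove u i)) ⟩
      q * (∑ u * u i) ∎)
    (0≤* (0≤∏ (λ j → 0≤diff (u≤1 (punchIn i j)))) (proj₂ pick))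
    where open ≡-Reasoning

-- This is `∏-exp` for `½ u`, squared, as `1 - u ≤ (1 - ½ u)²`; squaring requires `1 + ½ * ∑ u` to
-- be nonnegative. The result is of second order in the sum, which `flip-bound` uses when the
-- product exceeds 1.
∏-exp² : ∀ {k} (u : Fin k → ℚ) → (∀ i → u i ≤ 1ℚ) → 0ℚ ≤ 2ℚ + ∑ u →
         ∏ (λ i → 1ℚ - u i) * ((1ℚ + ½ * ∑ u) * (1ℚ + ½ * ∑ u)) ≤ 1ℚ
∏-exp² {k} u u≤1 0≤2+s = begin
  ∏ (λ i → 1ℚ - u i) * (t * t)
    ≤⟨ *-mono-≤₂ (0≤* 0≤h 0≤h) (0≤* 0≤t 0≤t) 1-u≤ ≤-refl ⟩
  h * h * (t * t)
    ≡⟨ lem₁ h t ⟩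
  h * t * (h * t)
    ≤⟨ *-mono-≤₂ 0≤1 (0≤* 0≤h 0≤t) ht≤1 ht≤1 ⟩
  1ℚ ∎
  where
  open ≤-Reasoning
  v : Fin k → ℚ
  v i = ½ * u i
  h t : ℚ
  h = ∏ (λ i → 1ℚ - v i)
  t = 1ℚ + ½ * ∑ u
  lem₁ : ∀ h t → h * h * (t * t) ≡ h * t * (h * t)
  lem₁ = solve-∀ ℚ-ring
  lem₂ : ∀ x → (1ℚ - ½ * x) * (1ℚ - ½ * x) - (1ℚ - x) ≡ ½ * x * (½ * x)
  lem₂ = solve-∀ ℚ-ring
  lem₃ : ∀ x → 1ℚ - ½ * x ≡ ½ + ½ * (1ℚ - x)
  lem₃ = solve-∀ ℚ-ring
  lem₄ : ∀ x → ½ * (2ℚ + x) ≡ 1ℚ + ½ * x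
  lem₄ = solve-∀ ℚ-ring
  0≤1-v : ∀ i → 0ℚ ≤ 1ℚ - v i
  0≤1-v i = subst (0ℚ ≤_) (sym (lem₃ (u i))) (0≤+ 0≤½ (0≤* 0≤½ (0≤diff (u≤1 i))))
  0≤h : 0ℚ ≤ h
  0≤h = 0≤∏ 0≤1-v
  0≤t : 0ℚ ≤ t
  0≤t = subst (0ℚ ≤_) (lem₄ (∑ u)) (0≤* 0≤½ 0≤2+s)
  1-u≤ : ∏ (λ i → 1ℚ - u i) ≤ h * h
  1-u≤ = ≤-trans
    (∏-mono (λ i → 0≤diff (u≤1 i)) (λ i → ≤-by (½ * u i * (½ * u i)) (lem₂ (u i)) (0≤sq (½ * u i))))
    (≤-reflexive (∏-* (λ i → 1ℚ - v i) (λ i → 1ℚ - v i)))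
  v≤1 : ∀ i → v i ≤ 1ℚ
  v≤1 i = ≤-by (1ℚ - v i) refl (0≤1-v i)
  ht≤1 : h * t ≤ 1ℚ
  ht≤1 = subst (λ x → h * (1ℚ + x) ≤ 1ℚ) (∑-*ˡ ½ u) (∏-exp v v≤1)

-- The Weierstrass product inequality; the induction drops the cross term `x fzero * ∑ (x ∘ fsuc)`.
1-∑≤∏ : ∀ {k} (x : Fin k → ℚ) → (∀ i → 0ℚ ≤ x i) → (∀ i → x i ≤ 1ℚ) → 1ℚ - ∑ x ≤ ∏ (λ i → 1ℚ - x i)
1-∑≤∏ {zero}  x 0≤x x≤1 = ≤-refl
1-∑≤∏ {suc k} x 0≤x x≤1 = ≤-trans
  (≤-by (x fzero * ∑ (x ∘ fsuc)) (lem (x fzero) _) (0≤* (0≤x fzero) (0≤∑ (0≤x ∘ fsuc))))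
  (*-mono-≤ˡ (1ℚ - x fzero) (0≤diff (x≤1 fzero)) (1-∑≤∏ (x ∘ fsuc) (0≤x ∘ fsuc) (x≤1 ∘ fsuc)))
  where
  lem : ∀ a s → (1ℚ - a) * (1ℚ - s) - (1ℚ - (a + s)) ≡ a * s
  lem = solve-∀ ℚ-ring

-- q and q′ stand for ∏ (1 - uᵢ) and ∏ (1 + uᵢ), s for ∑ uᵢ and v for ∑ uᵢ².
flip-bound : ∀ q q′ s v → 0ℚ ≤ q → 0ℚ ≤ q′ → 0ℚ ≤ v →
  q * (1ℚ + s) ≤ 1ℚ →
  (0ℚ ≤ 2ℚ + s → q * ((1ℚ + ½ * s) * (1ℚ + ½ * s)) ≤ 1ℚ) →
  1ℚ - v ≤ q * q′ →
  ½ * q - 8ℚ * (1ℚ - q - q * s) - v * q ≤ q′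
flip-bound q q′ s v 0≤q 0≤q′ 0≤v exp exp² qq′ with ≤-total ½ v
... | inj₁ ½≤v = ≤-by (q′ + 8ℚ * (1ℚ - q * (1ℚ + s)) + (v - ½) * q) (lem q q′ s v)
                   (0≤+ (0≤+ 0≤q′ (0≤* (nonNegative⁻¹ 8ℚ) (0≤diff exp))) (0≤* (0≤diff ½≤v) 0≤q))
  where
  lem : ∀ q q′ s v → q′ - (½ * q - 8ℚ * (1ℚ - q - q * s) - v * q)
          ≡ q′ + 8ℚ * (1ℚ - q * (1ℚ + s)) + (v - ½) * q
  lem = solve-∀ ℚ-ring
... | inj₂ v≤½ with ≤-total (2ℚ + s) 0ℚ
-- Here `1 + s ≤ - 1`, so the bracket `1 - q - q * s` is at least `1 + q`, and 8 times it exceeds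
-- `½ * q`.
... | inj₁ 2+s≤0 = ≤-by (q′ + 8ℚ + (8ℚ - ½) * q + 8ℚ * (q * (0ℚ - (2ℚ + s))) + v * q) (lem q q′ s v)
        (0≤+ (0≤+ (0≤+ (0≤+ 0≤q′ (nonNegative⁻¹ 8ℚ)) (0≤* (nonNegative⁻¹ (8ℚ - ½)) 0≤q))
          (0≤* (nonNegative⁻¹ 8ℚ) (0≤* 0≤q (0≤diff 2+s≤0)))) (0≤* 0≤v 0≤q))
  where
  lem : ∀ q q′ s v → q′ - (½ * q - 8ℚ * (1ℚ - q - q * s) - v * q)
          ≡ q′ + 8ℚ + (8ℚ - ½) * q + 8ℚ * (q * (0ℚ - (2ℚ + s))) + v * q
  lem = solve-∀ ℚ-ring
... | inj₂ 0≤2+s with ≤-total q 1ℚ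
-- For `q ≤ 1` already `q′ ≥ q * q′ ≥ 1 - v`, which is at least `(½ - v) * q`.
... | inj₁ q≤1 = ≤-by
        (q′ * (1ℚ - q) + (q * q′ - (1ℚ - v)) + (½ + (½ - v)) * (1ℚ - q) + ½ * q + 8ℚ * (1ℚ - q * (1ℚ + s)))
        (lem q q′ s v)
        (0≤+ (0≤+ (0≤+ (0≤+ (0≤* 0≤q′ (0≤diff q≤1)) (0≤diff qq′))
          (0≤* (0≤+ 0≤½ (0≤diff v≤½)) (0≤diff q≤1))) (0≤* 0≤½ 0≤q)) (0≤* (nonNegative⁻¹ 8ℚ) (0≤diff exp)))
  where
  lem : ∀ q q′ s v → q′ - (½ * q - 8ℚ * (1ℚ - q - q * s) - v * q)
          ≡ q′ * (1ℚ - q) + (q * q′ - (1ℚ - v)) + (½ + (½ - v)) * (1ℚ - q) + ½ * q + 8ℚ * (1ℚ - q * (1ℚ + s))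
  lem = solve-∀ ℚ-ring
-- Multiplying by `q` brings in `q * q′ ≥ 1 - v`. With the weight 8, the `s²` terms of the
-- second-order bound cancel those of `½ * q * (1 + 2 s)²`.
... | inj₂ 1≤q = *-cancel-≤ q (<-≤-trans (positive⁻¹ 1ℚ) 1≤q) (≤-by
        (q * q′ - (1ℚ - v) + (½ + (½ - v)) * ((q - 1ℚ) * (q - 1ℚ)) +
          q * (2ℚ * (1ℚ - q * (1ℚ + s)) + ½ * q * ((1ℚ + 2ℚ * s) * (1ℚ + 2ℚ * s)) + 2ℚ * v * (q - 1ℚ)
               + 8ℚ * (1ℚ - q * ((1ℚ + ½ * s) * (1ℚ + ½ * s)))))
        (lem q q′ s v)
        (0≤+ (0≤+ (0≤diff qq′) (0≤* (0≤+ 0≤½ (0≤diff v≤½)) (0≤sq (q - 1ℚ))))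
          (0≤* 0≤q (0≤+ (0≤+ (0≤+ (0≤* (nonNegative⁻¹ 2ℚ) (0≤diff exp))
            (0≤* (0≤* 0≤½ 0≤q) (0≤sq (1ℚ + 2ℚ * s)))) (0≤* (0≤* (nonNegative⁻¹ 2ℚ) 0≤v) (0≤diff 1≤q)))
            (0≤* (nonNegative⁻¹ 8ℚ) (0≤diff (exp² 0≤2+s)))))))
  where
  lem : ∀ q q′ s v → q * q′ - q * (½ * q - 8ℚ * (1ℚ - q - q * s) - v * q)
          ≡ q * q′ - (1ℚ - v) + (½ + (½ - v)) * ((q - 1ℚ) * (q - 1ℚ)) +
          q * (2ℚ * (1ℚ - q * (1ℚ + s)) + ½ * q * ((1ℚ + 2ℚ * s) * (1ℚ + 2ℚ * s)) + 2ℚ * v * (q - 1ℚ)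
               + 8ℚ * (1ℚ - q * ((1ℚ + ½ * s) * (1ℚ + ½ * s))))
  lem = solve-∀ ℚ-ring

-- With `m = mid a b` and `u = bias a b`, nonnegative `a` and `b` become `m (1 - u)` and `m (1 + u)`
-- with `u` between -1 and 1. Later claims then reduce to polynomial identities in `m` and `u`.
bias : ℚ → ℚ → ℚ
bias a b = (b - a) * inv (a + b)

-- Half the triangular discrimination of a and b, with value 0 at a = b = 0.
tri : ℚ → ℚ → ℚ
tri a b = ½ * ((b - a) * bias a b)

mid : ℚ → ℚ → ℚ
mid a b = ½ * (a + b)

data BiasView (a b : ℚ) : Set where
  null    : a ≡ 0ℚ → b ≡ 0ℚ → BiasView a b
  nonnull : 0ℚ < a + b → (a + b) * inv (a + b) ≡ 1ℚ → BiasView a b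

biasView : ∀ {a b} → 0ℚ ≤ a → 0ℚ ≤ b → BiasView a b
biasView {a} {b} 0≤a 0≤b with (a + b) ≟ 0ℚ
... | no a+b≢0 = nonnull (≤∧≢⇒< (0≤+ 0≤a 0≤b) (a+b≢0 ∘ sym)) (*-inv a+b≢0)
... | yes a+b≡0 = null
  (≤-antisym (≤-by b (trans (cong (_- a) (sym a+b≡0)) (lem a b)) 0≤b) 0≤a)
  (≤-antisym (≤-by a (trans (cong (_- b) (sym a+b≡0)) (lem′ a b)) 0≤a) 0≤b)
  where
  lem : ∀ a b → a + b - a ≡ b
  lem = solve-∀ ℚ-ring
  lem′ : ∀ a b → a + b - b ≡ a
  lem′ = solve-∀ ℚ-ring

mid*[1-bias] : ∀ {a b} → 0ℚ ≤ a → 0ℚ ≤ b → mid a b * (1ℚ - bias a b) ≡ a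
mid*[1-bias] {a} {b} 0≤a 0≤b with biasView 0≤a 0≤b
... | null refl refl = refl
... | nonnull _ eq = trans (lem a b (inv (a + b))) (trans (cong (λ z → ½ * (a + b - (b - a) * z)) eq) (lem′ a b))
  where
  lem : ∀ a b c → ½ * (a + b) * (1ℚ - (b - a) * c) ≡ ½ * (a + b - (b - a) * ((a + b) * c))
  lem = solve-∀ ℚ-ring
  lem′ : ∀ a b → ½ * (a + b - (b - a) * 1ℚ) ≡ a
  lem′ = solve-∀ ℚ-ring

mid*[1+bias] : ∀ {a b} → 0ℚ ≤ a → 0ℚ ≤ b → mid a b * (1ℚ + bias a b) ≡ b
mid*[1+bias] {a} {b} 0≤a 0≤b =
  trans (lem (mid a b) (bias a b)) (trans (cong (λ z → 2ℚ * mid a b - z) (mid*[1-bias] 0≤a 0≤b)) (lem′ a b))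
  where
  lem : ∀ m u → m * (1ℚ + u) ≡ 2ℚ * m - m * (1ℚ - u)
  lem = solve-∀ ℚ-ring
  lem′ : ∀ a b → 2ℚ * (½ * (a + b)) - a ≡ b
  lem′ = solve-∀ ℚ-ring

bias≤1 : ∀ {a b} → 0ℚ ≤ a → 0ℚ ≤ b → bias a b ≤ 1ℚ
bias≤1 {a} {b} 0≤a 0≤b with biasView 0≤a 0≤b
... | null refl refl = 0≤1
... | nonnull 0<a+b eq = *-cancel-≤ (a + b) 0<a+b
  (≤-by (2ℚ * a) (trans (lem a b (inv (a + b))) (trans (cong (λ z → a + b - (b - a) * z) eq) (lem′ a b)))
        (0≤* (nonNegative⁻¹ 2ℚ) 0≤a))
  where
  lem : ∀ a b c → (a + b) * 1ℚ - (a + b) * ((b - a) * c) ≡ a + b - (b - a) * ((a + b) * c)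
  lem = solve-∀ ℚ-ring
  lem′ : ∀ a b → a + b - (b - a) * 1ℚ ≡ 2ℚ * a
  lem′ = solve-∀ ℚ-ring

-1≤bias : ∀ {a b} → 0ℚ ≤ a → 0ℚ ≤ b → 0ℚ ≤ 1ℚ + bias a b
-1≤bias {a} {b} 0≤a 0≤b with biasView 0≤a 0≤b
... | null refl refl = 0≤1
... | nonnull 0<a+b eq = *-cancel-≤ (a + b) 0<a+b
  (≤-by (2ℚ * b) (trans (lem a b (inv (a + b))) (trans (cong (λ z → a + b + (b - a) * z) eq) (lem′ a b)))
        (0≤* (nonNegative⁻¹ 2ℚ) 0≤b))
  where
  lem : ∀ a b c → (a + b) * (1ℚ + (b - a) * c) - (a + b) * 0ℚ ≡ a + b + (b - a) * ((a + b) * c)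
  lem = solve-∀ ℚ-ring
  lem′ : ∀ a b → a + b + (b - a) * 1ℚ ≡ 2ℚ * b
  lem′ = solve-∀ ℚ-ring

tri≡mid*bias² : ∀ {a b} → 0ℚ ≤ a → 0ℚ ≤ b → tri a b ≡ mid a b * (bias a b * bias a b)
tri≡mid*bias² {a} {b} 0≤a 0≤b =
  trans (cong₂ (λ x y → ½ * ((y - x) * bias a b)) (sym (mid*[1-bias] 0≤a 0≤b)) (sym (mid*[1+bias] 0≤a 0≤b)))
        (lem (mid a b) (bias a b))
  where
  lem : ∀ m u → ½ * ((m * (1ℚ + u) - m * (1ℚ - u)) * u) ≡ m * (u * u)
  lem = solve-∀ ℚ-ring

0≤mid : ∀ {a b} → 0ℚ ≤ a → 0ℚ ≤ b → 0ℚ ≤ mid a b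
0≤mid 0≤a 0≤b = 0≤* 0≤½ (0≤+ 0≤a 0≤b)

0≤tri : ∀ {a b} → 0ℚ ≤ a → 0ℚ ≤ b → 0ℚ ≤ tri a b
0≤tri {a} {b} 0≤a 0≤b = subst (0ℚ ≤_) (sym (tri≡mid*bias² 0≤a 0≤b)) (0≤* (0≤mid 0≤a 0≤b) (0≤sq (bias a b)))

-- Summed over all leaves, the second and third terms vanish, because the products involved are
-- probability distributions on the leaves.
leaf-value : ∀ {k} → (Fin k → ℚ) → (Fin k → ℚ) → ℚ
leaf-value a b =
  ½ * ∏ a - 8ℚ * (∏ (λ i → mid (a i) (b i)) - ∏ a)
  + 4ℚ * ∑ (λ i → ∏ (a [ i ≔ b i ]) - ∏ a)
  - 10ℚ * ∑ (λ i → ∏ (a [ i ≔ tri (a i) (b i) ]))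

module _ {k} (a b : Fin k → ℚ) (0≤a : ∀ i → 0ℚ ≤ a i) (0≤b : ∀ i → 0ℚ ≤ b i) where

  private
    m u : Fin k → ℚ
    m i = mid (a i) (b i)
    u i = bias (a i) (b i)

    P q q′ s v c T : ℚ
    P = ∏ m
    q = ∏ (λ i → 1ℚ - u i)
    q′ = ∏ (λ i → 1ℚ + u i)
    s = ∑ u
    v = ∑ (λ i → u i * u i)
    c = ½ * q - 8ℚ * (1ℚ - q - q * s) - v * q
    T = ∑ (λ i → ∏ (a [ i ≔ tri (a i) (b i) ]))

    u≤1 : ∀ i → u i ≤ 1ℚ
    u≤1 i = bias≤1 (0≤a i) (0≤b i)

    0≤1+u : ∀ i → 0ℚ ≤ 1ℚ + u i
    0≤1+u i = -1≤bias (0≤a i) (0≤b i)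

    0≤P : 0ℚ ≤ P
    0≤P = 0≤∏ (λ i → 0≤mid (0≤a i) (0≤b i))

    0≤q : 0ℚ ≤ q
    0≤q = 0≤∏ (λ i → 0≤diff (u≤1 i))

    0≤q′ : 0ℚ ≤ q′
    0≤q′ = 0≤∏ 0≤1+u

    0≤v : 0ℚ ≤ v
    0≤v = 0≤∑ (λ i → 0≤sq (u i))

    ∏a : P * q ≡ ∏ a
    ∏a = trans (sym (∏-* m _)) (∏-cong λ i → mid*[1-bias] (0≤a i) (0≤b i))

    ∏b : P * q′ ≡ ∏ b
    ∏b = trans (sym (∏-* m _)) (∏-cong λ i → mid*[1+bias] (0≤a i) (0≤b i))

    u²≤1 : ∀ i → u i * u i ≤ 1ℚ
    u²≤1 i = ≤-by ((1ℚ - u i) * (1ℚ + u i)) (lem (u i)) (0≤* (0≤diff (u≤1 i)) (0≤1+u i))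
      where
      lem : ∀ x → 1ℚ - x * x ≡ (1ℚ - x) * (1ℚ + x)
      lem = solve-∀ ℚ-ring

    qq′ : 1ℚ - v ≤ q * q′
    qq′ = ≤-trans (1-∑≤∏ _ (λ i → 0≤sq (u i)) u²≤1)
                  (≤-reflexive (trans (∏-cong (λ i → lem (u i))) (∏-* _ (λ i → 1ℚ + u i))))
      where
      lem : ∀ x → 1ℚ - x * x ≡ (1ℚ - x) * (1ℚ + x)
      lem = solve-∀ ℚ-ring

    -- Since `b - a = 2 m u = 2 (a u + m u²)`, changing one factor splits into a first-order part
    -- relative to `∏ a` and the squared part `tri`.
    flip≡ : ∀ i → ∏ (a [ i ≔ b i ]) - ∏ a ≡ 2ℚ * (∏ a * u i + ∏ (a [ i ≔ tri (a i) (b i) ]))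
    flip≡ i = begin
      ∏ (a [ i ≔ b i ]) - ∏ a
        ≡⟨ cong₂ _-_ (∏-update a i (b i)) (∏-split a i) ⟩
      b i * r - a i * r
        ≡⟨ cong₂ (λ x y → y * r - x * r) (sym a≡) (sym b≡) ⟩
      m i * (1ℚ + u i) * r - m i * (1ℚ - u i) * r
        ≡⟨ lem (m i) (u i) r ⟩
      2ℚ * (m i * (1ℚ - u i) * r * u i + m i * (u i * u i) * r)
        ≡⟨ cong₂ (λ x y → 2ℚ * (x * r * u i + y * r)) a≡ (sym (tri≡mid*bias² (0≤a i) (0≤b i))) ⟩
      2ℚ * (a i * r * u i + tri (a i) (b i) * r)
        ≡⟨ cong₂ (λ x y → 2ℚ * (x * u i + y)) (sym (∏-split a i)) (sym (∏-update a i _)) ⟩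
      2ℚ * (∏ a * u i + ∏ (a [ i ≔ tri (a i) (b i) ])) ∎
      where
      open ≡-Reasoning
      r : ℚ
      r = ∏-skip a i
      a≡ : m i * (1ℚ - u i) ≡ a i
      a≡ = mid*[1-bias] (0≤a i) (0≤b i)
      b≡ : m i * (1ℚ + u i) ≡ b i
      b≡ = mid*[1+bias] (0≤a i) (0≤b i)
      lem : ∀ m u r → m * (1ℚ + u) * r - m * (1ℚ - u) * r
            ≡ 2ℚ * (m * (1ℚ - u) * r * u + m * (u * u) * r)
      lem = solve-∀ ℚ-ring

    ∑flip≡ : ∑ (λ i → ∏ (a [ i ≔ b i ]) - ∏ a) ≡ 2ℚ * (∏ a * s + T)
    ∑flip≡ = trans (∑-cong flip≡) (trans (∑-*ˡ 2ℚ (λ i → ∏ a * u i + ∏ (a [ i ≔ tri (a i) (b i) ])))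
      (cong (2ℚ *_) (trans (∑-+ (λ i → ∏ a * u i) _) (cong (_+ T) (∑-*ˡ (∏ a) u)))))

    u²≤tri : ∀ i → ∏ a * (u i * u i) ≤ 2ℚ * ∏ (a [ i ≔ tri (a i) (b i) ])
    u²≤tri i = ≤-by ((1ℚ + u i) * (m i * (u i * u i)) * r)
      (trans (cong₂ (λ x y → 2ℚ * x - y * (u i * u i))
               (trans (∏-update a i _) (cong (_* r) (tri≡mid*bias² (0≤a i) (0≤b i))))
               (trans (∏-split a i) (cong (_* r) (sym (mid*[1-bias] (0≤a i) (0≤b i))))))
             (lem (m i) (u i) r))
      (0≤* (0≤* (0≤1+u i) (0≤* (0≤mid (0≤a i) (0≤b i)) (0≤sq (u i)))) (0≤∏-skip 0≤a i))
      where
      r : ℚ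
      r = ∏-skip a i
      lem : ∀ m u r → 2ℚ * (m * (u * u) * r) - m * (1ℚ - u) * r * (u * u)
            ≡ (1ℚ + u) * (m * (u * u)) * r
      lem = solve-∀ ℚ-ring

    v≤T : ∏ a * v ≤ 2ℚ * T
    v≤T = subst₂ _≤_ (∑-*ˡ (∏ a) (λ i → u i * u i))
                    (∑-*ˡ 2ℚ (λ i → ∏ (a [ i ≔ tri (a i) (b i) ]))) (∑-mono u²≤tri)

    -- Origin of the constants in `leaf-value`: the flips enter as `8 (∏ a * s + T)`, which
    -- completes the bracket `1 - q - q * s`; of the `10 T` subtracted, 8 cancel the `T` of the
    -- flips and 2 pay for `∏ a * v`.
    value≤ : leaf-value a b ≤ P * c
    value≤ = ≤-by (2ℚ * T - ∏ a * v)
      (trans (cong₂ (λ x y → P * c - (½ * x - 8ℚ * (P - x) + 4ℚ * y - 10ℚ * T)) (sym ∏a)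
               (trans ∑flip≡ (cong (λ x → 2ℚ * (x * s + T)) (sym ∏a))))
        (trans (lem P q s v T) (cong (λ x → 2ℚ * T - x * v) ∏a)))
      (0≤diff v≤T)
      where
      lem : ∀ P q s v T → P * (½ * q - 8ℚ * (1ℚ - q - q * s) - v * q)
              - (½ * (P * q) - 8ℚ * (P - P * q) + 4ℚ * (2ℚ * (P * q * s + T)) - 10ℚ * T)
              ≡ 2ℚ * T - P * q * v
      lem = solve-∀ ℚ-ring

    c≤q : c ≤ q
    c≤q = ≤-by (½ * q + 8ℚ * (1ℚ - q * (1ℚ + s)) + v * q) (lem q s v)
      (0≤+ (0≤+ (0≤* 0≤½ 0≤q) (0≤* (nonNegative⁻¹ 8ℚ) (0≤diff (∏-exp u u≤1)))) (0≤* 0≤v 0≤q))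
      where
      lem : ∀ q s v → q - (½ * q - 8ℚ * (1ℚ - q - q * s) - v * q)
            ≡ ½ * q + 8ℚ * (1ℚ - q * (1ℚ + s)) + v * q
      lem = solve-∀ ℚ-ring

  leaf-value≤∏₀ : leaf-value a b ≤ ∏ a
  leaf-value≤∏₀ = ≤-trans value≤ (subst (P * c ≤_) ∏a (*-mono-≤ˡ P 0≤P c≤q))

  leaf-value≤∏₁ : leaf-value a b ≤ ∏ b
  leaf-value≤∏₁ = ≤-trans value≤ (subst (P * c ≤_) ∏b (*-mono-≤ˡ P 0≤P
    (flip-bound q q′ s v 0≤q 0≤q′ 0≤v (∏-exp u u≤1) (∏-exp² u u≤1) qq′)))

-- A rational entropy function

-- For every slope `t` the left side is linear in `a` and `b`, and it is attained at `t = bias a b`,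
-- so `tri` is a supremum of linear functions. Convexity and scaling follow by fixing the slope,
-- without comparing quotients of different denominators.
tri-chord : ∀ {a b} → 0ℚ ≤ a → 0ℚ ≤ b → ∀ t →
            ½ * (2ℚ * t * (b - a) - t * t * (a + b)) ≤ tri a b
tri-chord {a} {b} 0≤a 0≤b t = ≤-by (m * ((u - t) * (u - t)))
  (trans (cong₂ _-_ (tri≡mid*bias² 0≤a 0≤b)
           (cong₂ (λ x y → ½ * (2ℚ * t * (y - x) - t * t * (x + y)))
                  (sym (mid*[1-bias] 0≤a 0≤b)) (sym (mid*[1+bias] 0≤a 0≤b))))
         (lem m u t))
  (0≤* (0≤mid 0≤a 0≤b) (0≤sq (u - t)))
  where
  m u : ℚ
  m = mid a b
  u = bias a b
  lem : ∀ m u t → m * (u * u) - ½ * (2ℚ * t * (m * (1ℚ + u) - m * (1ℚ - u))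
          - t * t * (m * (1ℚ - u) + m * (1ℚ + u))) ≡ m * ((u - t) * (u - t))
  lem = solve-∀ ℚ-ring

tri-chord-bias : ∀ {a b} → 0ℚ ≤ a → 0ℚ ≤ b → let t = bias a b in
                 tri a b ≡ ½ * (2ℚ * t * (b - a) - t * t * (a + b))
tri-chord-bias {a} {b} 0≤a 0≤b = trans (tri≡mid*bias² 0≤a 0≤b) (trans (lem m u)
  (cong₂ (λ x y → ½ * (2ℚ * u * (y - x) - u * u * (x + y))) (mid*[1-bias] 0≤a 0≤b) (mid*[1+bias] 0≤a 0≤b)))
  where
  m u : ℚ
  m = mid a b
  u = bias a b
  lem : ∀ m u → m * (u * u) ≡ ½ * (2ℚ * u * (m * (1ℚ + u) - m * (1ℚ - u))
          - u * u * (m * (1ℚ - u) + m * (1ℚ + u)))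
  lem = solve-∀ ℚ-ring

tri-convex : ∀ {a b a′ b′} → 0ℚ ≤ a → 0ℚ ≤ b → 0ℚ ≤ a′ → 0ℚ ≤ b′ →
             tri (mid a a′) (mid b b′) ≤ mid (tri a b) (tri a′ b′)
tri-convex {a} {b} {a′} {b′} 0≤a 0≤b 0≤a′ 0≤b′ = begin
  tri (mid a a′) (mid b b′)
    ≡⟨ tri-chord-bias (0≤mid 0≤a 0≤a′) (0≤mid 0≤b 0≤b′) ⟩
  ½ * (2ℚ * t * (mid b b′ - mid a a′) - t * t * (mid a a′ + mid b b′))
    ≡⟨ lem a b a′ b′ t ⟩
  mid (½ * (2ℚ * t * (b - a) - t * t * (a + b))) (½ * (2ℚ * t * (b′ - a′) - t * t * (a′ + b′)))
    ≤⟨ *-mono-≤ˡ ½ 0≤½ (+-mono-≤ (tri-chord 0≤a 0≤b t) (tri-chord 0≤a′ 0≤b′ t)) ⟩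
  mid (tri a b) (tri a′ b′) ∎
  where
  open ≤-Reasoning
  t : ℚ
  t = bias (mid a a′) (mid b b′)
  lem : ∀ a b a′ b′ t → ½ * (2ℚ * t * (½ * (b + b′) - ½ * (a + a′)) - t * t * (½ * (a + a′) + ½ * (b + b′)))
        ≡ ½ * (½ * (2ℚ * t * (b - a) - t * t * (a + b)) + ½ * (2ℚ * t * (b′ - a′) - t * t * (a′ + b′)))
  lem = solve-∀ ℚ-ring

tri-double : ∀ {a b} → 0ℚ ≤ a → 0ℚ ≤ b → tri a b ≤ ½ * tri (2ℚ * a) (2ℚ * b)
tri-double {a} {b} 0≤a 0≤b = begin
  tri a b
    ≡⟨ tri-chord-bias 0≤a 0≤b ⟩
  ½ * (2ℚ * t * (b - a) - t * t * (a + b))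
    ≡⟨ lem a b t ⟩
  ½ * (½ * (2ℚ * t * (2ℚ * b - 2ℚ * a) - t * t * (2ℚ * a + 2ℚ * b)))
    ≤⟨ *-mono-≤ˡ ½ 0≤½ (tri-chord (0≤* (nonNegative⁻¹ 2ℚ) 0≤a) (0≤* (nonNegative⁻¹ 2ℚ) 0≤b) t) ⟩
  ½ * tri (2ℚ * a) (2ℚ * b) ∎
  where
  open ≤-Reasoning
  t : ℚ
  t = bias a b
  lem : ∀ a b t → ½ * (2ℚ * t * (b - a) - t * t * (a + b))
        ≡ ½ * (½ * (2ℚ * t * (2ℚ * b - 2ℚ * a) - t * t * (2ℚ * a + 2ℚ * b)))
  lem = solve-∀ ℚ-ring

tri≤sq : ∀ {a b} → 0ℚ ≤ a → 0ℚ ≤ b → ½ ≤ a + b → tri a b ≤ (a - b) * (a - b)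
tri≤sq {a} {b} 0≤a 0≤b ½≤a+b = ≤-by ((a + b - ½) * (2ℚ * (m * (u * u))))
  (begin
    (a - b) * (a - b) - tri a b
      ≡⟨ cong₂ (λ x y → (x - y) * (x - y) - tri a b) (sym a≡) (sym b≡) ⟩
    (m * (1ℚ - u) - m * (1ℚ + u)) * (m * (1ℚ - u) - m * (1ℚ + u)) - tri a b
      ≡⟨ cong (λ z → (m * (1ℚ - u) - m * (1ℚ + u)) * (m * (1ℚ - u) - m * (1ℚ + u)) - z) (tri≡mid*bias² 0≤a 0≤b) ⟩
    (m * (1ℚ - u) - m * (1ℚ + u)) * (m * (1ℚ - u) - m * (1ℚ + u)) - m * (u * u)
      ≡⟨ lem m u ⟩
    (m * (1ℚ - u) + m * (1ℚ + u) - ½) * (2ℚ * (m * (u * u)))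
      ≡⟨ cong₂ (λ x y → (x + y - ½) * (2ℚ * (m * (u * u)))) a≡ b≡ ⟩
    (a + b - ½) * (2ℚ * (m * (u * u))) ∎)
  (0≤* (0≤diff ½≤a+b) (0≤* (nonNegative⁻¹ 2ℚ) (0≤* (0≤mid 0≤a 0≤b) (0≤sq u))))
  where
  open ≡-Reasoning
  m u : ℚ
  m = mid a b
  u = bias a b
  a≡ : m * (1ℚ - u) ≡ a
  a≡ = mid*[1-bias] 0≤a 0≤b
  b≡ : m * (1ℚ + u) ≡ b
  b≡ = mid*[1+bias] 0≤a 0≤b
  lem : ∀ m u → (m * (1ℚ - u) - m * (1ℚ + u)) * (m * (1ℚ - u) - m * (1ℚ + u)) - m * (u * u)
        ≡ (m * (1ℚ - u) + m * (1ℚ + u) - ½) * (2ℚ * (m * (u * u)))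
  lem = solve-∀ ℚ-ring

-- Truncated parabolas and their sum over dyadic scales.

ramp : ℚ → ℚ
ramp x = 0ℚ ⊔ (1ℚ - x)

0≤ramp : ∀ x → 0ℚ ≤ ramp x
0≤ramp x = p≤p⊔q 0ℚ (1ℚ - x)

1-x≤ramp : ∀ x → 1ℚ - x ≤ ramp x
1-x≤ramp x = p≤q⊔p 0ℚ (1ℚ - x)

ramp-small : ∀ {x} → x ≤ 1ℚ → ramp x ≡ 1ℚ - x
ramp-small {x} x≤1 = p≤q⇒p⊔q≡q {0ℚ} {1ℚ - x} (0≤diff x≤1)

ramp≤1 : ∀ {x} → 0ℚ ≤ x → ramp x ≤ 1ℚ
ramp≤1 {x} 0≤x = ⊔-lub 0≤1 1-x≤1
  where
  lem : ∀ x → 1ℚ - (1ℚ - x) ≡ x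
  lem = solve-∀ ℚ-ring
  1-x≤1 : 1ℚ - x ≤ 1ℚ
  1-x≤1 = ≤-by x (lem x) 0≤x

ramp-mid : ∀ x y → ramp (mid x y) ≤ mid (ramp x) (ramp y)
ramp-mid x y = ⊔-lub (0≤mid (0≤ramp x) (0≤ramp y))
  (subst (_≤ mid (ramp x) (ramp y)) (lem x y) (*-mono-≤ˡ ½ 0≤½ (+-mono-≤ (1-x≤ramp x) (1-x≤ramp y))))
  where
  lem : ∀ x y → ½ * ((1ℚ - x) + (1ℚ - y)) ≡ 1ℚ - ½ * (x + y)
  lem = solve-∀ ℚ-ring

-- Equal to `2 x - x²` for `x ≤ 1` and to 1 beyond: concave, and curved only below 1.
hump : ℚ → ℚ
hump x = 1ℚ - ramp x * ramp x

0≤hump : ∀ {x} → 0ℚ ≤ x → 0ℚ ≤ hump x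
0≤hump {x} 0≤x = 0≤diff (*-mono-≤₂ 0≤1 (0≤ramp x) (ramp≤1 0≤x) (ramp≤1 0≤x))

hump≤ : ∀ x → hump x ≤ 2ℚ * x
hump≤ x = ≤-by (2ℚ * (ramp x - (1ℚ - x)) + (1ℚ - ramp x) * (1ℚ - ramp x)) (lem x (ramp x))
  (0≤+ (0≤* (nonNegative⁻¹ 2ℚ) (0≤diff (1-x≤ramp x))) (0≤sq (1ℚ - ramp x)))
  where
  lem : ∀ x r → 2ℚ * x - (1ℚ - r * r) ≡ 2ℚ * (r - (1ℚ - x)) + (1ℚ - r) * (1ℚ - r)
  lem = solve-∀ ℚ-ring

-- The squares of two numbers `r` and `s` average to the square of their mean plus `(½ (r - s))²`,
-- and convexity of `ramp` puts its value at the midpoint below that mean.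
hump-gap : ∀ x y → ½ * (ramp x - ramp y) * (½ * (ramp x - ramp y)) ≤ hump (mid x y) - mid (hump x) (hump y)
hump-gap x y = ≤-by (mid r s * mid r s - t * t) (lem r s t)
  (0≤diff (*-mono-≤₂ (0≤mid (0≤ramp x) (0≤ramp y)) (0≤ramp (mid x y)) (ramp-mid x y) (ramp-mid x y)))
  where
  r s t : ℚ
  r = ramp x
  s = ramp y
  t = ramp (mid x y)
  lem : ∀ r s t → 1ℚ - t * t - ½ * (1ℚ - r * r + (1ℚ - s * s)) - ½ * (r - s) * (½ * (r - s))
        ≡ ½ * (r + s) * (½ * (r + s)) - t * t
  lem = solve-∀ ℚ-ring

hump-concave : ∀ x y → mid (hump x) (hump y) ≤ hump (mid x y)
hump-concave x y = ≤-by (hump (mid x y) - mid (hump x) (hump y)) refl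
  (≤-trans (0≤sq (½ * (ramp x - ramp y))) (hump-gap x y))

hump-tri : ∀ {x y} → 0ℚ ≤ x → 0ℚ ≤ y → x ≤ 1ℚ → y ≤ 1ℚ → ½ ≤ x + y →
           tri x y ≤ 4ℚ * (hump (mid x y) - mid (hump x) (hump y))
hump-tri {x} {y} 0≤x 0≤y x≤1 y≤1 ½≤x+y = begin
  tri x y
    ≤⟨ tri≤sq 0≤x 0≤y ½≤x+y ⟩
  (x - y) * (x - y)
    ≡⟨ lem x y ⟩
  4ℚ * (½ * ((1ℚ - x) - (1ℚ - y)) * (½ * ((1ℚ - x) - (1ℚ - y))))
    ≡⟨ cong₂ (λ r s → 4ℚ * (½ * (r - s) * (½ * (r - s)))) (sym (ramp-small x≤1)) (sym (ramp-small y≤1)) ⟩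
  4ℚ * (½ * (ramp x - ramp y) * (½ * (ramp x - ramp y)))
    ≤⟨ *-mono-≤ˡ 4ℚ (nonNegative⁻¹ 4ℚ) (hump-gap x y) ⟩
  4ℚ * (hump (mid x y) - mid (hump x) (hump y)) ∎
  where
  open ≤-Reasoning
  lem : ∀ x y → (x - y) * (x - y) ≡ 4ℚ * (½ * ((1ℚ - x) - (1ℚ - y)) * (½ * ((1ℚ - x) - (1ℚ - y))))
  lem = solve-∀ ℚ-ring

-- A rational substitute for the entropy function x log (1/x) on [0,1]: up to an affine term, humps at
-- all dyadic scales 2^-q add up to it, with second derivative about -1/x for x ≥ 2^-Q.
Φ : ℕ → ℚ → ℚ
Φ zero    x = hump x
Φ (suc Q) x = hump x + ½ * Φ Q (2ℚ * x)

private
  2*mid : ∀ x y → 2ℚ * (½ * (x + y)) ≡ ½ * (2ℚ * x + 2ℚ * y)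
  2*mid = solve-∀ ℚ-ring

  0≤2* : ∀ {x} → 0ℚ ≤ x → 0ℚ ≤ 2ℚ * x
  0≤2* = 0≤* (nonNegative⁻¹ 2ℚ)

0≤Φ : ∀ Q {x} → 0ℚ ≤ x → 0ℚ ≤ Φ Q x
0≤Φ zero    0≤x = 0≤hump 0≤x
0≤Φ (suc Q) 0≤x = 0≤+ (0≤hump 0≤x) (0≤* 0≤½ (0≤Φ Q (0≤2* 0≤x)))

Φ-step : ∀ Q {x} → 0ℚ ≤ x → Φ Q x ≤ Φ (suc Q) x
Φ-step zero    {x} 0≤x = ≤-by (½ * hump (2ℚ * x)) (lem (hump x) _) (0≤* 0≤½ (0≤hump (0≤2* 0≤x)))
  where
  lem : ∀ a b → a + b - a ≡ b
  lem = solve-∀ ℚ-ring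
Φ-step (suc Q) {x} 0≤x = +-monoʳ-≤ (hump x) (*-mono-≤ˡ ½ 0≤½ (Φ-step Q (0≤2* 0≤x)))

Φ-concave : ∀ Q x y → mid (Φ Q x) (Φ Q y) ≤ Φ Q (mid x y)
Φ-concave zero    x y = hump-concave x y
Φ-concave (suc Q) x y = begin
  mid (hump x + ½ * Φ Q (2ℚ * x)) (hump y + ½ * Φ Q (2ℚ * y))
    ≡⟨ lem (hump x) (hump y) (Φ Q (2ℚ * x)) (Φ Q (2ℚ * y)) ⟩
  mid (hump x) (hump y) + ½ * mid (Φ Q (2ℚ * x)) (Φ Q (2ℚ * y))
    ≤⟨ +-mono-≤ (hump-concave x y) (*-mono-≤ˡ ½ 0≤½ (Φ-concave Q (2ℚ * x) (2ℚ * y))) ⟩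
  hump (mid x y) + ½ * Φ Q (mid (2ℚ * x) (2ℚ * y))
    ≡⟨ cong (λ z → hump (mid x y) + ½ * Φ Q z) (sym (2*mid x y)) ⟩
  Φ (suc Q) (mid x y) ∎
  where
  open ≤-Reasoning
  lem : ∀ a b c d → ½ * ((a + ½ * c) + (b + ½ * d)) ≡ ½ * (a + b) + ½ * (½ * (c + d))
  lem = solve-∀ ℚ-ring

-- Halving the argument shifts the dyadic scales by one, so the excess is a single hump, bounded
-- linearly. For `x log (1/x)` the corresponding excess is `z log 2`.
Φ-half : ∀ Q {z} → 0ℚ ≤ z → 2ℚ * Φ Q (½ * z) ≤ Φ Q z + 2ℚ * z
Φ-half zero {z} 0≤z = ≤-by (hump z + 2ℚ * (2ℚ * (½ * z) - hump (½ * z))) (lem (hump z) z (hump (½ * z)))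
  (0≤+ (0≤hump 0≤z) (0≤* (nonNegative⁻¹ 2ℚ) (0≤diff (hump≤ (½ * z)))))
  where
  lem : ∀ h z g → h + 2ℚ * z - 2ℚ * g ≡ h + 2ℚ * (2ℚ * (½ * z) - g)
  lem = solve-∀ ℚ-ring
Φ-half (suc Q) {z} 0≤z = begin
  2ℚ * (hump (½ * z) + ½ * Φ Q (2ℚ * (½ * z)))
    ≡⟨ cong (λ w → 2ℚ * (hump (½ * z) + ½ * Φ Q w)) (2*½* z) ⟩
  2ℚ * (hump (½ * z) + ½ * Φ Q z)
    ≡⟨ lem (hump (½ * z)) (Φ Q z) ⟩
  Φ Q z + 2ℚ * hump (½ * z)
    ≤⟨ +-mono-≤ (Φ-step Q 0≤z) (*-mono-≤ˡ 2ℚ (nonNegative⁻¹ 2ℚ) (hump≤ (½ * z))) ⟩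
  Φ (suc Q) z + 2ℚ * (2ℚ * (½ * z))
    ≡⟨ cong (λ w → Φ (suc Q) z + 2ℚ * w) (2*½* z) ⟩
  Φ (suc Q) z + 2ℚ * z ∎
  where
  open ≤-Reasoning
  2*½* : ∀ z → 2ℚ * (½ * z) ≡ z
  2*½* = solve-∀ ℚ-ring
  lem : ∀ a b → 2ℚ * (a + ½ * b) ≡ b + 2ℚ * a
  lem = solve-∀ ℚ-ring

-- The price of one bit: by concavity the even split is the worst, and `Φ-half` bounds it. In a
-- protocol tree, sending a bit raises the entropy by at most twice the probability of the node.
Φ-split : ∀ Q {x y} → 0ℚ ≤ x → 0ℚ ≤ y → Φ Q x + Φ Q y ≤ Φ Q (x + y) + 2ℚ * (x + y)
Φ-split Q {x} {y} 0≤x 0≤y = begin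
  Φ Q x + Φ Q y               ≡⟨ lem (Φ Q x) (Φ Q y) ⟩
  2ℚ * mid (Φ Q x) (Φ Q y)    ≤⟨ *-mono-≤ˡ 2ℚ (nonNegative⁻¹ 2ℚ) (Φ-concave Q x y) ⟩
  2ℚ * Φ Q (mid x y)          ≤⟨ Φ-half Q (0≤+ 0≤x 0≤y) ⟩
  Φ Q (x + y) + 2ℚ * (x + y)  ∎
  where
  open ≤-Reasoning
  lem : ∀ a b → a + b ≡ 2ℚ * (½ * (a + b))
  lem = solve-∀ ℚ-ring

½^ : ℕ → ℚ
½^ zero    = 1ℚ
½^ (suc Q) = ½ * ½^ Q

-- The scale of the pair decides which hump pays: the outermost one if `½ ≤ x + y`, otherwise both
-- arguments are doubled. The hypothesis `½^ Q ≤ x + y` ensures that the scales do not run out.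
Φ-tri : ∀ Q {x y} → 0ℚ ≤ x → 0ℚ ≤ y → x ≤ 1ℚ → y ≤ 1ℚ → ½^ Q ≤ x + y →
        tri x y ≤ 4ℚ * (Φ Q (mid x y) - mid (Φ Q x) (Φ Q y))
Φ-tri zero    0≤x 0≤y x≤1 y≤1 1≤x+y = hump-tri 0≤x 0≤y x≤1 y≤1 (≤-trans ½≤1 1≤x+y)
  where
  ½≤1 : ½ ≤ 1ℚ
  ½≤1 = ≤-by ½ refl 0≤½
Φ-tri (suc Q) {x} {y} 0≤x 0≤y x≤1 y≤1 h with ≤-total ½ (x + y)
... | inj₁ ½≤x+y = begin
  tri x y
    ≤⟨ hump-tri 0≤x 0≤y x≤1 y≤1 ½≤x+y ⟩
  4ℚ * (hump (mid x y) - mid (hump x) (hump y))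
    ≤⟨ *-mono-≤ˡ {hump (mid x y) - mid (hump x) (hump y)} {Φ (suc Q) (mid x y) - mid (Φ (suc Q) x) (Φ (suc Q) y)}
         4ℚ (nonNegative⁻¹ 4ℚ) (≤-by (½ * (Φ Q (mid (2ℚ * x) (2ℚ * y)) - mid c d))
         (trans (cong (λ w → hump (mid x y) + ½ * Φ Q w - mid (hump x + ½ * c) (hump y + ½ * d)
                               - (hump (mid x y) - mid (hump x) (hump y))) (2*mid x y))
           (lem (hump (mid x y)) (hump x) (hump y) e c d))
         (0≤* 0≤½ (0≤diff (Φ-concave Q (2ℚ * x) (2ℚ * y))))) ⟩
  4ℚ * (Φ (suc Q) (mid x y) - mid (Φ (suc Q) x) (Φ (suc Q) y)) ∎
  where
  open ≤-Reasoning
  c d e : ℚ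
  e = Φ Q (mid (2ℚ * x) (2ℚ * y))
  c = Φ Q (2ℚ * x)
  d = Φ Q (2ℚ * y)
  lem : ∀ h a b e c d → h + ½ * e - ½ * (a + ½ * c + (b + ½ * d)) - (h - ½ * (a + b))
        ≡ ½ * (e - ½ * (c + d))
  lem = solve-∀ ℚ-ring
... | inj₂ x+y≤½ = begin
  tri x y
    ≤⟨ tri-double 0≤x 0≤y ⟩
  ½ * tri (2ℚ * x) (2ℚ * y)
    ≤⟨ *-mono-≤ˡ ½ 0≤½ (Φ-tri Q (0≤2* 0≤x) (0≤2* 0≤y)
         (double≤1 {x} {y} 0≤y x+y≤½)
         (double≤1 {y} {x} 0≤x (subst (_≤ ½) (+-comm x y) x+y≤½))
         (subst₂ _≤_ (2*½* (½^ Q)) (*-distribˡ-+ 2ℚ x y) (*-mono-≤ˡ 2ℚ (nonNegative⁻¹ 2ℚ) h))) ⟩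
  ½ * (4ℚ * (Φ Q (mid (2ℚ * x) (2ℚ * y)) - mid c d))
    ≤⟨ ≤-by (4ℚ * (hump (mid x y) - mid (hump x) (hump y)))
         (trans (cong (λ w → 4ℚ * (hump (mid x y) + ½ * Φ Q w - mid (hump x + ½ * c) (hump y + ½ * d))
                               - ½ * (4ℚ * (Φ Q (mid (2ℚ * x) (2ℚ * y)) - mid c d))) (2*mid x y))
           (lem (hump (mid x y)) (hump x) (hump y) e c d))
         (0≤* (nonNegative⁻¹ 4ℚ) (0≤diff (hump-concave x y))) ⟩
  4ℚ * (Φ (suc Q) (mid x y) - mid (Φ (suc Q) x) (Φ (suc Q) y)) ∎
  where
  open ≤-Reasoning
  c d e : ℚ
  e = Φ Q (mid (2ℚ * x) (2ℚ * y))
  c = Φ Q (2ℚ * x)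
  d = Φ Q (2ℚ * y)
  2*½* : ∀ z → 2ℚ * (½ * z) ≡ z
  2*½* = solve-∀ ℚ-ring
  double≤1 : ∀ {x y} → 0ℚ ≤ y → x + y ≤ ½ → 2ℚ * x ≤ 1ℚ
  double≤1 {x} {y} 0≤y x+y≤½ = ≤-by (2ℚ * (½ - (x + y)) + 2ℚ * y) (lem₁ x y)
    (0≤+ (0≤2* (0≤diff x+y≤½)) (0≤2* 0≤y))
    where
    lem₁ : ∀ x y → 1ℚ - 2ℚ * x ≡ 2ℚ * (½ - (x + y)) + 2ℚ * y
    lem₁ = solve-∀ ℚ-ring
  lem : ∀ h a b e c d → 4ℚ * (h + ½ * e - ½ * (a + ½ * c + (b + ½ * d))) - ½ * (4ℚ * (e - ½ * (c + d)))
        ≡ 4ℚ * (h - ½ * (a + b))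
  lem = solve-∀ ℚ-ring

-- Finite distributions

private variable
  A B : Set

⟦_⟧ : Bool → ℚ
⟦ true ⟧  = 1ℚ
⟦ false ⟧ = 0ℚ

0≤⟦_⟧ : ∀ b → 0ℚ ≤ ⟦ b ⟧
0≤⟦ true ⟧  = 0≤1
0≤⟦ false ⟧ = ≤-refl

⟦_⟧≤1 : ∀ b → ⟦ b ⟧ ≤ 1ℚ
⟦ true ⟧≤1  = ≤-refl
⟦ false ⟧≤1 = 0≤1

⟦∧⟧ : ∀ a b → ⟦ a ∧ b ⟧ ≡ ⟦ a ⟧ * ⟦ b ⟧
⟦∧⟧ true  b = sym (*-identityˡ ⟦ b ⟧)
⟦∧⟧ false b = sym (*-zeroˡ ⟦ b ⟧)

sumᴸ : List A → (A → ℚ) → ℚ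
sumᴸ []       h = 0ℚ
sumᴸ (x ∷ xs) h = h x + sumᴸ xs h

sumᴸ-cong : ∀ (xs : List A) {g h : A → ℚ} → (∀ x → g x ≡ h x) → sumᴸ xs g ≡ sumᴸ xs h
sumᴸ-cong []       g≗h = refl
sumᴸ-cong (x ∷ xs) g≗h = cong₂ _+_ (g≗h x) (sumᴸ-cong xs g≗h)

sumᴸ-mono : ∀ (xs : List A) {g h : A → ℚ} → (∀ x → g x ≤ h x) → sumᴸ xs g ≤ sumᴸ xs h
sumᴸ-mono []       g≤h = ≤-refl
sumᴸ-mono (x ∷ xs) g≤h = +-mono-≤ (g≤h x) (sumᴸ-mono xs g≤h)

sumᴸ-0 : ∀ (xs : List A) → sumᴸ xs (λ _ → 0ℚ) ≡ 0ℚ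
sumᴸ-0 []       = refl
sumᴸ-0 (x ∷ xs) = trans (+-identityˡ _) (sumᴸ-0 xs)

sumᴸ-+ : ∀ (xs : List A) (g h : A → ℚ) → sumᴸ xs (λ x → g x + h x) ≡ sumᴸ xs g + sumᴸ xs h
sumᴸ-+ []       g h = refl
sumᴸ-+ (x ∷ xs) g h = trans (cong (g x + h x +_) (sumᴸ-+ xs g h)) (lem (g x) (h x) (sumᴸ xs g) (sumᴸ xs h))
  where
  lem : ∀ a b c d → a + b + (c + d) ≡ a + c + (b + d)
  lem = solve-∀ ℚ-ring

sumᴸ-*ˡ : ∀ (xs : List A) c (h : A → ℚ) → sumᴸ xs (λ x → c * h x) ≡ c * sumᴸ xs h
sumᴸ-*ˡ []       c h = sym (*-zeroʳ c)
sumᴸ-*ˡ (x ∷ xs) c h = trans (cong (c * h x +_) (sumᴸ-*ˡ xs c h)) (sym (*-distribˡ-+ c (h x) (sumᴸ xs h)))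

sumᴸ-swap : ∀ (xs : List A) (ys : List B) (h : A → B → ℚ) →
            sumᴸ xs (λ x → sumᴸ ys (h x)) ≡ sumᴸ ys (λ y → sumᴸ xs (λ x → h x y))
sumᴸ-swap []       ys h = sym (sumᴸ-0 ys)
sumᴸ-swap (x ∷ xs) ys h = trans (cong (sumᴸ ys (h x) +_) (sumᴸ-swap xs ys h))
                                (sym (sumᴸ-+ ys (h x) (λ y → sumᴸ xs (λ x → h x y))))

sumᴸ-++ : ∀ (xs ys : List A) h → sumᴸ (xs ++ ys) h ≡ sumᴸ xs h + sumᴸ ys h
sumᴸ-++ []       ys h = sym (+-identityˡ (sumᴸ ys h))
sumᴸ-++ (x ∷ xs) ys h = trans (cong (h x +_) (sumᴸ-++ xs ys h)) (sym (+-assoc (h x) (sumᴸ xs h) (sumᴸ ys h)))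

sumᴸ-map : ∀ (f : A → B) xs h → sumᴸ (map f xs) h ≡ sumᴸ xs (h ∘ f)
sumᴸ-map f []       h = refl
sumᴸ-map f (x ∷ xs) h = cong (h (f x) +_) (sumᴸ-map f xs h)

sumᴸ-concatMap : ∀ (f : A → List B) xs h → sumᴸ (concatMap f xs) h ≡ sumᴸ xs (λ x → sumᴸ (f x) h)
sumᴸ-concatMap f []       h = refl
sumᴸ-concatMap f (x ∷ xs) h = trans (sumᴸ-++ (f x) (concatMap f xs) h) (cong (sumᴸ (f x) h +_) (sumᴸ-concatMap f xs h))

-- Vectors stand for functions on `Fin m`, since `Enumerates` requires a decidable equality.
vecs : List A → ∀ m → List (Vec A m)
vecs xs zero    = [] ∷ []
vecs xs (suc m) = concatMap (λ x → map (x ∷_) (vecs xs m)) xs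

sumᴸ-vecs : ∀ (xs : List A) m (h : Vec A (suc m) → ℚ) →
            sumᴸ (vecs xs (suc m)) h ≡ sumᴸ xs (λ x → sumᴸ (vecs xs m) (h ∘ (x ∷_)))
sumᴸ-vecs xs m h = trans (sumᴸ-concatMap (λ x → map (x ∷_) (vecs xs m)) xs h)
                         (sumᴸ-cong xs λ x → sumᴸ-map (x ∷_) (vecs xs m) h)

Enumerates : DecidableEquality A → List A → Set
Enumerates _≟′_ xs = ∀ y → sumᴸ xs (λ x → ⟦ does (x ≟′ y) ⟧) ≡ 1ℚ

module _ (_≟′_ : DecidableEquality A) (xs : List A) (enum : Enumerates _≟′_ xs) where

  sumᴸ-δ : ∀ (h : A → ℚ) y → sumᴸ xs (λ x → ⟦ does (x ≟′ y) ⟧ * h x) ≡ h y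
  sumᴸ-δ h y = begin
    sumᴸ xs (λ x → ⟦ does (x ≟′ y) ⟧ * h x)  ≡⟨ sumᴸ-cong xs same ⟩
    sumᴸ xs (λ x → h y * ⟦ does (x ≟′ y) ⟧)  ≡⟨ sumᴸ-*ˡ xs (h y) (λ x → ⟦ does (x ≟′ y) ⟧) ⟩
    h y * sumᴸ xs (λ x → ⟦ does (x ≟′ y) ⟧)  ≡⟨ cong (h y *_) (enum y) ⟩
    h y * 1ℚ                                ≡⟨ *-identityʳ (h y) ⟩
    h y                                     ∎
    where
    open ≡-Reasoning
    same : ∀ x → ⟦ does (x ≟′ y) ⟧ * h x ≡ h y * ⟦ does (x ≟′ y) ⟧
    same x with x ≟′ y
    ... | yes refl = *-comm 1ℚ (h x)
    ... | no _     = trans (*-zeroˡ (h x)) (sym (*-zeroʳ (h y)))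

  -- Each `h (φ x)` is expanded as a sum over `y` of indicators of `y = φ x`; after exchanging the
  -- sums, the condition is read as `x = ψ y`. No rearrangement of the list is involved.
  sumᴸ-reindex : ∀ (φ ψ : A → A) → (∀ y → φ (ψ y) ≡ y) → (∀ x → ψ (φ x) ≡ x) →
                 ∀ (h : A → ℚ) → sumᴸ xs (h ∘ φ) ≡ sumᴸ xs h
  sumᴸ-reindex φ ψ φψ ψφ h = begin
    sumᴸ xs (h ∘ φ)
      ≡⟨ sumᴸ-cong xs (λ x → sym (sumᴸ-δ h (φ x))) ⟩
    sumᴸ xs (λ x → sumᴸ xs (λ y → ⟦ does (y ≟′ φ x) ⟧ * h y))
      ≡⟨ sumᴸ-swap xs xs (λ x y → ⟦ does (y ≟′ φ x) ⟧ * h y) ⟩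
    sumᴸ xs (λ y → sumᴸ xs (λ x → ⟦ does (y ≟′ φ x) ⟧ * h y))
      ≡⟨ sumᴸ-cong xs inner ⟩
    sumᴸ xs h ∎
    where
    open ≡-Reasoning
    inner : ∀ y → sumᴸ xs (λ x → ⟦ does (y ≟′ φ x) ⟧ * h y) ≡ h y
    inner y = trans (sumᴸ-cong xs λ x → cong (λ b → ⟦ b ⟧ * h y)
      (does-⇔ (mk⇔ (λ y≡φx → trans (sym (ψφ x)) (cong ψ (sym y≡φx)))
                   (λ x≡ψy → trans (sym (φψ y)) (cong φ (sym x≡ψy)))) (y ≟′ φ x) (x ≟′ ψ y)))
      (sumᴸ-δ (λ _ → h y) (ψ y))

enumerates-vecs : (_≟′_ : DecidableEquality A) (xs : List A) → Enumerates _≟′_ xs →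
                  ∀ m → Enumerates (Vecₚ.≡-dec _≟′_) (vecs xs m)
enumerates-vecs _≟′_ xs enum zero    []       = refl
enumerates-vecs _≟′_ xs enum (suc m) (y ∷ ys) = begin
  sumᴸ (vecs xs (suc m)) (λ v → ⟦ does (v ≟ᵛ (y ∷ ys)) ⟧)
    ≡⟨ sumᴸ-vecs xs m _ ⟩
  sumᴸ xs (λ x → sumᴸ (vecs xs m) (λ v → ⟦ does ((x ∷ v) ≟ᵛ (y ∷ ys)) ⟧))
    ≡⟨ sumᴸ-cong xs (λ x → trans (sumᴸ-cong (vecs xs m) (split x)) (sumᴸ-*ˡ (vecs xs m) ⟦ does (x ≟′ y) ⟧ _)) ⟩
  sumᴸ xs (λ x → ⟦ does (x ≟′ y) ⟧ * sumᴸ (vecs xs m) (λ v → ⟦ does (v ≟ᵛ ys) ⟧))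
    ≡⟨ sumᴸ-δ _≟′_ xs enum (λ _ → sumᴸ (vecs xs m) (λ v → ⟦ does (v ≟ᵛ ys) ⟧)) y ⟩
  sumᴸ (vecs xs m) (λ v → ⟦ does (v ≟ᵛ ys) ⟧)
    ≡⟨ enumerates-vecs _≟′_ xs enum m ys ⟩
  1ℚ ∎
  where
  open ≡-Reasoning
  _≟ᵛ_ : ∀ {m} → DecidableEquality (Vec _ m)
  _≟ᵛ_ = Vecₚ.≡-dec _≟′_
  split : ∀ x v → ⟦ does ((x ∷ v) ≟ᵛ (y ∷ ys)) ⟧ ≡ ⟦ does (x ≟′ y) ⟧ * ⟦ does (v ≟ᵛ ys) ⟧
  split x v = ⟦∧⟧ (does (x ≟′ y)) (does (v ≟ᵛ ys))

fins : ∀ n → List (Fin n)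
fins zero    = []
fins (suc n) = fzero ∷ map fsuc (fins n)

enumerates-fins : ∀ n → Enumerates Finₚ._≟_ (fins n)
enumerates-fins (suc n) fzero    = cong (1ℚ +_) (trans (sumᴸ-map fsuc (fins n) _) (sumᴸ-0 (fins n)))
enumerates-fins (suc n) (fsuc y) = trans (+-identityˡ _) (trans (sumᴸ-map fsuc (fins n) _) (enumerates-fins n y))

bools : List Bool
bools = false ∷ true ∷ []

enumerates-bools : Enumerates 𝔹._≟_ bools
enumerates-bools false = refl
enumerates-bools true  = refl

-- Expectations, product distributions and fair coins.

record Dist (A : Set) : Set where
  field
    support  : List A
    weight   : A → ℚ
    0≤weight : ∀ x → 0ℚ ≤ weight x
    total    : sumᴸ support weight ≡ 1ℚ
open Dist

𝔼 : Dist A → (A → ℚ) → ℚ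
𝔼 D h = sumᴸ (support D) (λ x → weight D x * h x)

module _ (D : Dist A) where

  𝔼-cong : ∀ {g h : A → ℚ} → (∀ x → g x ≡ h x) → 𝔼 D g ≡ 𝔼 D h
  𝔼-cong g≗h = sumᴸ-cong (support D) λ x → cong (weight D x *_) (g≗h x)

  𝔼-mono : ∀ {g h : A → ℚ} → (∀ x → g x ≤ h x) → 𝔼 D g ≤ 𝔼 D h
  𝔼-mono g≤h = sumᴸ-mono (support D) λ x → *-mono-≤ˡ (weight D x) (0≤weight D x) (g≤h x)

  𝔼-+ : ∀ (g h : A → ℚ) → 𝔼 D (λ x → g x + h x) ≡ 𝔼 D g + 𝔼 D h
  𝔼-+ g h = trans (sumᴸ-cong (support D) λ x → *-distribˡ-+ (weight D x) (g x) (h x)) (sumᴸ-+ (support D) _ _)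

  𝔼-*ˡ : ∀ c (h : A → ℚ) → 𝔼 D (λ x → c * h x) ≡ c * 𝔼 D h
  𝔼-*ˡ c h = trans (sumᴸ-cong (support D) λ x → lem (weight D x) c (h x)) (sumᴸ-*ˡ (support D) c _)
    where
    lem : ∀ w c h → w * (c * h) ≡ c * (w * h)
    lem = solve-∀ ℚ-ring

  𝔼-const : ∀ c → 𝔼 D (λ _ → c) ≡ c
  𝔼-const c = begin
    sumᴸ (support D) (λ x → weight D x * c)  ≡⟨ sumᴸ-cong (support D) (λ x → *-comm (weight D x) c) ⟩
    sumᴸ (support D) (λ x → c * weight D x)  ≡⟨ sumᴸ-*ˡ (support D) c (weight D) ⟩
    c * sumᴸ (support D) (weight D)          ≡⟨ cong (c *_) (total D) ⟩
    c * 1ℚ                                   ≡⟨ *-identityʳ c ⟩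
    c                                        ∎
    where open ≡-Reasoning

  0≤𝔼 : ∀ {h : A → ℚ} → (∀ x → 0ℚ ≤ h x) → 0ℚ ≤ 𝔼 D h
  0≤𝔼 {h} 0≤h = subst (_≤ 𝔼 D h) (𝔼-const 0ℚ) (𝔼-mono 0≤h)

  𝔼≤1 : ∀ {h : A → ℚ} → (∀ x → h x ≤ 1ℚ) → 𝔼 D h ≤ 1ℚ
  𝔼≤1 {h} h≤1 = subst (𝔼 D h ≤_) (𝔼-const 1ℚ) (𝔼-mono h≤1)

  𝔼-∑ : ∀ {k} (h : Fin k → A → ℚ) → 𝔼 D (λ x → ∑ (λ i → h i x)) ≡ ∑ (λ i → 𝔼 D (h i))
  𝔼-∑ {zero}  h = 𝔼-const 0ℚ
  𝔼-∑ {suc k} h = trans (𝔼-+ (h fzero) (λ x → ∑ (λ i → h (fsuc i) x))) (cong (𝔼 D (h fzero) +_) (𝔼-∑ (h ∘ fsuc)))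

  𝔼-sumᴸ : ∀ (ys : List B) (h : B → A → ℚ) → 𝔼 D (λ x → sumᴸ ys (λ y → h y x)) ≡ sumᴸ ys (λ y → 𝔼 D (h y))
  𝔼-sumᴸ ys h = trans (sumᴸ-cong (support D) λ x → sym (sumᴸ-*ˡ ys (weight D x) (λ y → h y x)))
                      (sumᴸ-swap (support D) ys (λ x y → weight D x * h y x))

𝔼-swap : ∀ (D : Dist A) (D′ : Dist B) (h : A → B → ℚ) →
         𝔼 D (λ x → 𝔼 D′ (h x)) ≡ 𝔼 D′ (λ y → 𝔼 D (λ x → h x y))
𝔼-swap D D′ h = trans (𝔼-sumᴸ D (support D′) (λ y x → weight D′ y * h x y))
                      (sumᴸ-cong (support D′) λ y → 𝔼-*ˡ D (weight D′ y) (λ x → h x y))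

module _ (D : Dist A) where

  private
    weight^ : ∀ {m} → Vec A m → ℚ
    weight^ []      = 1ℚ
    weight^ (x ∷ v) = weight D x * weight^ v

    0≤weight^ : ∀ {m} (v : Vec A m) → 0ℚ ≤ weight^ v
    0≤weight^ []      = 0≤1
    0≤weight^ (x ∷ v) = 0≤* (0≤weight D x) (0≤weight^ v)

    sumᴸ-weight^ : ∀ m (h : Vec A (suc m) → ℚ) →
      sumᴸ (vecs (support D) (suc m)) (λ v → weight^ v * h v) ≡
      𝔼 D (λ x → sumᴸ (vecs (support D) m) (λ v → weight^ v * h (x ∷ v)))
    sumᴸ-weight^ m h = trans (sumᴸ-vecs (support D) m _) (sumᴸ-cong (support D) λ x →
      trans (sumᴸ-cong (vecs (support D) m) λ v → *-assoc (weight D x) (weight^ v) (h (x ∷ v)))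
            (sumᴸ-*ˡ (vecs (support D) m) (weight D x) _))

    total^ : ∀ m → sumᴸ (vecs (support D) m) weight^ ≡ 1ℚ
    total^ zero    = refl
    total^ (suc m) = trans (sumᴸ-cong (vecs (support D) (suc m)) λ v → sym (*-identityʳ (weight^ v)))
      (trans (sumᴸ-weight^ m (λ _ → 1ℚ))
        (trans (𝔼-cong D λ x → trans (sumᴸ-cong (vecs (support D) m) λ v → *-identityʳ (weight^ v)) (total^ m))
               (𝔼-const D 1ℚ)))

  infixr 8 _^ᴰ_
  _^ᴰ_ : ∀ m → Dist (Vec A m)
  _^ᴰ_ m = record
    { support = vecs (support D) m ; weight = weight^ ; 0≤weight = 0≤weight^ ; total = total^ m }

  𝔼-^-suc : ∀ m (h : Vec A (suc m) → ℚ) → 𝔼 (_^ᴰ_ (suc m)) h ≡ 𝔼 D (λ x → 𝔼 (_^ᴰ_ m) (h ∘ (x ∷_)))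
  𝔼-^-suc m h = sumᴸ-weight^ m h

  -- Independence of the coordinates; it identifies the product of the players' probabilities with
  -- the probability of a rectangle.
  𝔼-∏ : ∀ {k} (g : Fin k → A → ℚ) → 𝔼 (_^ᴰ_ k) (λ v → ∏ (λ i → g i (lookup v i))) ≡ ∏ (λ i → 𝔼 D (g i))
  𝔼-∏ {zero}  g = 𝔼-const (_^ᴰ_ 0) 1ℚ
  𝔼-∏ {suc k} g = begin
    𝔼 (_^ᴰ_ (suc k)) (λ v → ∏ (λ i → g i (lookup v i)))
      ≡⟨ 𝔼-^-suc k _ ⟩
    𝔼 D (λ x → 𝔼 (_^ᴰ_ k) (λ v → g fzero x * ∏ (λ i → g (fsuc i) (lookup v i))))
      ≡⟨ 𝔼-cong D (λ x → trans (𝔼-*ˡ (_^ᴰ_ k) (g fzero x) _)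
           (trans (cong (g fzero x *_) (𝔼-∏ (g ∘ fsuc))) (*-comm (g fzero x) (∏ λ i → 𝔼 D (g (fsuc i)))))) ⟩
    𝔼 D (λ x → ∏ (λ i → 𝔼 D (g (fsuc i))) * g fzero x)
      ≡⟨ 𝔼-*ˡ D (∏ λ i → 𝔼 D (g (fsuc i))) (g fzero) ⟩
    ∏ (λ i → 𝔼 D (g (fsuc i))) * 𝔼 D (g fzero)
      ≡⟨ *-comm (∏ λ i → 𝔼 D (g (fsuc i))) (𝔼 D (g fzero)) ⟩
    𝔼 D (g fzero) * ∏ (λ i → 𝔼 D (g (fsuc i))) ∎
    where open ≡-Reasoning

coin : Dist Bool
coin = record { support = bools ; weight = λ _ → ½ ; 0≤weight = λ _ → 0≤½ ; total = refl }

Bits : ℕ → Set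
Bits = Vec Bool

bits : ∀ S → Dist (Bits S)
bits S = coin ^ᴰ S

𝔼-bits-suc : ∀ S (h : Bits (suc S) → ℚ) →
             𝔼 (bits (suc S)) h ≡ mid (𝔼 (bits S) (h ∘ (false ∷_))) (𝔼 (bits S) (h ∘ (true ∷_)))
𝔼-bits-suc S h = trans (𝔼-^-suc coin S h) (lem (𝔼 (bits S) (h ∘ (false ∷_))) (𝔼 (bits S) (h ∘ (true ∷_))))
  where
  lem : ∀ a b → ½ * a + (½ * b + 0ℚ) ≡ ½ * (a + b)
  lem = solve-∀ ℚ-ring

weight-bits : ∀ {S} (β : Bits S) → weight (bits S) β ≡ ½^ S
weight-bits []      = refl
weight-bits (b ∷ β) = cong (½ *_) (weight-bits β)

𝔼-bits-reindex : ∀ {S} (φ ψ : Bits S → Bits S) → (∀ β → φ (ψ β) ≡ β) → (∀ β → ψ (φ β) ≡ β) →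
                 ∀ h → 𝔼 (bits S) (h ∘ φ) ≡ 𝔼 (bits S) h
𝔼-bits-reindex {S} φ ψ φψ ψφ h =
  trans (sumᴸ-cong (vecs bools S) λ β → cong (_* h (φ β)) (trans (weight-bits β) (sym (weight-bits (φ β)))))
        (sumᴸ-reindex (Vecₚ.≡-dec 𝔹._≟_) (vecs bools S) (enumerates-vecs 𝔹._≟_ bools enumerates-bools S) φ ψ φψ ψφ
          (λ β → weight (bits S) β * h β))

-- Entropy of sets of bit vectors

½^-antitone : ∀ {S Q} → S ℕ.≤ Q → ½^ Q ≤ ½^ S
½^-antitone {zero}  {zero}  _           = ≤-refl
½^-antitone {zero}  {suc Q} _           = ≤-trans (*-mono-≤ˡ ½ 0≤½ (½^-antitone {zero} {Q} ℕ.z≤n)) (≤-by ½ refl 0≤½)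
½^-antitone {suc S} {suc Q} (ℕ.s≤s S≤Q) = *-mono-≤ˡ ½ 0≤½ (½^-antitone S≤Q)

mid-same : ∀ x → ½ * (x + x) ≡ x
mid-same = solve-∀ ℚ-ring

density : ∀ {S} → (Bits S → Bool) → ℚ
density {S} h = 𝔼 (bits S) (λ β → ⟦ h β ⟧)

0≤density : ∀ {S} (h : Bits S → Bool) → 0ℚ ≤ density h
0≤density {S} h = 0≤𝔼 (bits S) (λ β → 0≤⟦ h β ⟧)

density≤1 : ∀ {S} (h : Bits S → Bool) → density h ≤ 1ℚ
density≤1 {S} h = 𝔼≤1 (bits S) (λ β → ⟦ h β ⟧≤1)

density-[] : ∀ (h : Bits 0 → Bool) → density h ≡ ⟦ h [] ⟧
density-[] h = trans (+-identityʳ _) (*-identityˡ ⟦ h [] ⟧)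

-- Densities are multiples of `½^ S`. Hence the scales of `Φ` may stop at any `Q ≥ S`: two densities
-- are either both 0 or meet the hypothesis of `Φ-tri`.
density-granular : ∀ {S} (h : Bits S → Bool) → density h ≡ 0ℚ ⊎ ½^ S ≤ density h
density-granular {zero} h rewrite density-[] h with h []
... | false = inj₁ refl
... | true  = inj₂ ≤-refl
density-granular {suc S} h =
  subst (λ z → z ≡ 0ℚ ⊎ ½^ (suc S) ≤ z) (sym (𝔼-bits-suc S (λ β → ⟦ h β ⟧)))
    (combine (0≤density h₀) (0≤density h₁) (density-granular h₀) (density-granular h₁))
  where
  h₀ h₁ : Bits S → Bool
  h₀ = h ∘ (false ∷_)
  h₁ = h ∘ (true ∷_)
  combine : ∀ {x y} → 0ℚ ≤ x → 0ℚ ≤ y → x ≡ 0ℚ ⊎ ½^ S ≤ x → y ≡ 0ℚ ⊎ ½^ S ≤ y →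
            mid x y ≡ 0ℚ ⊎ ½^ (suc S) ≤ mid x y
  combine 0≤x 0≤y (inj₁ x≡0) (inj₁ y≡0) = inj₁ (cong₂ mid x≡0 y≡0)
  combine {x} {y} 0≤x 0≤y (inj₂ ≤x) _   = inj₂ (*-mono-≤ˡ ½ 0≤½ (subst (_≤ x + y) (+-identityʳ (½^ S)) (+-mono-≤ ≤x 0≤y)))
  combine {x} {y} 0≤x 0≤y _ (inj₂ ≤y)   = inj₂ (*-mono-≤ˡ ½ 0≤½ (subst (_≤ x + y) (+-identityˡ (½^ S)) (+-mono-≤ 0≤x ≤y)))

-- Overwriting a fair coin has the same effect as conditioning on its value, so this is the density
-- of `h` given that coin `t` shows `v`.
given : ∀ {S} → (Bits S → Bool) → Fin S → Bool → ℚ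
given h t v = density (λ β → h (β [ t ]≔ᵛ v))

given-fzero : ∀ {S} (h : Bits (suc S) → Bool) v → given h fzero v ≡ density (h ∘ (v ∷_))
given-fzero {S} h v = trans (𝔼-bits-suc S _) (mid-same _)

given-fsuc : ∀ {S} (h : Bits (suc S) → Bool) t v →
             given h (fsuc t) v ≡ mid (given (h ∘ (false ∷_)) t v) (given (h ∘ (true ∷_)) t v)
given-fsuc {S} h t v = 𝔼-bits-suc S _

tri-density : ∀ Q {S} → S ℕ.≤ Q → (h g : Bits S → Bool) →
  let x = density h ; y = density g in tri x y ≤ 4ℚ * (Φ Q (mid x y) - mid (Φ Q x) (Φ Q y))
tri-density Q {S} S≤Q h g with density-granular h | density-granular g
... | inj₁ x≡0 | inj₁ y≡0 rewrite x≡0 | y≡0 =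
        0≤* (nonNegative⁻¹ 4ℚ) (0≤diff (Φ-concave Q 0ℚ 0ℚ))
... | inj₂ ≤x  | _        = Φ-tri Q (0≤density h) (0≤density g) (density≤1 h) (density≤1 g)
        (≤-trans (½^-antitone S≤Q) (subst (_≤ density h + density g) (+-identityʳ (½^ S)) (+-mono-≤ ≤x (0≤density g))))
... | inj₁ _   | inj₂ ≤y  = Φ-tri Q (0≤density h) (0≤density g) (density≤1 h) (density≤1 g)
        (≤-trans (½^-antitone S≤Q) (subst (_≤ density h + density g) (+-identityˡ (½^ S)) (+-mono-≤ (0≤density h) ≤y)))

-- Level-one inequality, with Φ Q μ - Φ Q 1ℚ * μ in the role of μ log (1/μ).
∑-tri≤entropy : ∀ Q {S} → S ℕ.≤ Q → (h : Bits S → Bool) →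
  ∑ (λ t → tri (given h t false) (given h t true)) ≤ 4ℚ * (Φ Q (density h) - Φ Q 1ℚ * density h)
∑-tri≤entropy Q {zero} S≤Q h rewrite density-[] h with h []
... | false = 0≤* (nonNegative⁻¹ 4ℚ) (subst (0ℚ ≤_) (lem (Φ Q 0ℚ) (Φ Q 1ℚ)) (0≤Φ Q ≤-refl))
  where
  lem : ∀ a b → a ≡ a - b * 0ℚ
  lem = solve-∀ ℚ-ring
... | true  = ≤-reflexive (lem (Φ Q 1ℚ))
  where
  lem : ∀ a → 0ℚ ≡ 4ℚ * (a - a * 1ℚ)
  lem = solve-∀ ℚ-ring
∑-tri≤entropy Q {suc S} S<Q h = begin
  tri (given h fzero false) (given h fzero true) + ∑ (λ t → tri (given h (fsuc t) false) (given h (fsuc t) true))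
    ≡⟨ cong₂ _+_ (cong₂ tri (given-fzero h false) (given-fzero h true))
                 (∑-cong λ t → cong₂ tri (given-fsuc h t false) (given-fsuc h t true)) ⟩
  tri x y + ∑ (λ t → tri (mid (given h₀ t false) (given h₁ t false)) (mid (given h₀ t true) (given h₁ t true)))
    -- The first coin is paid for by the concavity gap of `Φ` between the two half-cube densities.
    -- For the other coins, convexity moves the average over the first coin out of `tri`, where the
    -- induction applies; `Q` stays fixed so that every level uses the same `Φ`.
    ≤⟨ +-mono-≤ (tri-density Q S≤Q h₀ h₁) (∑-mono λ t →
         tri-convex (0≤given h₀ t false) (0≤given h₀ t true) (0≤given h₁ t false) (0≤given h₁ t true)) ⟩
  gap + ∑ (λ t → mid (tri₀ t) (tri₁ t))
    ≡⟨ cong (gap +_) (trans (∑-*ˡ ½ (λ t → tri₀ t + tri₁ t)) (cong (½ *_) (∑-+ tri₀ tri₁))) ⟩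
  gap + mid (∑ tri₀) (∑ tri₁)
    ≤⟨ +-monoʳ-≤ gap (*-mono-≤ˡ ½ 0≤½ (+-mono-≤ (∑-tri≤entropy Q S≤Q h₀) (∑-tri≤entropy Q S≤Q h₁))) ⟩
  gap + mid (4ℚ * (Φ Q x - Φ Q 1ℚ * x)) (4ℚ * (Φ Q y - Φ Q 1ℚ * y))
    ≡⟨ lem (Φ Q (mid x y)) (Φ Q x) (Φ Q y) (Φ Q 1ℚ) x y ⟩
  4ℚ * (Φ Q (mid x y) - Φ Q 1ℚ * mid x y)
    ≡⟨ cong (λ z → 4ℚ * (Φ Q z - Φ Q 1ℚ * z)) (sym (𝔼-bits-suc S (λ β → ⟦ h β ⟧))) ⟩
  4ℚ * (Φ Q (density h) - Φ Q 1ℚ * density h) ∎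
  where
  open ≤-Reasoning
  S≤Q : S ℕ.≤ Q
  S≤Q = ℕₚ.≤-trans (ℕₚ.n≤1+n S) S<Q
  h₀ h₁ : Bits S → Bool
  h₀ = h ∘ (false ∷_)
  h₁ = h ∘ (true ∷_)
  x y gap : ℚ
  x = density h₀
  y = density h₁
  gap = 4ℚ * (Φ Q (mid x y) - mid (Φ Q x) (Φ Q y))
  tri₀ tri₁ : Fin S → ℚ
  tri₀ t = tri (given h₀ t false) (given h₀ t true)
  tri₁ t = tri (given h₁ t false) (given h₁ t true)
  0≤given : ∀ {S} (h : Bits S → Bool) t v → 0ℚ ≤ given h t v
  0≤given h t v = 0≤density (λ β → h (β [ t ]≔ᵛ v))
  lem : ∀ e a b c x y → 4ℚ * (e - ½ * (a + b)) + ½ * (4ℚ * (a - c * x) + 4ℚ * (b - c * y))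
        ≡ 4ℚ * (e - c * (½ * (x + y)))
  lem = solve-∀ ℚ-ring

ι : ℕ → ℚ
ι zero    = 0ℚ
ι (suc n) = 1ℚ + ι n

ι-mono : ∀ {m n} → m ℕ.≤ n → ι m ≤ ι n
ι-mono {n = zero}  ℕ.z≤n = ≤-refl
ι-mono {n = suc n} ℕ.z≤n = 0≤+ 0≤1 (ι-mono {n = n} ℕ.z≤n)
ι-mono (ℕ.s≤s m≤n)       = +-monoʳ-≤ 1ℚ (ι-mono m≤n)

-- Rectangles at the leaves of a protocol

map-update : ∀ {k} {A B : Set} (F : Fin k → A → B) (R : Fin k → A) i x →
             ∀ j → F j ((R [ i ≔ x ]) j) ≡ ((λ j → F j (R j)) [ i ≔ F i x ]) j
map-update F R fzero    x fzero    = refl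
map-update F R fzero    x (fsuc j) = refl
map-update F R (fsuc i) x fzero    = refl
map-update F R (fsuc i) x (fsuc j) = map-update (F ∘ fsuc) (R ∘ fsuc) i x j

update-app : ∀ {k} {A B : Set} (F : Fin k → A → B) (R : Fin k → A) i G →
             ∀ j → (F [ i ≔ G ]) j (R j) ≡ ((λ j → F j (R j)) [ i ≔ G (R i) ]) j
update-app F R fzero    G fzero    = refl
update-app F R fzero    G (fsuc j) = refl
update-app F R (fsuc i) G fzero    = refl
update-app F R (fsuc i) G (fsuc j) = update-app (F ∘ fsuc) (R ∘ fsuc) i G j

module Tree {n : ℕ} (read : Vec Bool n → Fin n → Bool) where

  Event : Set
  Event = Vec Bool n → Bool

  _∩_ : Event → Event → Event
  (P ∩ Q) x = P x ∧ Q x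

  ∁ : Event → Event
  ∁ P x = not (P x)

  Rect : ℕ → Set
  Rect k = Fin k → Event

  everything : ∀ {k} → Rect k
  everything _ _ = true

  _∣_∈_ : ∀ {k} → Rect k → Fin k → Event → Rect k
  R ∣ i ∈ P = R [ i ≔ R i ∩ P ]

  leafSum : ∀ {k} → Protocol k n → Rect k → (Bool → Rect k → ℚ) → ℚ
  leafSum (leaf b)       R Ψ = Ψ b R
  leafSum (node i f p q) R Ψ = leafSum p (R ∣ i ∈ ∁ (f ∘ read)) Ψ + leafSum q (R ∣ i ∈ (f ∘ read)) Ψ

  module _ {k : ℕ} where

    leafSum-cong : ∀ (π : Protocol k n) R {Ψ Ψ′} → (∀ b R → Ψ b R ≡ Ψ′ b R) → leafSum π R Ψ ≡ leafSum π R Ψ′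
    leafSum-cong (leaf b)       R eq = eq b R
    leafSum-cong (node i f p q) R eq = cong₂ _+_ (leafSum-cong p _ eq) (leafSum-cong q _ eq)

    leafSum-mono : ∀ (π : Protocol k n) R {Ψ Ψ′} → (∀ b R → Ψ b R ≤ Ψ′ b R) → leafSum π R Ψ ≤ leafSum π R Ψ′
    leafSum-mono (leaf b)       R le = le b R
    leafSum-mono (node i f p q) R le = +-mono-≤ (leafSum-mono p _ le) (leafSum-mono q _ le)

    leafSum-+ : ∀ (π : Protocol k n) R Ψ Ψ′ →
                leafSum π R (λ b R → Ψ b R + Ψ′ b R) ≡ leafSum π R Ψ + leafSum π R Ψ′
    leafSum-+ (leaf b)       R Ψ Ψ′ = refl
    leafSum-+ (node i f p q) R Ψ Ψ′ = trans (cong₂ _+_ (leafSum-+ p _ Ψ Ψ′) (leafSum-+ q _ Ψ Ψ′))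
      (lem (leafSum p _ Ψ) (leafSum p _ Ψ′) (leafSum q _ Ψ) (leafSum q _ Ψ′))
      where
      lem : ∀ a b c d → a + b + (c + d) ≡ a + c + (b + d)
      lem = solve-∀ ℚ-ring

    leafSum-*ˡ : ∀ (π : Protocol k n) R c Ψ → leafSum π R (λ b R → c * Ψ b R) ≡ c * leafSum π R Ψ
    leafSum-*ˡ (leaf b)       R c Ψ = refl
    leafSum-*ˡ (node i f p q) R c Ψ = trans (cong₂ _+_ (leafSum-*ˡ p _ c Ψ) (leafSum-*ˡ q _ c Ψ))
      (sym (*-distribˡ-+ c (leafSum p _ Ψ) (leafSum q _ Ψ)))

    leafSum-0 : ∀ (π : Protocol k n) R → leafSum π R (λ _ _ → 0ℚ) ≡ 0ℚ
    leafSum-0 (leaf b)       R = refl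
    leafSum-0 (node i f p q) R = cong₂ _+_ (leafSum-0 p _) (leafSum-0 q _)

    leafSum-∑ : ∀ (π : Protocol k n) R {m} (Ψ : Fin m → Bool → Rect k → ℚ) →
                leafSum π R (λ b R → ∑ (λ t → Ψ t b R)) ≡ ∑ (λ t → leafSum π R (Ψ t))
    leafSum-∑ π R {zero}  Ψ = leafSum-0 π R
    leafSum-∑ π R {suc m} Ψ = trans (leafSum-+ π R (Ψ fzero) (λ b R → ∑ (λ t → Ψ (fsuc t) b R)))
                                    (cong (leafSum π R (Ψ fzero) +_) (leafSum-∑ π R (Ψ ∘ fsuc)))

    leafSum-𝔼 : ∀ {Ω : Set} (D : Dist Ω) (π : Protocol k n) R (Ψ : Ω → Bool → Rect k → ℚ) →
                leafSum π R (λ b R → 𝔼 D (λ ω → Ψ ω b R)) ≡ 𝔼 D (λ ω → leafSum π R (Ψ ω))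
    leafSum-𝔼 D (leaf b)       R Ψ = refl
    leafSum-𝔼 D (node i f p q) R Ψ = trans (cong₂ _+_ (leafSum-𝔼 D p _ Ψ) (leafSum-𝔼 D q _ Ψ)) (sym (𝔼-+ D _ _))

    -- Arbitrary set functions, with `Additive` as a separate property: products with one factor
    -- replaced by the non-additive `Φ Q ∘ ϑ i` or `tri-at z t` keep the same form.
    Measures : Set
    Measures = Fin k → Event → ℚ

    volume : Measures → Rect k → ℚ
    volume ϑ R = ∏ (λ i → ϑ i (R i))

    Additive : (Event → ℚ) → Set
    Additive θ = ∀ P Q → θ (P ∩ ∁ Q) + θ (P ∩ Q) ≡ θ P

    skip : Measures → Rect k → Fin k → ℚ
    skip ϑ R = ∏-skip (λ j → ϑ j (R j))

    volume-split : ∀ ϑ R i → volume ϑ R ≡ ϑ i (R i) * skip ϑ R i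
    volume-split ϑ R i = ∏-split (λ j → ϑ j (R j)) i

    volume-update : ∀ ϑ R i P → volume ϑ (R [ i ≔ P ]) ≡ ϑ i P * skip ϑ R i
    volume-update ϑ R i P = trans (∏-cong (map-update ϑ R i P)) (∏-update (λ j → ϑ j (R j)) i (ϑ i P))

    volume-replace : ∀ ϑ i θ R → volume (ϑ [ i ≔ θ ]) R ≡ ∏ ((λ j → ϑ j (R j)) [ i ≔ θ (R i) ])
    volume-replace ϑ i θ R = ∏-cong (update-app ϑ R i θ)

    volume-replace′ : ∀ ϑ i θ R → volume (ϑ [ i ≔ θ ]) R ≡ θ (R i) * skip ϑ R i
    volume-replace′ ϑ i θ R = trans (volume-replace ϑ i θ R) (∏-update (λ j → ϑ j (R j)) i (θ (R i)))

    volume-node : ∀ ϑ R i P → Additive (ϑ i) → volume ϑ (R ∣ i ∈ ∁ P) + volume ϑ (R ∣ i ∈ P) ≡ volume ϑ R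
    volume-node ϑ R i P add = begin
      volume ϑ (R ∣ i ∈ ∁ P) + volume ϑ (R ∣ i ∈ P)
        ≡⟨ cong₂ _+_ (volume-update ϑ R i _) (volume-update ϑ R i _) ⟩
      ϑ i (R i ∩ ∁ P) * skip ϑ R i + ϑ i (R i ∩ P) * skip ϑ R i
        ≡⟨ sym (*-distribʳ-+ (skip ϑ R i) (ϑ i (R i ∩ ∁ P)) (ϑ i (R i ∩ P))) ⟩
      (ϑ i (R i ∩ ∁ P) + ϑ i (R i ∩ P)) * skip ϑ R i
        ≡⟨ cong (_* skip ϑ R i) (add (R i) P) ⟩
      ϑ i (R i) * skip ϑ R i
        ≡⟨ sym (volume-split ϑ R i) ⟩
      volume ϑ R ∎
      where open ≡-Reasoning

    -- At a node only the speaker's factor changes, and its additivity glues the two children. For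
    -- normalised factors the leaf volumes form a probability distribution, even for mixed products
    -- that belong to neither world.
    leafSum-volume : ∀ ϑ → (∀ i → Additive (ϑ i)) → ∀ π R → leafSum π R (λ _ → volume ϑ) ≡ volume ϑ R
    leafSum-volume ϑ add (leaf b)       R = refl
    leafSum-volume ϑ add (node i f p q) R =
      trans (cong₂ _+_ (leafSum-volume ϑ add p _) (leafSum-volume ϑ add q _)) (volume-node ϑ R i (f ∘ read) (add i))

    dirac : (Fin k → Vec Bool n) → Measures
    dirac x i P = ⟦ P (x i) ⟧

    inside : Rect k → (Fin k → Vec Bool n) → ℚ
    inside R x = volume (dirac x) R

    0≤inside : ∀ R x → 0ℚ ≤ inside R x
    0≤inside R x = 0≤∏ (λ i → 0≤⟦ R i (x i) ⟧)

    inside-everything : ∀ x → inside everything x ≡ 1ℚ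
    inside-everything x = ∏-1 (λ j → dirac x j (everything {k} j)) (λ _ → refl)

    inside-∣ : ∀ R x i P → inside (R ∣ i ∈ P) x ≡ ⟦ P (x i) ⟧ * inside R x
    inside-∣ R x i P = begin
      inside (R ∣ i ∈ P) x                     ≡⟨ volume-update (dirac x) R i (R i ∩ P) ⟩
      ⟦ R i (x i) ∧ P (x i) ⟧ * s              ≡⟨ cong (_* s) (⟦∧⟧ (R i (x i)) (P (x i))) ⟩
      ⟦ R i (x i) ⟧ * ⟦ P (x i) ⟧ * s          ≡⟨ lem ⟦ R i (x i) ⟧ ⟦ P (x i) ⟧ s ⟩
      ⟦ P (x i) ⟧ * (⟦ R i (x i) ⟧ * s)        ≡⟨ cong (⟦ P (x i) ⟧ *_) (sym (volume-split (dirac x) R i)) ⟩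
      ⟦ P (x i) ⟧ * inside R x                 ∎
      where
      open ≡-Reasoning
      s : ℚ
      s = skip (dirac x) R i
      lem : ∀ a b c → a * b * c ≡ b * (a * c)
      lem = solve-∀ ℚ-ring

    -- The leaf rectangles partition the inputs: `x` lies only in the one that its run reaches, and
    -- the sum collapses to the output there.
    leafSum-run : ∀ (o : Bool → ℚ) π R x →
      leafSum π R (λ b R → o b * inside R x) ≡ o (run π (read ∘ x)) * inside R x
    leafSum-run o (leaf b) R x = refl
    leafSum-run o (node i f p q) R x = trans
      (cong₂ _+_ (trans (leafSum-run o p _ x) (cong (o (run p (read ∘ x)) *_) (inside-∣ R x i (∁ (f ∘ read)))))
                 (trans (leafSum-run o q _ x) (cong (o (run q (read ∘ x)) *_) (inside-∣ R x i (f ∘ read)))))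
      (branch (f (read (x i))) (run p (read ∘ x)) (run q (read ∘ x)) (inside R x))
      where
      lem₀ : ∀ a b c → a * (1ℚ * c) + b * (0ℚ * c) ≡ a * c
      lem₀ = solve-∀ ℚ-ring
      lem₁ : ∀ a b c → a * (0ℚ * c) + b * (1ℚ * c) ≡ b * c
      lem₁ = solve-∀ ℚ-ring
      branch : ∀ v r₀ r₁ c → o r₀ * (⟦ not v ⟧ * c) + o r₁ * (⟦ v ⟧ * c) ≡ o (if v then r₁ else r₀) * c
      branch false r₀ r₁ c = lem₀ (o r₀) (o r₁) c
      branch true  r₀ r₁ c = lem₁ (o r₀) (o r₁) c

    -- A potential argument down the tree. The potential is preserved where another player speaks
    -- and, by `Φ-split`, gains at most twice the volume of a node where player `i` speaks. These
    -- volumes, being expectations of `inside`, add up to the expected number of bits sent by `i`.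
    leafSum-bits : ∀ i ϑ Q → (∀ j → Additive (ϑ j)) → (∀ j P → 0ℚ ≤ ϑ j P) →
      ∀ {Ω : Set} (D : Dist Ω) (x : Ω → Fin k → Vec Bool n) → (∀ R → volume ϑ R ≡ 𝔼 D (λ ω → inside R (x ω))) →
      ∀ π R → leafSum π R (λ _ → volume (ϑ [ i ≔ Φ Q ∘ ϑ i ])) ≤
              volume (ϑ [ i ≔ Φ Q ∘ ϑ i ]) R +
              2ℚ * 𝔼 D (λ ω → ι (bitsSent π (read ∘ x ω) i) * inside R (x ω))
    leafSum-bits i ϑ Q add 0≤ϑ D x sampled = go
      where
      open ≤-Reasoning
      pot : Rect k → ℚ
      pot = volume (ϑ [ i ≔ Φ Q ∘ ϑ i ])

      cost : Protocol k n → Rect k → ℚ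
      cost π R = 𝔼 D (λ ω → ι (bitsSent π (read ∘ x ω) i) * inside R (x ω))

      speaks : Fin k → Rect k → ℚ
      speaks j R = ⟦ does (j Finₚ.≟ i) ⟧ * volume ϑ R

      cost-node : ∀ j f p q R → cost p (R ∣ j ∈ ∁ (f ∘ read)) + cost q (R ∣ j ∈ (f ∘ read)) + speaks j R
                  ≡ cost (node j f p q) R
      cost-node j f p q R = trans
        (cong₂ _+_ (sym (𝔼-+ D _ _))
          (trans (cong (⟦ does (j Finₚ.≟ i) ⟧ *_) (sampled R))
                 (sym (𝔼-*ˡ D ⟦ does (j Finₚ.≟ i) ⟧ (λ ω → inside R (x ω))))))
        (trans (sym (𝔼-+ D _ _)) (𝔼-cong D pointwise))
        where
        lem₀ : ∀ a b s w → a * (1ℚ * w) + b * (0ℚ * w) + 1ℚ * w ≡ (1ℚ + a) * w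
        lem₀ = solve-∀ ℚ-ring
        lem₁ : ∀ a b s w → a * (0ℚ * w) + b * (1ℚ * w) + 1ℚ * w ≡ (1ℚ + b) * w
        lem₁ = solve-∀ ℚ-ring
        lem₂ : ∀ a b s w → a * (1ℚ * w) + b * (0ℚ * w) + 0ℚ * w ≡ a * w
        lem₂ = solve-∀ ℚ-ring
        lem₃ : ∀ a b s w → a * (0ℚ * w) + b * (1ℚ * w) + 0ℚ * w ≡ b * w
        lem₃ = solve-∀ ℚ-ring
        branch : ∀ s v (b₀ b₁ : ℕ) w → ι b₀ * (⟦ not v ⟧ * w) + ι b₁ * (⟦ v ⟧ * w) + ⟦ s ⟧ * w
                 ≡ ι ((if s then 1 else 0) ℕ.+ (if v then b₁ else b₀)) * w
        branch true  false b₀ b₁ w = lem₀ (ι b₀) (ι b₁) 1ℚ w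
        branch true  true  b₀ b₁ w = lem₁ (ι b₀) (ι b₁) 1ℚ w
        branch false false b₀ b₁ w = lem₂ (ι b₀) (ι b₁) 1ℚ w
        branch false true  b₀ b₁ w = lem₃ (ι b₀) (ι b₁) 1ℚ w
        pointwise : ∀ ω →
          ι (bitsSent p (read ∘ x ω) i) * inside (R ∣ j ∈ ∁ (f ∘ read)) (x ω) +
          ι (bitsSent q (read ∘ x ω) i) * inside (R ∣ j ∈ (f ∘ read)) (x ω) +
          ⟦ does (j Finₚ.≟ i) ⟧ * inside R (x ω) ≡ ι (bitsSent (node j f p q) (read ∘ x ω) i) * inside R (x ω)
        pointwise ω = trans
          (cong₂ (λ y z → ι b₀ * y + ι b₁ * z + ⟦ does (j Finₚ.≟ i) ⟧ * inside R (x ω))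
                 (inside-∣ R (x ω) j (∁ (f ∘ read))) (inside-∣ R (x ω) j (f ∘ read)))
          (branch (does (j Finₚ.≟ i)) (f (read (x ω j))) b₀ b₁ (inside R (x ω)))
          where
          b₀ b₁ : ℕ
          b₀ = bitsSent p (read ∘ x ω) i
          b₁ = bitsSent q (read ∘ x ω) i

      pot-node : ∀ j P R → pot (R ∣ j ∈ ∁ P) + pot (R ∣ j ∈ P) ≤ pot R + 2ℚ * speaks j R
      pot-node j P R with j Finₚ.≟ i
      ... | no j≢i = ≤-reflexive (trans
              (volume-node _ R j P (subst Additive (sym (updateAt-minimal j i ϑ j≢i)) (add j)))
              (lem (pot R) (volume ϑ R)))
        where
        lem : ∀ a b → a ≡ a + 2ℚ * (0ℚ * b)
        lem = solve-∀ ℚ-ring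
      ... | yes refl = begin
        pot (R ∣ i ∈ ∁ P) + pot (R ∣ i ∈ P)
          ≡⟨ cong₂ _+_ (pot-update (R i ∩ ∁ P)) (pot-update (R i ∩ P)) ⟩
        Φ Q y₀ * s + Φ Q y₁ * s
          ≡⟨ sym (*-distribʳ-+ s (Φ Q y₀) (Φ Q y₁)) ⟩
        (Φ Q y₀ + Φ Q y₁) * s
          ≤⟨ *-mono-≤₂ (≤-trans (0≤+ (0≤Φ Q (0≤ϑ i _)) (0≤Φ Q (0≤ϑ i _))) split) 0≤s split ≤-refl ⟩
        (Φ Q (y₀ + y₁) + 2ℚ * (y₀ + y₁)) * s
          ≡⟨ cong (λ y → (Φ Q y + 2ℚ * y) * s) (add i (R i) P) ⟩
        (Φ Q (ϑ i (R i)) + 2ℚ * ϑ i (R i)) * s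
          ≡⟨ lem (Φ Q (ϑ i (R i))) (ϑ i (R i)) s ⟩
        Φ Q (ϑ i (R i)) * s + 2ℚ * (1ℚ * (ϑ i (R i) * s))
          ≡⟨ cong₂ (λ a b → a + 2ℚ * (1ℚ * b)) (sym (volume-replace′ ϑ i (Φ Q ∘ ϑ i) R)) (sym (volume-split ϑ R i)) ⟩
        pot R + 2ℚ * (1ℚ * volume ϑ R) ∎
        where
        s y₀ y₁ : ℚ
        s = skip ϑ R i
        y₀ = ϑ i (R i ∩ ∁ P)
        y₁ = ϑ i (R i ∩ P)
        0≤s : 0ℚ ≤ s
        0≤s = 0≤∏-skip (λ j → 0≤ϑ j (R j)) i
        split : Φ Q y₀ + Φ Q y₁ ≤ Φ Q (y₀ + y₁) + 2ℚ * (y₀ + y₁)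
        split = Φ-split Q (0≤ϑ i _) (0≤ϑ i _)
        pot-update : ∀ P → pot (R [ i ≔ P ]) ≡ Φ Q (ϑ i P) * s
        pot-update P = trans (volume-update (ϑ [ i ≔ Φ Q ∘ ϑ i ]) R i P)
          (cong₂ _*_ (cong (λ θ → θ P) (updateAt-updates i ϑ))
            (∏-cong λ j → skip-replace ϑ i j))
          where
          skip-replace : ∀ ϑ i j → ((λ j → (ϑ [ i ≔ Φ Q ∘ ϑ i ]) j (R j)) [ i ≔ 1ℚ ]) j ≡ ((λ j → ϑ j (R j)) [ i ≔ 1ℚ ]) j
          skip-replace ϑ i j with j Finₚ.≟ i
          ... | yes refl = trans (updateAt-updates i _) (sym (updateAt-updates i _))
          ... | no j≢i   = trans (updateAt-minimal j i _ j≢i)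
                  (trans (cong (λ θ → θ (R j)) (updateAt-minimal j i ϑ j≢i)) (sym (updateAt-minimal j i _ j≢i)))
        lem : ∀ a b s → (a + 2ℚ * b) * s ≡ a * s + 2ℚ * (1ℚ * (b * s))
        lem = solve-∀ ℚ-ring

      go : ∀ π R → leafSum π R (λ _ → pot) ≤ pot R + 2ℚ * cost π R
      go (leaf b) R = ≤-by (2ℚ * cost (leaf b) R) (lem (pot R) (2ℚ * cost (leaf b) R))
        (0≤* (nonNegative⁻¹ 2ℚ) (0≤𝔼 D λ ω → 0≤* ≤-refl (0≤inside R (x ω))))
        where
        lem : ∀ a b → a + b - a ≡ b
        lem = solve-∀ ℚ-ring
      go (node j f p q) R = begin
        leafSum p R₀ (λ _ → pot) + leafSum q R₁ (λ _ → pot)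
          ≤⟨ +-mono-≤ (go p R₀) (go q R₁) ⟩
        pot R₀ + 2ℚ * cost p R₀ + (pot R₁ + 2ℚ * cost q R₁)
          ≡⟨ lem₁ (pot R₀) (cost p R₀) (pot R₁) (cost q R₁) ⟩
        pot R₀ + pot R₁ + 2ℚ * (cost p R₀ + cost q R₁)
          ≤⟨ +-monoˡ-≤ (2ℚ * (cost p R₀ + cost q R₁)) (pot-node j (f ∘ read) R) ⟩
        pot R + 2ℚ * speaks j R + 2ℚ * (cost p R₀ + cost q R₁)
          ≡⟨ lem₂ (pot R) (speaks j R) (cost p R₀ + cost q R₁) ⟩
        pot R + 2ℚ * (cost p R₀ + cost q R₁ + speaks j R)
          ≡⟨ cong (λ z → pot R + 2ℚ * z) (cost-node j f p q R) ⟩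
        pot R + 2ℚ * cost (node j f p q) R ∎
        where
        R₀ R₁ : Rect k
        R₀ = R ∣ j ∈ ∁ (f ∘ read)
        R₁ = R ∣ j ∈ (f ∘ read)
        lem₁ : ∀ a b c d → a + 2ℚ * b + (c + 2ℚ * d) ≡ a + c + 2ℚ * (b + d)
        lem₁ = solve-∀ ℚ-ring
        lem₂ : ∀ a b c → a + 2ℚ * b + 2ℚ * c ≡ a + 2ℚ * (c + b)
        lem₂ = solve-∀ ℚ-ring

    tri-at : ∀ {S} → (Bits S → Vec Bool n) → Fin S → Event → ℚ
    tri-at z t P = tri (given (P ∘ z) t false) (given (P ∘ z) t true)

    -- On each leaf the level-one inequality bounds the squared biases by entropy. The linear terms
    -- sum to the potential of the root, so only its increase remains; the 4 of `Φ-tri` times the 2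
    -- per bit of `Φ-split` gives 8.
    leafSum-info : ∀ i ϑ → (∀ j → Additive (ϑ j)) → (∀ j P → 0ℚ ≤ ϑ j P) → (∀ j → ϑ j (λ _ → true) ≡ 1ℚ) →
      ∀ {Ω : Set} (D : Dist Ω) (x : Ω → Fin k → Vec Bool n) → (∀ R → volume ϑ R ≡ 𝔼 D (λ ω → inside R (x ω))) →
      ∀ {S} (z : Bits S → Vec Bool n) → (∀ P → ϑ i P ≡ density (P ∘ z)) →
      ∀ π c → (∀ ω → bitsSent π (read ∘ x ω) i ℕ.≤ c) →
      ∑ (λ t → leafSum π everything (λ _ → volume (ϑ [ i ≔ tri-at z t ]))) ≤ 8ℚ * ι c
    leafSum-info i ϑ add 0≤ϑ ϑ-total D x sampled {S} z ϑi≡ π c bounded = begin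
      ∑ (λ t → leafSum π everything (λ _ → volume (ϑ [ i ≔ tri-at z t ])))
        ≡⟨ sym (leafSum-∑ π everything (λ t _ → volume (ϑ [ i ≔ tri-at z t ]))) ⟩
      leafSum π everything (λ _ R → ∑ (λ t → volume (ϑ [ i ≔ tri-at z t ]) R))
        ≤⟨ leafSum-mono π everything (λ _ R → entropy R) ⟩
      leafSum π everything (λ _ R → 4ℚ * (pot R + - h * volume ϑ R))
        ≡⟨ leafSum-*ˡ π everything 4ℚ (λ _ R → pot R + - h * volume ϑ R) ⟩
      4ℚ * leafSum π everything (λ _ R → pot R + - h * volume ϑ R)
        ≡⟨ cong (4ℚ *_) (trans (leafSum-+ π everything (λ _ → pot) (λ _ R → - h * volume ϑ R))
             (cong (leafSum π everything (λ _ → pot) +_) (trans (leafSum-*ˡ π everything (- h) (λ _ → volume ϑ))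
               (cong (- h *_) (trans (leafSum-volume ϑ add π everything) volume-everything))))) ⟩
      4ℚ * (leafSum π everything (λ _ → pot) + - h * 1ℚ)
        ≤⟨ *-mono-≤ˡ 4ℚ (nonNegative⁻¹ 4ℚ) (+-monoˡ-≤ (- h * 1ℚ)
             (leafSum-bits i ϑ S add 0≤ϑ D x sampled π everything)) ⟩
      4ℚ * (pot everything + 2ℚ * cost + - h * 1ℚ)
        ≡⟨ cong (λ y → 4ℚ * (y + 2ℚ * cost + - h * 1ℚ)) pot-everything ⟩
      4ℚ * (h * 1ℚ + 2ℚ * cost + - h * 1ℚ)
        ≡⟨ lem h cost ⟩
      8ℚ * cost
        ≤⟨ *-mono-≤ˡ 8ℚ (nonNegative⁻¹ 8ℚ) cost≤ ⟩
      8ℚ * ι c ∎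
      where
      open ≤-Reasoning
      pot : Rect k → ℚ
      pot = volume (ϑ [ i ≔ Φ S ∘ ϑ i ])
      h cost : ℚ
      h = Φ S 1ℚ
      cost = 𝔼 D (λ ω → ι (bitsSent π (read ∘ x ω) i) * inside everything (x ω))
      lem : ∀ h c → 4ℚ * (h * 1ℚ + 2ℚ * c + - h * 1ℚ) ≡ 8ℚ * c
      lem = solve-∀ ℚ-ring

      volume-everything : volume ϑ everything ≡ 1ℚ
      volume-everything = ∏-1 _ ϑ-total

      pot-everything : pot everything ≡ h * 1ℚ
      pot-everything = trans (volume-replace′ ϑ i (Φ S ∘ ϑ i) everything)
        (cong₂ _*_ (cong (Φ S) (ϑ-total i)) (∏-1 _ (λ j → skip≡1 j)))
        where
        skip≡1 : ∀ j → ((λ j → ϑ j (everything j)) [ i ≔ 1ℚ ]) j ≡ 1ℚ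
        skip≡1 j with j Finₚ.≟ i
        ... | yes refl = updateAt-updates i _
        ... | no j≢i   = trans (updateAt-minimal j i _ j≢i) (ϑ-total j)

      cost≤ : cost ≤ ι c
      cost≤ = subst (cost ≤_) (𝔼-const D (ι c)) (𝔼-mono D λ ω →
        ≤-trans (≤-reflexive (trans (cong (ι (bitsSent π (read ∘ x ω) i) *_) (inside-everything (x ω))) (*-identityʳ _)))
                (ι-mono (bounded ω)))

      entropy : ∀ R → ∑ (λ t → volume (ϑ [ i ≔ tri-at z t ]) R) ≤ 4ℚ * (pot R + - h * volume ϑ R)
      entropy R = begin
        ∑ (λ t → volume (ϑ [ i ≔ tri-at z t ]) R)
          ≡⟨ ∑-cong (λ t → trans (volume-replace′ ϑ i (tri-at z t) R) (*-comm (tri-at z t (R i)) s)) ⟩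
        ∑ (λ t → s * tri-at z t (R i))
          ≡⟨ ∑-*ˡ s (λ t → tri-at z t (R i)) ⟩
        s * ∑ (λ t → tri-at z t (R i))
          -- The cutoff of `Φ` is the number of coins, which is the finest scale of any density
          -- here.
          ≤⟨ *-mono-≤ˡ s (0≤∏-skip (λ j → 0≤ϑ j (R j)) i) (∑-tri≤entropy S ℕₚ.≤-refl (R i ∘ z)) ⟩
        s * (4ℚ * (Φ S (density (R i ∘ z)) - h * density (R i ∘ z)))
          ≡⟨ cong (λ y → s * (4ℚ * (Φ S y - h * y))) (sym (ϑi≡ (R i))) ⟩
        s * (4ℚ * (Φ S (ϑ i (R i)) - h * ϑ i (R i)))
          ≡⟨ lem′ s (Φ S (ϑ i (R i))) h (ϑ i (R i)) ⟩
        4ℚ * (Φ S (ϑ i (R i)) * s + - h * (ϑ i (R i) * s))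
          ≡⟨ cong₂ (λ a b → 4ℚ * (a + - h * b)) (sym (volume-replace′ ϑ i (Φ S ∘ ϑ i) R)) (sym (volume-split ϑ R i)) ⟩
        4ℚ * (pot R + - h * volume ϑ R) ∎
        where
        s : ℚ
        s = skip ϑ R i
        lem′ : ∀ s a h b → s * (4ℚ * (a - h * b)) ≡ 4ℚ * (a * s + - h * (b * s))
        lem′ = solve-∀ ℚ-ring

-- Sizes, and symmetry of the inputs

size-cong : ∀ {m} {f g : Fin m → Bool} → (∀ i → f i ≡ g i) → size f ≡ size g
size-cong {zero}  f≗g = refl
size-cong {suc m} f≗g = cong₂ (λ b s → (if b then 1 else 0) ℕ.+ s) (f≗g fzero) (size-cong (f≗g ∘ fsuc))

size-remove : ∀ {m} (f : Fin (suc m) → Bool) i → size f ≡ (if f i then 1 else 0) ℕ.+ size (f ∘ punchIn i)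
size-remove         f fzero    = refl
size-remove {suc m} f (fsuc i) = trans
  (cong ((if f fzero then 1 else 0) ℕ.+_) (size-remove (f ∘ fsuc) i))
  (lem (if f fzero then 1 else 0) (if f (fsuc i) then 1 else 0) _)
  where
  lem : ∀ a b c → a ℕ.+ (b ℕ.+ c) ≡ b ℕ.+ (a ℕ.+ c)
  lem a b c = trans (sym (ℕₚ.+-assoc a b c)) (trans (cong (ℕ._+ c) (ℕₚ.+-comm a b)) (ℕₚ.+-assoc b a c))

size-≤ : ∀ {m} (f : Fin m → Bool) → size f ℕ.≤ m
size-≤ {zero}  f = z≤n
size-≤ {suc m} f with f fzero
... | true  = s≤s (size-≤ (f ∘ fsuc))
... | false = ℕₚ.m≤n⇒m≤1+n (size-≤ (f ∘ fsuc))

size-none : ∀ {m} {f : Fin m → Bool} → (∀ i → f i ≡ false) → size f ≡ 0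
size-none {zero}  none = refl
size-none {suc m} none rewrite none fzero = size-none (none ∘ fsuc)

size-all : ∀ {m} {f : Fin m → Bool} → (∀ i → f i ≡ true) → size f ≡ m
size-all {zero}  all = refl
size-all {suc m} all rewrite all fzero = cong suc (size-all (all ∘ fsuc))

size≡m⇒all : ∀ {m} (f : Fin m → Bool) → size f ≡ m → ∀ i → f i ≡ true
size≡m⇒all {suc m} f eq i with f i in fi
... | true  = refl
... | false = contradiction (subst (ℕ._≤ m) (trans (sym size≡) eq) (size-≤ (f ∘ punchIn i))) ℕₚ.1+n≰n
  where
  size≡ : size f ≡ size (f ∘ punchIn i)
  size≡ = trans (size-remove f i) (cong (λ b → (if b then 1 else 0) ℕ.+ size (f ∘ punchIn i)) fi)

1≤size : ∀ {m} (f : Fin m → Bool) i → f i ≡ true → 1 ℕ.≤ size f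
1≤size {suc m} f i fi rewrite size-remove f i | fi = s≤s z≤n

1≤size⇒∃ : ∀ {m} (f : Fin m → Bool) → 1 ℕ.≤ size f → ∃ λ i → f i ≡ true
1≤size⇒∃ {suc m} f h with f fzero in f0
... | true  = fzero , f0
... | false = let i , fi = 1≤size⇒∃ (f ∘ fsuc) h in fsuc i , fi

size≤1⇒unique : ∀ {m} (f : Fin m → Bool) → size f ℕ.≤ 1 → ∀ i j → f i ≡ true → f j ≡ true → i ≡ j
size≤1⇒unique {suc m} f h i j fi fj with i Finₚ.≟ j
... | yes i≡j = i≡j
... | no i≢j  = contradiction (ℕₚ.≤-trans two h) (λ { (s≤s ()) })
  where
  rest : 1 ℕ.≤ size (f ∘ punchIn i)
  rest = 1≤size (f ∘ punchIn i) (punchOut i≢j) (trans (cong f (Finₚ.punchIn-punchOut i≢j)) fj)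
  two : 2 ℕ.≤ size f
  two = subst (2 ℕ.≤_) (sym (trans (size-remove f i)
          (cong (λ b → (if b then 1 else 0) ℕ.+ size (f ∘ punchIn i)) fi))) (s≤s rest)

unique⇒size≤1 : ∀ {m} (f : Fin m → Bool) → (∀ i j → f i ≡ true → f j ≡ true → i ≡ j) → size f ℕ.≤ 1
unique⇒size≤1 {zero}  f uniq = z≤n
unique⇒size≤1 {suc m} f uniq with f fzero in f0
... | false = unique⇒size≤1 (f ∘ fsuc) (λ i j fi fj → Finₚ.suc-injective (uniq (fsuc i) (fsuc j) fi fj))
... | true  = s≤s (ℕₚ.≤-reflexive (size-none rest))
  where
  rest : ∀ i → f (fsuc i) ≡ false
  rest i with f (fsuc i) in fi
  ... | false = refl
  ... | true  = contradiction (uniq fzero (fsuc i) f0 fi) (λ ())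

sumℕ-+ : ∀ {k} (f g : Fin k → ℕ) → sumℕ (λ i → f i ℕ.+ g i) ≡ sumℕ f ℕ.+ sumℕ g
sumℕ-+ {zero}  f g = refl
sumℕ-+ {suc k} f g = trans (cong (f fzero ℕ.+ g fzero ℕ.+_) (sumℕ-+ (f ∘ fsuc) (g ∘ fsuc)))
  (interchange ℕₚ.+-commutativeSemigroup (f fzero) (g fzero) _ _)

sumℕ-cong : ∀ {k} {f g : Fin k → ℕ} → (∀ i → f i ≡ g i) → sumℕ f ≡ sumℕ g
sumℕ-cong {zero}  f≗g = refl
sumℕ-cong {suc k} f≗g = cong₂ ℕ._+_ (f≗g fzero) (sumℕ-cong (f≗g ∘ fsuc))

sumℕ-≤ : ∀ {k} {f : Fin k → ℕ} → (∀ i → f i ℕ.≤ 1) → sumℕ f ℕ.≤ k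
sumℕ-≤ {zero}  f≤1 = z≤n
sumℕ-≤ {suc k} f≤1 = ℕₚ.+-mono-≤ (f≤1 fzero) (sumℕ-≤ (f≤1 ∘ fsuc))

sumℕ-≥ : ∀ {k} {f : Fin k → ℕ} → (∀ i → 1 ℕ.≤ f i) → k ℕ.≤ sumℕ f
sumℕ-≥ {zero}  1≤f = z≤n
sumℕ-≥ {suc k} 1≤f = ℕₚ.+-mono-≤ (1≤f fzero) (sumℕ-≥ (1≤f ∘ fsuc))

sumℕ-0 : ∀ k → sumℕ {k} (λ _ → 0) ≡ 0
sumℕ-0 zero    = refl
sumℕ-0 (suc k) = sumℕ-0 k

size≡sumℕ : ∀ {m} (f : Fin m → Bool) → size f ≡ sumℕ (λ i → if f i then 1 else 0)
size≡sumℕ {zero}  f = refl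
size≡sumℕ {suc m} f = cong ((if f fzero then 1 else 0) ℕ.+_) (size≡sumℕ (f ∘ fsuc))

rows≡columns : ∀ {k n} (X : Input k n) → sumℕ (λ i → size (X i)) ≡ sumℕ (λ j → size (column X j))
rows≡columns {zero}  {n} X = sym (sumℕ-0 n)
rows≡columns {suc k}     X = trans (cong₂ ℕ._+_ (size≡sumℕ (X fzero)) (rows≡columns (X ∘ fsuc)))
                               (sym (sumℕ-+ (λ j → if X fzero j then 1 else 0) (λ j → size (column (X ∘ fsuc) j))))

module _ {k n} (X Y : Input k (suc n)) (X₀ : F0 X) (Y₀ : F0 Y) (sizes : ∀ i → size (X i) ≡ size (Y i)) where

  private
    -- Counting incidences: without an empty column `Y` would have at least `n + 1` of them, while
    -- `X`, with one empty column and at most one incidence in each other, has at most `n`.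
    blank : (∀ i → X i fzero ≡ false) → ∃ λ j → ∀ i → Y i j ≡ false
    blank none with Finₚ.any? (λ j → Finₚ.all? (λ i → Y i j 𝔹.≟ false))
    ... | yes found = found
    ... | no ¬found = contradiction (ℕₚ.≤-trans (ℕₚ.≤-trans many (ℕₚ.≤-reflexive same)) few) ℕₚ.1+n≰n
      where
      hit : ∀ j → 1 ℕ.≤ size (column Y j)
      hit j with Finₚ.any? (λ i → Y i j 𝔹.≟ true)
      ... | yes (i , yij) = 1≤size (column Y j) i yij
      ... | no ¬hit = contradiction (j , λ i → Boolₚ.¬-not (λ yij → ¬hit (i , yij))) ¬found
      many : suc n ℕ.≤ sumℕ (λ j → size (column Y j))
      many = sumℕ-≥ hit
      same : sumℕ (λ j → size (column Y j)) ≡ sumℕ (λ j → size (column X j))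
      same = trans (sym (rows≡columns Y)) (trans (sumℕ-cong (λ i → sym (sizes i))) (rows≡columns X))
      few : sumℕ (λ j → size (column X j)) ℕ.≤ n
      few = ℕₚ.+-mono-≤ (ℕₚ.≤-reflexive (size-none none)) (sumℕ-≤ (λ j → X₀ (fsuc j)))

  -- A nonempty column of a disjoint input determines a player, who owns a point in `Y` as well
  -- because the sizes agree; disjointness then makes the two columns equal.
  match-column : ∃ λ j → ∀ i → X i fzero ≡ Y i j
  match-column with Finₚ.any? (λ i → X i fzero 𝔹.≟ true)
  ... | no ¬any = let none = λ i → Boolₚ.¬-not (λ xi → ¬any (i , xi))
                      j , yj = blank none
                  in j , λ i → trans (none i) (sym (yj i))
  ... | yes (i , xi) = j , same
    where
    found : ∃ λ j → Y i j ≡ true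
    found = 1≤size⇒∃ (Y i) (subst (1 ℕ.≤_) (sizes i) (1≤size (X i) fzero xi))
    j : Fin (suc n)
    j = proj₁ found
    same : ∀ i′ → X i′ fzero ≡ Y i′ j
    same i′ with X i′ fzero in xi′ | Y i′ j in yi′
    ... | true  | true  = refl
    ... | false | false = refl
    ... | true  | false with refl ← size≤1⇒unique (column X fzero) (X₀ fzero) i i′ xi xi′ =
            trans (sym (proj₂ found)) yi′
    ... | false | true  with refl ← size≤1⇒unique (column Y j) (Y₀ j) i i′ (proj₂ found) yi′ =
            trans (sym xi′) xi

_∘ᵢ_ : ∀ {k n m} → Input k n → (Fin m → Fin n) → Input k m
(X ∘ᵢ f) i x = X i (f x)

extend-match : ∀ {k n} (X Y : Input k (suc n)) x y (σ : Permutation′ n) → (∀ i → X i x ≡ Y i y) →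
  (∀ i z → X i (punchIn x z) ≡ Y i (punchIn y (σ ⟨$⟩ʳ z))) → ∀ i z → X i z ≡ Y i (Perm.insert x y σ ⟨$⟩ʳ z)
extend-match X Y x y σ here there i z with x Finₚ.≟ z
... | yes refl = here i
... | no x≢z   = trans (cong (X i) (sym (Finₚ.punchIn-punchOut x≢z))) (there i (punchOut x≢z))

removed-size : ∀ {k n} (X Y : Input k (suc n)) x y i → size (X i) ≡ size (Y i) → X i x ≡ Y i y →
               size ((X ∘ᵢ punchIn x) i) ≡ size ((Y ∘ᵢ punchIn y) i)
removed-size X Y x y i sizes eq = ℕₚ.+-cancelˡ-≡ (if Y i y then 1 else 0) _ _
  (trans (cong (λ b → (if b then 1 else 0) ℕ.+ size ((X ∘ᵢ punchIn x) i)) (sym eq))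
    (trans (sym (size-remove (X i) x)) (trans sizes (size-remove (Y i) y))))

-- Matching the columns one at a time shows that the disjoint inputs of given sizes form a single
-- orbit under permutations of the points. Hence a random placement of any one of them is uniform on
-- all of them.
F0-transitive : ∀ {k n} (X Y : Input k n) → F0 X → F0 Y → (∀ i → size (X i) ≡ size (Y i)) →
                Σ (Permutation′ n) λ σ → ∀ i x → X i x ≡ Y i (σ ⟨$⟩ʳ x)
F0-transitive {n = zero}  X Y X₀ Y₀ sizes = Perm.id , λ _ ()
F0-transitive {n = suc n} X Y X₀ Y₀ sizes =
  let j , same = match-column X Y X₀ Y₀ sizes
      σ , match = F0-transitive (X ∘ᵢ fsuc) (Y ∘ᵢ punchIn j) (X₀ ∘ fsuc) (Y₀ ∘ punchIn j)
                    (λ i → removed-size X Y fzero j i (sizes i) (same i))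
  in Perm.insert fzero j σ , extend-match X Y fzero j σ same match

-- Removing the common point from both inputs leaves disjoint inputs of equal sizes.
F1-transitive : ∀ {k n} (X Y : Input k n) → F1 X → F1 Y → (∀ i → size (X i) ≡ size (Y i)) →
                Σ (Permutation′ n) λ σ → ∀ i x → X i x ≡ Y i (σ ⟨$⟩ʳ x)
F1-transitive {n = suc n} X Y (x , X₁ , X₀) (y , Y₁ , Y₀) sizes =
  let σ , match = F0-transitive (X ∘ᵢ punchIn x) (Y ∘ᵢ punchIn y)
                    (λ z → X₀ (punchIn x z) (Finₚ.punchInᵢ≢i x z))
                    (λ z → Y₀ (punchIn y z) (Finₚ.punchInᵢ≢i y z))
                    (λ i → removed-size X Y x y i (sizes i) (same i))
  in Perm.insert x y σ , extend-match X Y x y σ same match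
  where
  same : ∀ i → X i x ≡ Y i y
  same i = trans (size≡m⇒all (column X x) X₁ i) (sym (size≡m⇒all (column Y y) Y₁ i))

injective⇒permutation : ∀ {n} (f : Fin n → Fin n) → (∀ x y → f x ≡ f y → x ≡ y) →
                        Σ (Permutation′ n) λ σ → ∀ x → σ ⟨$⟩ʳ x ≡ f x
injective⇒permutation {zero}  f inj = Perm.id , λ ()
injective⇒permutation {suc n} f inj =
  Perm.permutation f (proj₁ ∘ onto) (proj₂ ∘ onto) (λ x → inj _ _ (proj₂ (onto (f x)))) , λ _ → refl
  where
  onto : ∀ y → ∃ λ x → f x ≡ y
  onto y with Finₚ.any? (λ x → f x Finₚ.≟ y)
  ... | yes found = found
  ... | no missed = contradiction (Finₚ.injective⇒≤ g-injective) ℕₚ.1+n≰n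
    where
    y≢f : ∀ x → ¬ y ≡ f x
    y≢f x y≡fx = missed (x , sym y≡fx)
    g : Fin (suc n) → Fin n
    g x = punchOut (y≢f x)
    g-injective : ∀ {x x′} → g x ≡ g x′ → x ≡ x′
    g-injective {x} {x′} eq = inj x x′ (Finₚ.punchOut-injective (y≢f x) (y≢f x′) eq)

-- Uniform placements

sumᴸ-≥ : (_≟′_ : (x y : A) → Dec (x ≡ y)) (xs : List A) → Enumerates _≟′_ xs →
         ∀ {h : A → ℚ} → (∀ x → 0ℚ ≤ h x) → ∀ y → h y ≤ sumᴸ xs h
sumᴸ-≥ _≟′_ xs enum {h} 0≤h y = subst (_≤ sumᴸ xs h) (sumᴸ-δ _≟′_ xs enum h y)
  (sumᴸ-mono xs λ x → shrink (does (x ≟′ y)) (0≤h x))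
  where
  shrink : ∀ b {y} → 0ℚ ≤ y → ⟦ b ⟧ * y ≤ y
  shrink true  {y} 0≤y = ≤-reflexive (*-identityˡ y)
  shrink false {y} 0≤y = subst (_≤ y) (sym (*-zeroˡ y)) 0≤y

Vec-≟ : ∀ {n m} (v w : Vec (Fin n) m) → Dec (v ≡ w)
Vec-≟ = Vecₚ.≡-dec Finₚ._≟_

Injective : ∀ {n} → Vec (Fin n) n → Set
Injective v = ∀ x y → lookup v x ≡ lookup v y → x ≡ y

injective? : ∀ {n} (v : Vec (Fin n) n) → Dec (Injective v)
injective? v = Finₚ.all? λ x → Finₚ.all? λ y → (lookup v x Finₚ.≟ lookup v y) →-dec (x Finₚ.≟ y)

endos : ∀ n → List (Vec (Fin n) n)
endos n = vecs (fins n) n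

enumerates-endos : ∀ n → Enumerates Vec-≟ (endos n)
enumerates-endos n = enumerates-vecs Finₚ._≟_ (fins n) (enumerates-fins n) n

indicator : ∀ {n} → Vec (Fin n) n → ℚ
indicator v = ⟦ does (injective? v) ⟧

bijections : ℕ → ℚ
bijections n = sumᴸ (endos n) indicator

1≤bijections : ∀ n → 1ℚ ≤ bijections n
1≤bijections n = begin
  1ℚ
    ≡⟨ cong ⟦_⟧ (sym (dec-true (injective? idᵛ) λ x y eq →
         trans (sym (Vecₚ.lookup∘tabulate _ x)) (trans eq (Vecₚ.lookup∘tabulate _ y)))) ⟩
  indicator idᵛ
    ≤⟨ sumᴸ-≥ Vec-≟ (endos n) (enumerates-endos n) (λ v → 0≤⟦ does (injective? v) ⟧) idᵛ ⟩
  bijections n ∎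
  where
  open ≤-Reasoning
  idᵛ : Vec (Fin n) n
  idᵛ = tabulate (λ x → x)

1≤⇒≢0 : ∀ {p} → 1ℚ ≤ p → ¬ p ≡ 0ℚ
1≤⇒≢0 1≤p refl = contradiction (≤-antisym 1≤p 0≤1) λ ()

-- A uniformly random bijection, obtained by giving weight zero to the vectors that are not
-- injective. The normalising constant is never computed; that it is at least 1 makes its inverse
-- meaningful.
𝔅 : ∀ n → Dist (Vec (Fin n) n)
𝔅 n = record
  { support  = endos n
  ; weight   = λ v → inv (bijections n) * indicator v
  ; 0≤weight = λ v → 0≤* (0≤inv (≤-trans 0≤1 (1≤bijections n))) 0≤⟦ does (injective? v) ⟧
  ; total    = trans (sumᴸ-*ˡ (endos n) (inv (bijections n)) indicator)
                     (trans (*-comm (inv (bijections n)) (bijections n)) (*-inv (1≤⇒≢0 (1≤bijections n))))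
  }

𝔼-𝔅-cong : ∀ {n} {g h : Vec (Fin n) n → ℚ} →
  (∀ v (σ : Permutation′ n) → (∀ x → σ ⟨$⟩ʳ x ≡ lookup v x) → g v ≡ h v) → 𝔼 (𝔅 n) g ≡ 𝔼 (𝔅 n) h
𝔼-𝔅-cong {n} {g} {h} eq = sumᴸ-cong (endos n) λ v → pointwise v (injective? v)
  where
  zero-weight : ∀ a b → inv (bijections n) * 0ℚ * a ≡ inv (bijections n) * 0ℚ * b
  zero-weight a b = trans (lem (inv (bijections n)) a) (sym (lem (inv (bijections n)) b))
    where
    lem : ∀ c a → c * 0ℚ * a ≡ 0ℚ
    lem = solve-∀ ℚ-ring
  pointwise : ∀ v (d : Dec (Injective v)) →
              inv (bijections n) * ⟦ does d ⟧ * g v ≡ inv (bijections n) * ⟦ does d ⟧ * h v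
  pointwise v (yes inj) = let σ , σ≡ = injective⇒permutation (lookup v) inj in
                          cong (inv (bijections n) * 1ℚ *_) (eq v σ σ≡)
  pointwise v (no _)    = zero-weight (g v) (h v)

𝔼-𝔅-translate : ∀ {n} (σ : Permutation′ n) (h : Vec (Fin n) n → ℚ) →
                 𝔼 (𝔅 n) (λ v → h (Vec.map (σ ⟨$⟩ʳ_) v)) ≡ 𝔼 (𝔅 n) h
𝔼-𝔅-translate {n} σ h = trans
  (sumᴸ-cong (endos n) λ v → cong (λ b → inv (bijections n) * ⟦ b ⟧ * h (φ v))
    (does-⇔ (mk⇔ (forward v) (backward v)) (injective? v) (injective? (φ v))))
  (sumᴸ-reindex Vec-≟ (endos n) (enumerates-endos n) φ ψ
    (λ v → trans (sym (Vecₚ.map-∘ (σ ⟨$⟩ʳ_) (σ ⟨$⟩ˡ_) v)) (trans (Vecₚ.map-cong (λ _ → Perm.inverseʳ σ) v) (Vecₚ.map-id v)))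
    (λ v → trans (sym (Vecₚ.map-∘ (σ ⟨$⟩ˡ_) (σ ⟨$⟩ʳ_) v)) (trans (Vecₚ.map-cong (λ _ → Perm.inverseˡ σ) v) (Vecₚ.map-id v)))
    (λ v → inv (bijections n) * indicator v * h v))
  where
  φ ψ : Vec (Fin n) n → Vec (Fin n) n
  φ = Vec.map (σ ⟨$⟩ʳ_)
  ψ = Vec.map (σ ⟨$⟩ˡ_)
  forward : ∀ v → Injective v → Injective (φ v)
  forward v inj x y eq = inj x y (trans (sym (Perm.inverseˡ σ)) (trans (cong (σ ⟨$⟩ˡ_)
    (trans (sym (Vecₚ.lookup-map x (σ ⟨$⟩ʳ_) v)) (trans eq (Vecₚ.lookup-map y (σ ⟨$⟩ʳ_) v)))) (Perm.inverseˡ σ)))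
  backward : ∀ v → Injective (φ v) → Injective v
  backward v inj x y eq = inj x y (trans (Vecₚ.lookup-map x (σ ⟨$⟩ʳ_) v)
    (trans (cong (σ ⟨$⟩ʳ_) eq) (sym (Vecₚ.lookup-map y (σ ⟨$⟩ʳ_) v))))

asInput : ∀ {k n} → Vec (Vec Bool n) k → Input k n
asInput V i = lookup (lookup V i)

place : ∀ {k n} → Input k n → Vec (Fin n) n → Fin k → Vec Bool n
place X v i = tabulate (X i ∘ lookup v)

place-cong : ∀ {k n} {X Y : Input k n} → (∀ i x → X i x ≡ Y i x) → ∀ v i → place X v i ≡ place Y v i
place-cong X≗Y v i = Vecₚ.tabulate-cong (λ x → X≗Y i (lookup v x))

place-translate : ∀ {k n} (X : Input k n) (σ : Permutation′ n) v i →
                  place X (Vec.map (σ ⟨$⟩ʳ_) v) i ≡ place (X ∘ᵢ (σ ⟨$⟩ʳ_)) v i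
place-translate X σ v i = Vecₚ.tabulate-cong (λ x → cong (X i) (Vecₚ.lookup-map x (σ ⟨$⟩ʳ_) v))

inputs : ∀ k n → List (Vec (Vec Bool n) k)
inputs k n = vecs (vecs bools n) k

-- `respects` carries `Q` between inputs that agree pointwise, so that an input and its encoding by
-- vectors can be exchanged.
record Orbit {k n} (Q : Input k n → Set) : Set where
  field
    dec        : ∀ X → Dec (Q X)
    respects       : ∀ {X Y} → (∀ i x → X i x ≡ Y i x) → Q X → Q Y
    invariant  : ∀ {X} (σ : Permutation′ n) → Q X → Q (X ∘ᵢ (σ ⟨$⟩ʳ_))
    transitive : ∀ X Y → Q X → Q Y → Σ (Permutation′ n) λ σ → ∀ i x → X i x ≡ Y i (σ ⟨$⟩ʳ x)

module _ {k n} {Q : Input k n → Set} (orbit : Orbit Q) where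
  open Orbit orbit

  member : Vec (Vec Bool n) k → ℚ
  member V = ⟦ does (dec (asInput V)) ⟧

  -- Both sides count pairs of a placement of Y and a member of the orbit.
  orbit-average : ∀ Y → Q Y → (g : (Fin k → Vec Bool n) → ℚ) → (∀ {x y} → (∀ i → x i ≡ y i) → g x ≡ g y) →
    𝔼 (𝔅 n) (λ v → g (place Y v)) * sumᴸ (inputs k n) member ≡ sumᴸ (inputs k n) (λ V → member V * g (lookup V))
  orbit-average Y QY g g-cong = begin
    a * sumᴸ (inputs k n) member
      ≡⟨ sym (sumᴸ-*ˡ (inputs k n) a member) ⟩
    sumᴸ (inputs k n) (λ V → a * member V)
      ≡⟨ sumᴸ-cong (inputs k n) (λ V → trans (*-comm a (member V)) (transport V (dec (asInput V)))) ⟩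
    sumᴸ (inputs k n) (λ V → member V * 𝔼 (𝔅 n) (λ v → g (place (asInput V) v)))
      ≡⟨ sumᴸ-cong (inputs k n) (λ V → sym (𝔼-*ˡ (𝔅 n) (member V) (λ v → g (place (asInput V) v)))) ⟩
    sumᴸ (inputs k n) (λ V → 𝔼 (𝔅 n) (λ v → member V * g (place (asInput V) v)))
      ≡⟨ sym (𝔼-sumᴸ (𝔅 n) (inputs k n) (λ V v → member V * g (place (asInput V) v))) ⟩
    𝔼 (𝔅 n) (λ v → sumᴸ (inputs k n) (λ V → member V * g (place (asInput V) v)))
      ≡⟨ 𝔼-𝔅-cong permute ⟩
    𝔼 (𝔅 n) (λ _ → sumᴸ (inputs k n) (λ V → member V * g (lookup V)))
      ≡⟨ 𝔼-const (𝔅 n) _ ⟩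
    sumᴸ (inputs k n) (λ V → member V * g (lookup V)) ∎
    where
    open ≡-Reasoning
    a : ℚ
    a = 𝔼 (𝔅 n) (λ v → g (place Y v))

    -- A member `V` of the orbit is a permuted `Y`, and the random placement is invariant under
    -- permutations.
    transport : ∀ V (d : Dec (Q (asInput V))) →
                ⟦ does d ⟧ * a ≡ ⟦ does d ⟧ * 𝔼 (𝔅 n) (λ v → g (place (asInput V) v))
    transport V (no _)   = trans (*-zeroˡ a) (sym (*-zeroˡ (𝔼 (𝔅 n) (λ v → g (place (asInput V) v)))))
    transport V (yes QV) = let σ , V≡Yσ = transitive (asInput V) Y QV QY in
      cong (1ℚ *_) (sym (trans
        (𝔼-cong (𝔅 n) λ v → g-cong λ i → trans (place-cong V≡Yσ v i) (sym (place-translate Y σ v i)))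
        (𝔼-𝔅-translate σ (λ v → g (place Y v)))))

    -- A fixed placement relabels the points, which maps the orbit bijectively onto itself, so the
    -- sum does not depend on the placement.
    permute : ∀ v (σ : Permutation′ n) → (∀ x → σ ⟨$⟩ʳ x ≡ lookup v x) →
      sumᴸ (inputs k n) (λ V → member V * g (place (asInput V) v)) ≡ sumᴸ (inputs k n) (λ V → member V * g (lookup V))
    permute v σ σ≡ = trans
      (sumᴸ-cong (inputs k n) λ V → cong₂ _*_
        (cong ⟦_⟧ (does-⇔ (mk⇔ (λ q → respects (λ i x → sym (φ-lookup V i x)) (invariant σ q))
                                (λ q → respects (λ i x → trans (φ-lookup V i (σ ⟨$⟩ˡ x))
                                                           (cong (asInput V i) (Perm.inverseʳ σ)))
                                            (invariant (Perm.flip σ) q)))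
                           (dec (asInput V)) (dec (asInput (φ V)))))
        (g-cong λ i → sym (trans (Vecₚ.lookup-map i (λ r → tabulate (lookup r ∘ (σ ⟨$⟩ʳ_))) V)
                                 (Vecₚ.tabulate-cong λ x → cong (asInput V i) (σ≡ x)))))
      (sumᴸ-reindex (Vecₚ.≡-dec (Vecₚ.≡-dec 𝔹._≟_)) (inputs k n)
        (enumerates-vecs (Vecₚ.≡-dec 𝔹._≟_) (vecs bools n) (enumerates-vecs 𝔹._≟_ bools enumerates-bools n) k)
        φ ψ (cancel (λ _ → Perm.inverseˡ σ)) (cancel (λ _ → Perm.inverseʳ σ))
        (λ V → member V * g (lookup V)))
      where
      along : (Fin n → Fin n) → Vec (Vec Bool n) k → Vec (Vec Bool n) k
      along f = Vec.map (λ r → tabulate (lookup r ∘ f))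
      φ ψ : Vec (Vec Bool n) k → Vec (Vec Bool n) k
      φ = along (σ ⟨$⟩ʳ_)
      ψ = along (σ ⟨$⟩ˡ_)
      φ-lookup : ∀ V i x → asInput (φ V) i x ≡ asInput V i (σ ⟨$⟩ʳ x)
      φ-lookup V i x = trans (cong (λ r → lookup r x) (Vecₚ.lookup-map i _ V)) (Vecₚ.lookup∘tabulate _ x)
      cancel : ∀ {f f⁻¹ : Fin n → Fin n} → (∀ x → f⁻¹ (f x) ≡ x) → ∀ V → along f (along f⁻¹ V) ≡ V
      cancel {f} {f⁻¹} f⁻¹f V = trans (sym (Vecₚ.map-∘ _ _ V)) (trans (Vecₚ.map-cong (λ r →
        trans (Vecₚ.tabulate-cong λ x → trans (Vecₚ.lookup∘tabulate _ (f x)) (cong (lookup r) (f⁻¹f x)))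
              (Vecₚ.tabulate∘lookup r)) V) (Vecₚ.map-id V))

  1≤members : ∀ Y → Q Y → 1ℚ ≤ sumᴸ (inputs k n) member
  1≤members Y QY = begin
    1ℚ
      ≡⟨ cong ⟦_⟧ (sym (dec-true (dec (asInput V₀)) (respects (λ i x → sym (V₀-lookup i x)) QY))) ⟩
    member V₀
      ≤⟨ sumᴸ-≥ Input-≟ (inputs k n) enum (λ V → 0≤⟦ does (dec (asInput V)) ⟧) V₀ ⟩
    sumᴸ (inputs k n) member ∎
    where
    open ≤-Reasoning
    Input-≟ : (V W : Vec (Vec Bool n) k) → Dec (V ≡ W)
    Input-≟ = Vecₚ.≡-dec (Vecₚ.≡-dec 𝔹._≟_)
    enum : Enumerates Input-≟ (inputs k n)
    enum = enumerates-vecs (Vecₚ.≡-dec 𝔹._≟_) (vecs bools n) (enumerates-vecs 𝔹._≟_ bools enumerates-bools n) k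
    V₀ : Vec (Vec Bool n) k
    V₀ = tabulate (λ i → tabulate (Y i))
    V₀-lookup : ∀ i x → asInput V₀ i x ≡ Y i x
    V₀-lookup i x = trans (cong (λ r → lookup r x) (Vecₚ.lookup∘tabulate _ i)) (Vecₚ.lookup∘tabulate _ x)

-- Cardinalities as rational sums, and the two orbits.

ι-injective : ∀ {m n} → ι m ≡ ι n → m ≡ n
ι-injective {zero}  {zero}  eq = refl
ι-injective {zero}  {suc n} eq = contradiction (sym eq) (1≤⇒≢0 (+-mono-≤ {1ℚ} {1ℚ} ≤-refl (ι-mono {0} {n} z≤n)))
ι-injective {suc m} {zero}  eq = contradiction eq (1≤⇒≢0 (+-mono-≤ {1ℚ} {1ℚ} ≤-refl (ι-mono {0} {m} z≤n)))
ι-injective {suc m} {suc n} eq = cong suc (ι-injective (trans (lem (ι m)) (trans (cong (_- 1ℚ) eq) (sym (lem (ι n))))))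
  where
  lem : ∀ a → a ≡ 1ℚ + a - 1ℚ
  lem = solve-∀ ℚ-ring

ι-if : ∀ b n → ι ((if b then 1 else 0) ℕ.+ n) ≡ ⟦ b ⟧ + ι n
ι-if true  n = refl
ι-if false n = sym (+-identityˡ (ι n))

ι-size : ∀ {m} (f : Fin m → Bool) → ι (size f) ≡ sumᴸ (fins m) (λ x → ⟦ f x ⟧)
ι-size {zero}  f = refl
ι-size {suc m} f = trans (ι-if (f fzero) (size (f ∘ fsuc)))
  (cong (⟦ f fzero ⟧ +_) (trans (ι-size (f ∘ fsuc)) (sym (sumᴸ-map fsuc (fins m) (λ x → ⟦ f x ⟧)))))

∑-size : ∀ {m} (f : Fin m → Bool) → ∑ (λ x → ⟦ f x ⟧) ≡ ι (size f)
∑-size {zero}  f = refl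
∑-size {suc m} f = trans (cong (⟦ f fzero ⟧ +_) (∑-size (f ∘ fsuc))) (sym (ι-if (f fzero) (size (f ∘ fsuc))))

-- Rational sums make `sumᴸ-reindex` available, and `ι-injective` leads back to cardinalities.
size-permute : ∀ {m} (f : Fin m → Bool) (σ : Permutation′ m) → size (f ∘ (σ ⟨$⟩ʳ_)) ≡ size f
size-permute {m} f σ = ι-injective (begin
  ι (size (f ∘ (σ ⟨$⟩ʳ_)))                     ≡⟨ ι-size (f ∘ (σ ⟨$⟩ʳ_)) ⟩
  sumᴸ (fins m) (λ x → ⟦ f (σ ⟨$⟩ʳ x) ⟧)       ≡⟨ sumᴸ-reindex Finₚ._≟_ (fins m) (enumerates-fins m) (σ ⟨$⟩ʳ_) (σ ⟨$⟩ˡ_)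
                                                    (λ _ → Perm.inverseʳ σ) (λ _ → Perm.inverseˡ σ) (λ x → ⟦ f x ⟧) ⟩
  sumᴸ (fins m) (λ x → ⟦ f x ⟧)                ≡⟨ sym (ι-size f) ⟩
  ι (size f)                                   ∎)
  where open ≡-Reasoning

module _ {k n : ℕ} (s : Fin k → ℕ) where

  private
    Fs-respects : ∀ {X Y : Input k n} → (∀ i x → X i x ≡ Y i x) → Fs s X → Fs s Y
    Fs-respects X≗Y Xs i = trans (sym (size-cong (X≗Y i))) (Xs i)

    Fs-invariant : ∀ {X : Input k n} (σ : Permutation′ n) → Fs s X → Fs s (X ∘ᵢ (σ ⟨$⟩ʳ_))
    Fs-invariant {X} σ Xs i = trans (size-permute (X i) σ) (Xs i)

    column-cong : ∀ {X Y : Input k n} → (∀ i x → X i x ≡ Y i x) → ∀ j → size (column X j) ≡ size (column Y j)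
    column-cong X≗Y j = size-cong (λ i → X≗Y i j)

  orbit₀ : Orbit {k} {n} (λ X → F0 X × Fs s X)
  orbit₀ = record
    { dec        = λ X → F0? X ×-dec Fs? s X
    ; respects   = λ X≗Y (X₀ , Xs) →
        (λ j → subst (ℕ._≤ 1) (column-cong X≗Y j) (X₀ j)) , Fs-respects X≗Y Xs
    ; invariant  = λ {X} σ (X₀ , Xs) → (λ j → X₀ (σ ⟨$⟩ʳ j)) , Fs-invariant {X} σ Xs
    ; transitive = λ X Y (X₀ , Xs) (Y₀ , Ys) → F0-transitive X Y X₀ Y₀ (λ i → trans (Xs i) (sym (Ys i)))
    }

  orbit₁ : Orbit {k} {n} (λ X → F1 X × Fs s X)
  orbit₁ = record
    { dec        = λ X → F1? X ×-dec Fs? s X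
    ; respects   = λ X≗Y ((x , X₁ , X₀) , Xs) →
        (x , trans (sym (column-cong X≗Y x)) X₁ , λ z z≢x → subst (ℕ._≤ 1) (column-cong X≗Y z) (X₀ z z≢x)) ,
        Fs-respects X≗Y Xs
    ; invariant  = λ {X} σ ((x , X₁ , X₀) , Xs) →
        ((σ ⟨$⟩ˡ x) , trans (cong (λ y → size (column X y)) (Perm.inverseʳ σ)) X₁ ,
         λ z z≢ → X₀ (σ ⟨$⟩ʳ z) (λ σz≡x → z≢ (trans (sym (Perm.inverseˡ σ)) (cong (σ ⟨$⟩ˡ_) σz≡x)))) ,
        Fs-invariant {X} σ Xs
    ; transitive = λ X Y (X₁ , Xs) (Y₁ , Ys) → F1-transitive X Y X₁ Y₁ (λ i → trans (Xs i) (sym (Ys i)))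
    }

-- Enumeration of the inputs

-- allFuns builds its functions with an extended lambda that cannot be named from here, so that
-- unification has to supply it.
emptyFun : (as : List A) → Σ (Fin 0 → A) λ f → allFuns as 0 ≡ f ∷ []
emptyFun as = _ , refl

consFun : (as : List A) (m : ℕ) → Σ (A → (Fin m → A) → Fin (suc m) → A) λ c →
          allFuns as (suc m) ≡ concatMap (λ a → map (c a) (allFuns as m)) as ×
          (∀ a f → c a f fzero ≡ a) × (∀ a f i → c a f (fsuc i) ≡ f i)
consFun as m = _ , refl , (λ _ _ → refl) , (λ _ _ _ → refl)

decode : (as : List A) → ∀ {m} → Vec A m → Fin m → A
decode as []              = proj₁ (emptyFun as)
decode as {suc m} (a ∷ v) = proj₁ (consFun as m) a (decode as v)

decode-lookup : ∀ (as : List A) {m} (v : Vec A m) i → decode as v i ≡ lookup v i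
decode-lookup as {suc m} (a ∷ v) fzero    = proj₁ (proj₂ (proj₂ (consFun as m))) a (decode as v)
decode-lookup as {suc m} (a ∷ v) (fsuc i) =
  trans (proj₂ (proj₂ (proj₂ (consFun as m))) a (decode as v) i) (decode-lookup as v i)

sumᴸ-allFuns : ∀ (as : List A) m h → sumᴸ (allFuns as m) h ≡ sumᴸ (vecs as m) (h ∘ decode as)
sumᴸ-allFuns as zero    h = cong (λ fs → sumᴸ fs h) (proj₂ (emptyFun as))
sumᴸ-allFuns as (suc m) h = begin
  sumᴸ (allFuns as (suc m)) h
    ≡⟨ cong (λ fs → sumᴸ fs h) (proj₁ (proj₂ (consFun as m))) ⟩
  sumᴸ (concatMap (λ a → map (cons a) (allFuns as m)) as) h
    ≡⟨ sumᴸ-concatMap (λ a → map (cons a) (allFuns as m)) as h ⟩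
  sumᴸ as (λ a → sumᴸ (map (cons a) (allFuns as m)) h)
    ≡⟨ sumᴸ-cong as (λ a → trans (sumᴸ-map (cons a) (allFuns as m) h) (sumᴸ-allFuns as m (h ∘ cons a))) ⟩
  sumᴸ as (λ a → sumᴸ (vecs as m) (λ v → h (decode as (a ∷ v))))
    ≡⟨ sym (sumᴸ-vecs as m (h ∘ decode as)) ⟩
  sumᴸ (vecs as (suc m)) (h ∘ decode as) ∎
  where
  open ≡-Reasoning
  cons = proj₁ (consFun as m)

sumᴸ-vecs-map : ∀ {xs : List A} {ys : List B} {f : B → A} → (∀ h → sumᴸ xs h ≡ sumᴸ ys (h ∘ f)) →
                ∀ m h → sumᴸ (vecs xs m) h ≡ sumᴸ (vecs ys m) (h ∘ Vec.map f)
sumᴸ-vecs-map eq zero    h = refl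
sumᴸ-vecs-map {xs = xs} {ys} {f} eq (suc m) h = begin
  sumᴸ (vecs xs (suc m)) h
    ≡⟨ sumᴸ-vecs xs m h ⟩
  sumᴸ xs (λ x → sumᴸ (vecs xs m) (h ∘ (x ∷_)))
    ≡⟨ eq (λ x → sumᴸ (vecs xs m) (h ∘ (x ∷_))) ⟩
  sumᴸ ys (λ y → sumᴸ (vecs xs m) (h ∘ (f y ∷_)))
    ≡⟨ sumᴸ-cong ys (λ y → sumᴸ-vecs-map eq m (h ∘ (f y ∷_))) ⟩
  sumᴸ ys (λ y → sumᴸ (vecs ys m) (λ v → h (f y ∷ Vec.map f v)))
    ≡⟨ sym (sumᴸ-vecs ys m (h ∘ Vec.map f)) ⟩
  sumᴸ (vecs ys (suc m)) (h ∘ Vec.map f) ∎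
  where open ≡-Reasoning

-- A player's predicate takes a function and might distinguish pointwise equal ones. Decoding
-- vectors into the very functions that occur in `allFuns` makes runs on decoded vectors agree with
-- runs on the enumerated inputs.
read : ∀ {n} → Vec Bool n → Fin n → Bool
read = decode bools

toInput : ∀ {k n} → Vec (Vec Bool n) k → Input k n
toInput {k} {n} V = decode (allFuns bools n) (Vec.map read V)

toInput-row : ∀ {k n} (V : Vec (Vec Bool n) k) i → toInput V i ≡ read (lookup V i)
toInput-row {k} {n} V i = trans (decode-lookup (allFuns bools n) (Vec.map read V) i) (Vecₚ.lookup-map i read V)

toInput≗asInput : ∀ {k n} (V : Vec (Vec Bool n) k) i x → toInput V i x ≡ asInput V i x
toInput≗asInput V i x = trans (cong (λ r → r x) (toInput-row V i)) (decode-lookup bools (lookup V i) x)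

sumᴸ-allInputs : ∀ k n h → sumᴸ (allInputs k n) h ≡ sumᴸ (inputs k n) (h ∘ toInput)
sumᴸ-allInputs k n h = trans (sumᴸ-allFuns (allFuns bools n) k h)
  (sumᴸ-vecs-map (sumᴸ-allFuns bools n) k (h ∘ decode (allFuns bools n)))

run-cong : ∀ {k n} (π : Protocol k n) {X Y} → (∀ i → X i ≡ Y i) → run π X ≡ run π Y
run-cong (leaf b)       X≡Y = refl
run-cong (node i f p q) X≡Y rewrite X≡Y i = cong₂ (if_then_else_ (f _)) (run-cong q X≡Y) (run-cong p X≡Y)

sumᴸ-filter : ∀ {P : A → Set} (P? : Decidable P) xs h →
              sumᴸ (filter P? xs) h ≡ sumᴸ xs (λ x → ⟦ does (P? x) ⟧ * h x)
sumᴸ-filter P? []       h = refl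
sumᴸ-filter P? (x ∷ xs) h with does (P? x)
... | true  = cong₂ _+_ (sym (*-identityˡ (h x))) (sumᴸ-filter P? xs h)
... | false = trans (sumᴸ-filter P? xs h) (trans (sym (+-identityˡ _)) (cong (_+ sumᴸ xs _) (sym (*-zeroˡ (h x)))))

ι-length : ∀ (xs : List A) → ι (length xs) ≡ sumᴸ xs (λ _ → 1ℚ)
ι-length []       = refl
ι-length (x ∷ xs) = cong (1ℚ +_) (ι-length xs)

ι-length-filter : ∀ {P : A → Set} (P? : Decidable P) xs → ι (length (filter P? xs)) ≡ sumᴸ xs (λ x → ⟦ does (P? x) ⟧)
ι-length-filter P? xs = trans (ι-length (filter P? xs))
  (trans (sumᴸ-filter P? xs (λ _ → 1ℚ)) (sumᴸ-cong xs (λ x → *-identityʳ ⟦ does (P? x) ⟧)))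

-- Fractions and output frequencies.

ι≡/1 : ∀ m → ι m ≡ ℤ.+ m / 1
ι≡/1 zero    = refl
ι≡/1 (suc m) = trans (cong (1ℚ +_) (ι≡/1 m)) (toℚᵘ-injective (begin
  toℚᵘ (1ℚ + ℤ.+ m / 1)                     ≈⟨ toℚᵘ-homo-+ 1ℚ (ℤ.+ m / 1) ⟩
  toℚᵘ 1ℚ ℚᵘ.+ toℚᵘ (ℤ.+ m / 1)             ≈⟨ ℚᵘₚ.+-congʳ (toℚᵘ 1ℚ) (toℚᵘ-fromℚᵘ (ℚᵘ.mkℚᵘ (ℤ.+ m) 0)) ⟩
  toℚᵘ 1ℚ ℚᵘ.+ ℚᵘ.mkℚᵘ (ℤ.+ m) 0            ≈⟨ ℚᵘ.*≡* (cong (ℤ._* ℤ.+ 1) (cong (ℤ._+_ (ℤ.+ 1)) (ℤₚ.*-identityʳ (ℤ.+ m)))) ⟩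
  ℚᵘ.mkℚᵘ (ℤ.+ suc m) 0                     ≈⟨ ℚᵘₚ.≃-sym (toℚᵘ-fromℚᵘ (ℚᵘ.mkℚᵘ (ℤ.+ suc m) 0)) ⟩
  toℚᵘ (ℤ.+ suc m / 1)                      ∎))
  where open ℚᵘₚ.≃-Reasoning

frac-* : ∀ a d → frac a (suc d) * ι (suc d) ≡ ι a
frac-* a d = trans (cong (frac a (suc d) *_) (ι≡/1 (suc d))) (trans (toℚᵘ-injective (begin
  toℚᵘ (ℤ.+ a / suc d * (ℤ.+ suc d / 1))
    ≈⟨ toℚᵘ-homo-* (ℤ.+ a / suc d) (ℤ.+ suc d / 1) ⟩
  toℚᵘ (ℤ.+ a / suc d) ℚᵘ.* toℚᵘ (ℤ.+ suc d / 1)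
    ≈⟨ ℚᵘₚ.*-cong (toℚᵘ-fromℚᵘ (ℚᵘ.mkℚᵘ (ℤ.+ a) d)) (toℚᵘ-fromℚᵘ (ℚᵘ.mkℚᵘ (ℤ.+ suc d) 0)) ⟩
  ℚᵘ.mkℚᵘ (ℤ.+ a) d ℚᵘ.* ℚᵘ.mkℚᵘ (ℤ.+ suc d) 0
    ≈⟨ ℚᵘ.*≡* (trans (ℤₚ.*-identityʳ (ℤ.+ a ℤ.* ℤ.+ suc d))
                     (cong (λ e → ℤ.+ a ℤ.* ℤ.+ suc e) (sym (ℕₚ.*-identityʳ d)))) ⟩
  ℚᵘ.mkℚᵘ (ℤ.+ a) 0
    ≈⟨ ℚᵘₚ.≃-sym (toℚᵘ-fromℚᵘ (ℚᵘ.mkℚᵘ (ℤ.+ a) 0)) ⟩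
  toℚᵘ (ℤ.+ a / 1) ∎)) (sym (ι≡/1 a)))
  where open ℚᵘₚ.≃-Reasoning

frac-unique : ∀ {x} a d → 1ℚ ≤ ι d → x * ι d ≡ ι a → frac a d ≡ x
frac-unique a zero    1≤0 _ = contradiction refl (1≤⇒≢0 1≤0)
frac-unique {x} a (suc d) _ eq = trans (divide (frac a (suc d)) (frac-* a d)) (sym (divide x eq))
  where
  divide : ∀ y → y * ι (suc d) ≡ ι a → y ≡ ι a * inv (ι (suc d))
  divide y eq = trans (sym (*-identityʳ y)) (trans (cong (y *_) (sym (*-inv d≢0)))
    (trans (sym (*-assoc y (ι (suc d)) (inv (ι (suc d))))) (cong (_* inv (ι (suc d))) eq)))
    where
    d≢0 : ¬ ι (suc d) ≡ 0ℚ
    d≢0 = 1≤⇒≢0 (+-mono-≤ {1ℚ} {1ℚ} ≤-refl (ι-mono {0} {d} z≤n))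

module _ {k n} {Q : Input k n → Set} (orbit : Orbit Q) (π : Protocol k n) (b : Bool) where

  private
    support′ : List (Input k n)
    support′ = filter (Orbit.dec orbit) (allInputs k n)

    dec≡member : ∀ V → ⟦ does (Orbit.dec orbit (toInput V)) ⟧ ≡ member orbit V
    dec≡member V = cong ⟦_⟧ (does-⇔ (mk⇔ (Orbit.respects orbit (toInput≗asInput V))
                                          (Orbit.respects orbit (λ i x → sym (toInput≗asInput V i x))))
                                     (Orbit.dec orbit (toInput V)) (Orbit.dec orbit (asInput V)))

    outputs-b : (Fin k → Vec Bool n) → ℚ
    outputs-b x = ⟦ does (run π (read ∘ x) 𝔹.≟ b) ⟧

    ι-support : ι (length support′) ≡ sumᴸ (inputs k n) (member orbit)
    ι-support = trans (ι-length-filter (Orbit.dec orbit) (allInputs k n))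
      (trans (sumᴸ-allInputs k n _) (sumᴸ-cong (inputs k n) dec≡member))

    ι-outputs : ι (length (filter (λ X → run π X 𝔹.≟ b) support′)) ≡
                sumᴸ (inputs k n) (λ V → member orbit V * outputs-b (lookup V))
    ι-outputs = trans (ι-length-filter (λ X → run π X 𝔹.≟ b) support′)
      (trans (sumᴸ-filter (Orbit.dec orbit) (allInputs k n) _) (trans (sumᴸ-allInputs k n _)
        (sumᴸ-cong (inputs k n) λ V → cong₂ _*_ (dec≡member V)
          (cong (λ o → ⟦ does (o 𝔹.≟ b) ⟧) (run-cong π (toInput-row V))))))

  -- This is `orbit-average` divided by the size of the orbit: it turns the fractions in `errorD`
  -- into probabilities over a random placement of any single member `Y`.
  output-frequency : ∀ Y → Q Y →
    frac (length (filter (λ X → run π X 𝔹.≟ b) support′)) (length support′) ≡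
    𝔼 (𝔅 n) (λ v → ⟦ does (run π (read ∘ place Y v) 𝔹.≟ b) ⟧)
  output-frequency Y QY = frac-unique _ (length support′)
    (subst (1ℚ ≤_) (sym ι-support) (1≤members orbit Y QY))
    (trans (cong (𝔼 (𝔅 n) (λ v → outputs-b (place Y v)) *_) ι-support)
      (trans (orbit-average orbit Y QY outputs-b
               (λ x≡y → cong (λ o → ⟦ does (o 𝔹.≟ b) ⟧) (run-cong π (λ i → cong read (x≡y i)))))
             (sym ι-outputs)))

-- The two worlds

owner : ∀ {k} (s : Fin k → ℕ) → Fin (sumℕ s) → Fin k
owner {suc k} s p = [ (λ _ → fzero) , (λ q → fsuc (owner (s ∘ fsuc) q)) ]′ (splitAt (s fzero) p)

size-++ : ∀ a {b} (f : Fin (a ℕ.+ b) → Bool) → size f ≡ size (f ∘ (_↑ˡ b)) ℕ.+ size (f ∘ (a ↑ʳ_))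
size-++ zero    f = refl
size-++ (suc a) f = trans (cong ((if f fzero then 1 else 0) ℕ.+_) (size-++ a (f ∘ fsuc)))
                          (sym (ℕₚ.+-assoc (if f fzero then 1 else 0) _ _))

size-owner : ∀ {k} (s : Fin k → ℕ) i → size (λ p → does (owner s p Finₚ.≟ i)) ≡ s i
size-owner {suc k} s i = trans (size-++ (s fzero) _) (trans (cong₂ ℕ._+_
    (size-cong λ p → cong (owned-by i) (Finₚ.splitAt-↑ˡ (s fzero) p (sumℕ (s ∘ fsuc))))
    (size-cong λ p → cong (owned-by i) (Finₚ.splitAt-↑ʳ (s fzero) (sumℕ (s ∘ fsuc)) p))) (by-cases i))
  where
  owned-by : Fin (suc k) → Fin (s fzero) ⊎ Fin (sumℕ (s ∘ fsuc)) → Bool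
  owned-by i y = does ([ (λ _ → fzero) , (λ q → fsuc (owner (s ∘ fsuc) q)) ]′ y Finₚ.≟ i)
  by-cases : ∀ i → size (owned-by i ∘ inj₁) ℕ.+ size (owned-by i ∘ inj₂) ≡ s i
  by-cases fzero    = trans (cong₂ ℕ._+_ (size-all {s fzero} (λ _ → refl)) (size-none {sumℕ (s ∘ fsuc)} (λ _ → refl)))
                            (ℕₚ.+-identityʳ (s fzero))
  by-cases (fsuc i) = trans (cong (ℕ._+ size (owned-by (fsuc i) ∘ inj₂)) (size-none {s fzero} (λ _ → refl)))
                            (size-owner (s ∘ fsuc) i)

data TransposeView {n} (i j x y : Fin n) : Set where
  first  : x ≡ i → y ≡ j → TransposeView i j x y
  second : x ≡ j → y ≡ i → TransposeView i j x y
  other  : x ≢ i → x ≢ j → y ≡ x → TransposeView i j x y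

transposeView : ∀ {n} (i j x : Fin n) → TransposeView i j x (PC.transpose i j x)
transposeView i j x with x Finₚ.≟ i
... | yes x≡i = first x≡i refl
... | no  x≢i with x Finₚ.≟ j
...   | yes x≡j = second x≡j refl
...   | no  x≢j = other x≢i x≢j refl

module Worlds {k : ℕ} (s : Fin (suc k) → ℕ) (1≤s : ∀ i → 1 ℕ.≤ s i) (r : ℕ) where

  -- Two slots for each of the `S` pairs and `r` spare points make up `n` by definition, so that
  -- slots are read off by splitting indices.
  S n : ℕ
  S = sumℕ s
  n = S ℕ.+ (S ℕ.+ r)

  own : Fin S → Fin (suc k)
  own = owner s

  designated : ∀ i → ∃ λ p → does (own p Finₚ.≟ i) ≡ true
  designated i = 1≤size⇒∃ (λ p → does (own p Finₚ.≟ i)) (subst (1 ℕ.≤_) (sym (size-owner s i)) (1≤s i))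

  d : Fin (suc k) → Fin S
  d i = proj₁ (designated i)

  own-d≟ : ∀ i → does (own (d i) Finₚ.≟ i) ≡ true
  own-d≟ i = proj₂ (designated i)

  does-true : ∀ {p i} → does (own p Finₚ.≟ i) ≡ true → own p ≡ i
  does-true {p} {i} eq with own p Finₚ.≟ i
  ... | yes own≡ = own≡

  own-d : ∀ i → own (d i) ≡ i
  own-d i = does-true (own-d≟ i)

  -- Every pair p has a false slot, a true slot, and r points lie outside all pairs.
  Slot : Set
  Slot = Fin S ⊎ (Fin S ⊎ Fin r)

  slot : Fin n → Slot
  slot x = Sum.map₂ (splitAt S) (splitAt S x)

  point : Slot → Fin n
  point y = join S (S ℕ.+ r) (Sum.map₂ (join S r) y)

  slot-point : ∀ y → slot (point y) ≡ y
  slot-point y = trans (cong (Sum.map₂ (splitAt S)) (Finₚ.splitAt-join S (S ℕ.+ r) (Sum.map₂ (join S r) y))) (inner y)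
    where
    inner : ∀ y → Sum.map₂ (splitAt S) (Sum.map₂ (join S r) y) ≡ y
    inner (inj₁ p) = refl
    inner (inj₂ y) = cong inj₂ (Finₚ.splitAt-join S r y)

  point-slot : ∀ x → point (slot x) ≡ x
  point-slot x = trans (cong (join S (S ℕ.+ r)) (inner (splitAt S x))) (Finₚ.join-splitAt S (S ℕ.+ r) x)
    where
    inner : ∀ y → Sum.map₂ (join S r) (Sum.map₂ (splitAt S) y) ≡ y
    inner (inj₁ p) = refl
    inner (inj₂ y) = cong inj₂ (Finₚ.join-splitAt S r y)

  module _ (π₀ π₁ : Permutation′ S) where

    permute-slots : Slot → Slot
    permute-slots (inj₁ p)        = inj₁ (π₀ ⟨$⟩ʳ p)
    permute-slots (inj₂ (inj₁ p)) = inj₂ (inj₁ (π₁ ⟨$⟩ʳ p))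
    permute-slots (inj₂ (inj₂ z)) = inj₂ (inj₂ z)

  permute-slots-cancel : ∀ {π₀ π₁ ρ₀ ρ₁ : Permutation′ S} →
    (∀ p → π₀ ⟨$⟩ʳ (ρ₀ ⟨$⟩ʳ p) ≡ p) → (∀ p → π₁ ⟨$⟩ʳ (ρ₁ ⟨$⟩ʳ p) ≡ p) →
    ∀ y → permute-slots π₀ π₁ (permute-slots ρ₀ ρ₁ y) ≡ y
  permute-slots-cancel eq₀ eq₁ (inj₁ p)        = cong inj₁ (eq₀ p)
  permute-slots-cancel eq₀ eq₁ (inj₂ (inj₁ p)) = cong (inj₂ ∘ inj₁) (eq₁ p)
  permute-slots-cancel eq₀ eq₁ (inj₂ (inj₂ z)) = refl

  conjugate : ∀ (f g : Slot → Slot) → (∀ y → f (g y) ≡ y) → ∀ x → point (f (slot (point (g (slot x))))) ≡ x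
  conjugate f g fg x = trans (cong (point ∘ f) (slot-point (g (slot x))))
                                 (trans (cong point (fg (slot x))) (point-slot x))

  -- False and true slots are permuted separately: `τ` moves true slots only, whereas `exchange`
  -- moves whole pairs.
  move : Permutation′ S → Permutation′ S → Permutation′ n
  move π₀ π₁ = Perm.permutation
    (point ∘ permute-slots π₀ π₁ ∘ slot) (point ∘ permute-slots (Perm.flip π₀) (Perm.flip π₁) ∘ slot)
    (conjugate (permute-slots π₀ π₁) (permute-slots (Perm.flip π₀) (Perm.flip π₁))
      (permute-slots-cancel {π₀} {π₁} {Perm.flip π₀} {Perm.flip π₁} (λ _ → Perm.inverseʳ π₀) (λ _ → Perm.inverseʳ π₁)))
    (conjugate (permute-slots (Perm.flip π₀) (Perm.flip π₁)) (permute-slots π₀ π₁)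
      (permute-slots-cancel {Perm.flip π₀} {Perm.flip π₁} {π₀} {π₁} (λ _ → Perm.inverseˡ π₀) (λ _ → Perm.inverseˡ π₁)))

  slot-move : ∀ π₀ π₁ x → slot (move π₀ π₁ ⟨$⟩ʳ x) ≡ permute-slots π₀ π₁ (slot x)
  slot-move π₀ π₁ x = slot-point (permute-slots π₀ π₁ (slot x))

  -- Every player carries coins for all `S` pairs but reads only those of his own; this gives all
  -- players the same probability space.
  chosen : Fin (suc k) → Bits S → Slot → Bool
  chosen i β (inj₁ p)        = does (own p Finₚ.≟ i) ∧ not (lookup β p)
  chosen i β (inj₂ (inj₁ p)) = does (own p Finₚ.≟ i) ∧ lookup β p
  chosen i β (inj₂ (inj₂ z)) = false

  plain : Fin (suc k) → Bits S → Fin n → Bool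
  plain i β x = chosen i β (slot x)

  size-plain : ∀ i β → size (plain i β) ≡ s i
  size-plain i β = begin
    size (plain i β)
      ≡⟨ size-++ S (plain i β) ⟩
    size (λ (p : Fin S) → plain i β (p ↑ˡ (S ℕ.+ r))) ℕ.+ size (plain i β ∘ (S ↑ʳ_))
      ≡⟨ cong₂ ℕ._+_
           (size-cong {S} λ p → cong (chosen i β) (cong (Sum.map₂ (splitAt S)) (Finₚ.splitAt-↑ˡ S p (S ℕ.+ r))))
           (trans (size-cong {S ℕ.+ r} λ y → cong (chosen i β) (cong (Sum.map₂ (splitAt S)) (Finₚ.splitAt-↑ʳ S (S ℕ.+ r) y)))
                  (size-++ S (λ y → chosen i β (inj₂ (splitAt S y))))) ⟩
    size no-slot ℕ.+ (size (λ p → chosen i β (inj₂ (splitAt S (p ↑ˡ r)))) ℕ.+ size (λ z → chosen i β (inj₂ (splitAt S (S ↑ʳ z)))))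
      ≡⟨ cong (size no-slot ℕ.+_) (cong₂ ℕ._+_
           (size-cong {S} λ p → cong (chosen i β ∘ inj₂) (Finₚ.splitAt-↑ˡ S p r))
           (size-none {r} λ z → cong (chosen i β ∘ inj₂) (Finₚ.splitAt-↑ʳ S r z))) ⟩
    size no-slot ℕ.+ (size yes-slot ℕ.+ 0)
      ≡⟨ cong (size no-slot ℕ.+_) (ℕₚ.+-identityʳ (size yes-slot)) ⟩
    size no-slot ℕ.+ size yes-slot
      ≡⟨ size-∧-not (λ p → does (own p Finₚ.≟ i)) (lookup β) ⟩
    size (λ p → does (own p Finₚ.≟ i))
      ≡⟨ size-owner s i ⟩
    s i ∎
    where
    open ≡-Reasoning
    no-slot yes-slot : Fin S → Bool
    no-slot p = chosen i β (inj₁ p)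
    yes-slot p = chosen i β (inj₂ (inj₁ p))
    size-∧-not : ∀ {m} (f g : Fin m → Bool) → size (λ p → f p ∧ not (g p)) ℕ.+ size (λ p → f p ∧ g p) ≡ size f
    size-∧-not {zero}  f g = refl
    size-∧-not {suc m} f g = trans
      (interchange ℕₚ.+-commutativeSemigroup (if f fzero ∧ not (g fzero) then 1 else 0) (size (λ p → f (fsuc p) ∧ not (g (fsuc p))))
                     (if f fzero ∧ g fzero then 1 else 0) (size (λ p → f (fsuc p) ∧ g (fsuc p))))
      (cong₂ ℕ._+_ (bit (f fzero) (g fzero)) (size-∧-not (f ∘ fsuc) (g ∘ fsuc)))
      where
      bit : ∀ a b → (if a ∧ not b then 1 else 0) ℕ.+ (if a ∧ b then 1 else 0) ≡ (if a then 1 else 0)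
      bit true  true  = refl
      bit true  false = refl
      bit false b     = refl

  Owns : Fin (suc k) → Slot → Set
  Owns i (inj₁ p)        = own p ≡ i
  Owns i (inj₂ (inj₁ p)) = own p ≡ i
  Owns i (inj₂ (inj₂ z)) = ⊥

  Owns-unique : ∀ {i j} y → Owns i y → Owns j y → i ≡ j
  Owns-unique (inj₁ p)        refl refl = refl
  Owns-unique (inj₂ (inj₁ p)) refl refl = refl

  ∧-true : ∀ {a b} → a ∧ b ≡ true → a ≡ true
  ∧-true {true} _ = refl

  chosen⇒Owns : ∀ i β y → chosen i β y ≡ true → Owns i y
  chosen⇒Owns i β (inj₁ p)        eq = does-true (∧-true eq)
  chosen⇒Owns i β (inj₂ (inj₁ p)) eq = does-true (∧-true eq)

  -- The true slot of d 0 serves as the common point of all players: τ i exchanges it with the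
  -- true slot of d i.
  τ : Fin (suc k) → Permutation′ n
  τ i = move Perm.id (Perm.transpose (d i) (d fzero))

  base : Bool → Fin (suc k) → Bits S → Fin n → Bool
  base b i β = plain i (β [ d i ]≔ᵛ b) ∘ (τ i ⟨$⟩ʳ_)

  plain₀ : Fin (suc k) → Bits S → Fin n → Bool
  plain₀ i β = plain i (β [ d i ]≔ᵛ false)

  not-designated : ∀ i j β → does (own (d j) Finₚ.≟ i) ∧ lookup (β [ d i ]≔ᵛ false) (d j) ≡ false
  not-designated i j β with own (d j) Finₚ.≟ i
  ... | no _      = refl
  ... | yes own≡i with refl ← trans (sym own≡i) (own-d j) = Vecₚ.lookup∘update (d j) β false

  -- With his designated coin false, a player occupies none of the true slots of designated pairs,
  -- so he does not notice when two of these are exchanged.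
  plain₀-τ : ∀ i j β x → plain₀ i β (τ j ⟨$⟩ʳ x) ≡ plain₀ i β x
  plain₀-τ i j β x = trans (cong (chosen i γ) (slot-move Perm.id _ x)) (fixed (slot x))
    where
    γ : Bits S
    γ = β [ d i ]≔ᵛ false
    fixed : ∀ y → chosen i γ (permute-slots Perm.id (Perm.transpose (d j) (d fzero)) y) ≡ chosen i γ y
    fixed (inj₁ p)        = refl
    fixed (inj₂ (inj₂ z)) = refl
    fixed (inj₂ (inj₁ p)) with PC.transpose (d j) (d fzero) p | transposeView (d j) (d fzero) p
    ... | _ | first refl refl  = trans (not-designated i fzero β) (sym (not-designated i j β))
    ... | _ | second refl refl = trans (not-designated i j β) (sym (not-designated i fzero β))
    ... | _ | other _ _ refl   = refl

  Fs-base : ∀ b (β : Fin (suc k) → Bits S) → Fs s (λ i → base b i (β i))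
  Fs-base b β i = trans (size-permute (plain i (β i [ d i ]≔ᵛ b)) (τ i)) (size-plain i (β i [ d i ]≔ᵛ b))

  F0-base : ∀ (β : Fin (suc k) → Bits S) → F0 (λ i → base false i (β i))
  F0-base β x = unique⇒size≤1 _ λ i j xi xj → Owns-unique (slot x) (owns i xi) (owns j xj)
    where
    owns : ∀ i → base false i (β i) x ≡ true → Owns i (slot x)
    owns i xi = chosen⇒Owns i (β i [ d i ]≔ᵛ false) (slot x) (trans (sym (plain₀-τ i i (β i) x)) xi)

  -- Away from `x*` each point is still reserved for at most one player: the only other point that
  -- `τ i` can move is the true slot of `d i`, which `i` owns himself.
  F1-base : ∀ (β : Fin (suc k) → Bits S) → F1 (λ i → base true i (β i))
  F1-base β = x* , size-all everyone , λ x x≢x* →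
    unique⇒size≤1 _ λ i j xi xj → Owns-unique (slot x) (owns x x≢x* i xi) (owns x x≢x* j xj)
    where
    x* : Fin n
    x* = point (inj₂ (inj₁ (d fzero)))

    everyone : ∀ i → base true i (β i) x* ≡ true
    everyone i = trans (cong (chosen i γ) (trans (slot-move Perm.id _ x*)
        (cong (permute-slots Perm.id (Perm.transpose (d i) (d fzero))) (slot-point (inj₂ (inj₁ (d fzero)))))))
      (trans (cong (λ p → chosen i γ (inj₂ (inj₁ p))) (at-d₀ (transposeView (d i) (d fzero) (d fzero))))
             (cong₂ _∧_ (own-d≟ i) (Vecₚ.lookup∘update (d i) (β i) true)))
      where
      γ : Bits S
      γ = β i [ d i ]≔ᵛ true
      at-d₀ : ∀ {y} → TransposeView (d i) (d fzero) (d fzero) y → y ≡ d i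
      at-d₀ (first d₀≡di y≡d₀) = trans y≡d₀ d₀≡di
      at-d₀ (second _ y≡di)    = y≡di
      at-d₀ (other _ d₀≢d₀ _)  = contradiction refl d₀≢d₀

    owns : ∀ x → x ≢ x* → ∀ i → base true i (β i) x ≡ true → Owns i (slot x)
    owns x x≢x* i xi = from-slot (slot x) (λ eq → x≢x* (trans (sym (point-slot x)) (cong point eq)))
      (chosen⇒Owns i γ _ (trans (cong (chosen i γ) (sym (slot-move Perm.id _ x))) xi))
      where
      γ : Bits S
      γ = β i [ d i ]≔ᵛ true
      from-slot : ∀ y → y ≢ inj₂ (inj₁ (d fzero)) →
                  Owns i (permute-slots Perm.id (Perm.transpose (d i) (d fzero)) y) → Owns i y
      from-slot (inj₁ p)        _ o = o
      from-slot (inj₂ (inj₁ p)) y≢ o with PC.transpose (d i) (d fzero) p | transposeView (d i) (d fzero) p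
      ... | _ | first refl _    = own-d i
      ... | _ | second refl _   = contradiction refl y≢
      ... | _ | other _ _ refl  = o

  exchange : Fin S → Fin S → Permutation′ n
  exchange p q = move (Perm.transpose p q) (Perm.transpose p q)

  permute-bits : Permutation′ S → Bits S → Bits S
  permute-bits π β = tabulate (lookup β ∘ (π ⟨$⟩ʳ_))

  chosen-cong : ∀ {i p q} β γ → own p ≡ own q → lookup β p ≡ lookup γ q → ∀ (f : Bool → Bool) →
                does (own p Finₚ.≟ i) ∧ f (lookup β p) ≡ does (own q Finₚ.≟ i) ∧ f (lookup γ q)
  chosen-cong {i} β γ own≡ β≡γ f = cong₂ (λ o b → does (o Finₚ.≟ i) ∧ f b) own≡ β≡γ

  own-transpose : ∀ {p q} → own p ≡ own q → ∀ x → own (PC.transpose p q x) ≡ own x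
  own-transpose {p} {q} own≡ x with PC.transpose p q x | transposeView p q x
  ... | _ | first refl refl  = sym own≡
  ... | _ | second refl refl = own≡
  ... | _ | other _ _ refl   = refl

  -- Swapping two pairs of one owner amounts to permuting his coins, which leaves uniform coins
  -- uniform.
  plain-exchange : ∀ {p q} → own p ≡ own q → ∀ i β x →
    plain i β (exchange p q ⟨$⟩ʳ x) ≡ plain i (permute-bits (Perm.transpose p q) β) x
  plain-exchange {p} {q} own≡ i β x = trans (cong (chosen i β) (slot-move _ _ x)) (by-slot (slot x))
    where
    π : Permutation′ S
    π = Perm.transpose p q
    by-slot : ∀ y → chosen i β (permute-slots π π y) ≡ chosen i (permute-bits π β) y
    by-slot (inj₁ t)        = chosen-cong β (permute-bits π β) (own-transpose own≡ t) (sym (Vecₚ.lookup∘tabulate _ t)) not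
    by-slot (inj₂ (inj₁ t)) = chosen-cong β (permute-bits π β) (own-transpose own≡ t) (sym (Vecₚ.lookup∘tabulate _ t)) (λ b → b)
    by-slot (inj₂ (inj₂ z)) = refl

  plain-exchange-other : ∀ {p q} i → own p ≢ i → own q ≢ i → ∀ β x →
    plain i β (exchange p q ⟨$⟩ʳ x) ≡ plain i β x
  plain-exchange-other {p} {q} i p≢i q≢i β x = trans (cong (chosen i β) (slot-move _ _ x)) (by-slot (slot x))
    where
    none : ∀ {t} → own t ≢ i → ∀ b → does (own t Finₚ.≟ i) ∧ b ≡ false
    none {t} t≢i b with own t Finₚ.≟ i
    ... | yes t≡i = contradiction t≡i t≢i
    ... | no _    = refl
    by-pair : ∀ (f : Bool → Bool) t → let t′ = PC.transpose p q t in
      does (own t′ Finₚ.≟ i) ∧ f (lookup β t′) ≡ does (own t Finₚ.≟ i) ∧ f (lookup β t)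
    by-pair f t with PC.transpose p q t | transposeView p q t
    ... | _ | first refl refl  = trans (none q≢i _) (sym (none p≢i _))
    ... | _ | second refl refl = trans (none p≢i _) (sym (none q≢i _))
    ... | _ | other _ _ refl   = refl
    by-slot : ∀ y → chosen i β (permute-slots (Perm.transpose p q) (Perm.transpose p q) y) ≡ chosen i β y
    by-slot (inj₁ t)        = by-pair not t
    by-slot (inj₂ (inj₁ t)) = by-pair (λ b → b) t
    by-slot (inj₂ (inj₂ z)) = refl

-- The communication bound

module Bound {k : ℕ} (s : Fin (suc k) → ℕ) (1≤s : ∀ i → 1 ℕ.≤ s i) (r : ℕ) where
  open Worlds s 1≤s r
  open Tree (read {n})

  K : ℕ
  K = suc k

  Family : Set
  Family = Bits S → Fin n → Bool

  Placement : Set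
  Placement = Vec (Fin n) n

  prob : Family → Placement → Event → ℚ
  prob g v P = density (λ β → P (tabulate (g β ∘ lookup v)))

  prob-cong : ∀ {g h : Family} → (∀ β x → g β x ≡ h β x) → ∀ v P → prob g v P ≡ prob h v P
  prob-cong g≗h v P = 𝔼-cong (bits S) λ β → cong (⟦_⟧ ∘ P) (Vecₚ.tabulate-cong λ x → g≗h β (lookup v x))

  prob-translate : ∀ (g : Family) (σ : Permutation′ n) v P →
                   prob g (Vec.map (σ ⟨$⟩ʳ_) v) P ≡ prob (λ β → g β ∘ (σ ⟨$⟩ʳ_)) v P
  prob-translate g σ v P = 𝔼-cong (bits S) λ β → cong (⟦_⟧ ∘ P)
    (Vecₚ.tabulate-cong λ x → cong (g β) (Vecₚ.lookup-map x (σ ⟨$⟩ʳ_) v))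

  prob-additive : ∀ g v → Additive {K} (prob g v)
  prob-additive g v P Q = trans (sym (𝔼-+ (bits S) _ _))
    (𝔼-cong (bits S) λ β → split (P (tabulate (g β ∘ lookup v))) (Q (tabulate (g β ∘ lookup v))))
    where
    split : ∀ a b → ⟦ a ∧ not b ⟧ + ⟦ a ∧ b ⟧ ≡ ⟦ a ⟧
    split true  true  = refl
    split true  false = refl
    split false b     = refl

  0≤prob : ∀ g v P → 0ℚ ≤ prob g v P
  0≤prob g v P = 0≤density (λ β → P (tabulate (g β ∘ lookup v)))

  prob-total : ∀ g v → prob g v (λ _ → true) ≡ 1ℚ
  prob-total g v = 𝔼-const (bits S) 1ℚ

  measure : (Fin K → Family) → Placement → Measures {K}
  measure B v i = prob (B i) v

  sample : (Fin K → Family) → Placement → Vec (Bits S) K → Fin K → Vec Bool n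
  sample B v ω = place (λ i → B i (lookup ω i)) v

  coins : Dist (Vec (Bits S) K)
  coins = bits S ^ᴰ K

  measure-sampled : ∀ B v R → volume (measure B v) R ≡ 𝔼 coins (λ ω → inside R (sample B v ω))
  measure-sampled B v R = sym (𝔼-∏ (bits S) (λ i β → ⟦ R i (tabulate (B i β ∘ lookup v)) ⟧))

  discrepancy : (Bool → Family) → Placement → Event → ℚ
  discrepancy C v P = tri (prob (C false) v P) (prob (C true) v P)

  module _ (π : Protocol K n) where

    leafTotal : (Rect K → ℚ) → ℚ
    leafTotal X = leafSum π everything (λ _ → X)

    -- One player's squared-bias term, summed over the leaves: `B` describes the other players, and
    -- factor `i` is overwritten by the comparison of the two alternatives in `C`.
    Ψ : (Fin K → Family) → (Bool → Family) → Fin K → Placement → ℚ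
    Ψ B C i v = leafTotal (volume (measure B v [ i ≔ discrepancy C v ]))

    Ψ-cong : ∀ B B′ C C′ i v v′ → (∀ j → j ≢ i → ∀ P → prob (B j) v P ≡ prob (B′ j) v′ P) →
             (∀ b P → prob (C b) v P ≡ prob (C′ b) v′ P) → Ψ B C i v ≡ Ψ B′ C′ i v′
    Ψ-cong B B′ C C′ i v v′ B≡ C≡ = leafSum-cong π everything λ _ R → ∏-cong λ j → agree R j
      where
      agree : ∀ R j → (measure B v [ i ≔ discrepancy C v ]) j (R j) ≡ (measure B′ v′ [ i ≔ discrepancy C′ v′ ]) j (R j)
      agree R j with j Finₚ.≟ i
      ... | yes refl = trans (cong (λ θ → θ (R i)) (updateAt-updates i (measure B v)))
              (trans (cong₂ tri (C≡ false (R i)) (C≡ true (R i)))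
                     (sym (cong (λ θ → θ (R i)) (updateAt-updates i (measure B′ v′)))))
      ... | no j≢i   = trans (cong (λ θ → θ (R j)) (updateAt-minimal j i (measure B v) j≢i))
              (trans (B≡ j j≢i (R j)) (sym (cong (λ θ → θ (R j)) (updateAt-minimal j i (measure B′ v′) j≢i))))

    0≤Ψ : ∀ B C i v → 0ℚ ≤ Ψ B C i v
    0≤Ψ B C i v = subst (_≤ Ψ B C i v) (leafSum-0 π everything) (leafSum-mono π everything λ _ R → 0≤∏ (nonneg R))
      where
      nonneg : ∀ R j → 0ℚ ≤ (measure B v [ i ≔ discrepancy C v ]) j (R j)
      nonneg R j with j Finₚ.≟ i
      ... | yes refl = subst (λ θ → 0ℚ ≤ θ (R i)) (sym (updateAt-updates i (measure B v)))
                             (0≤tri (0≤prob (C false) v (R i)) (0≤prob (C true) v (R i)))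
      ... | no j≢i   = subst (λ θ → 0ℚ ≤ θ (R j)) (sym (updateAt-minimal j i (measure B v) j≢i)) (0≤prob (B j) v (R j))

    fixing : Fin K → Fin S → Bool → Family
    fixing i p b β = plain i (β [ p ]≔ᵛ b)

    ε : Fin K → ℚ
    ε i = 𝔼 (𝔅 n) (Ψ (base false) (λ b → base b i) i)

    permute-update : ∀ q p (β : Bits S) b → permute-bits (Perm.transpose q p) (β [ q ]≔ᵛ b) ≡
                                             permute-bits (Perm.transpose q p) β [ p ]≔ᵛ b
    permute-update q p β b = trans (Vecₚ.tabulate-cong pointwise) (Vecₚ.tabulate∘lookup _)
      where
      β′ : Bits S
      β′ = permute-bits (Perm.transpose q p) β
      at : ∀ x → lookup β′ x ≡ lookup β (PC.transpose q p x)
      at x = Vecₚ.lookup∘tabulate _ x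
      pointwise : ∀ x → lookup (β [ q ]≔ᵛ b) (PC.transpose q p x) ≡ lookup (β′ [ p ]≔ᵛ b) x
      pointwise x with x Finₚ.≟ p
      ... | yes refl = trans (cong (lookup (β [ q ]≔ᵛ b)) (to-q (transposeView q x x)))
                             (trans (Vecₚ.lookup∘update q β b) (sym (Vecₚ.lookup∘update x β′ b)))
        where
        to-q : ∀ {y} → TransposeView q x x y → y ≡ q
        to-q (first x≡q y≡x)  = trans y≡x x≡q
        to-q (second _ y≡q)   = y≡q
        to-q (other _ x≢x _)  = contradiction refl x≢x
      ... | no x≢p = trans (Vecₚ.lookup∘update′ (not-q (transposeView q p x)) β b)
                           (trans (sym (at x)) (sym (Vecₚ.lookup∘update′ x≢p β′ b)))
        where
        not-q : ∀ {y} → TransposeView q p x y → y ≢ q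
        not-q (first x≡q y≡p) y≡q = x≢p (trans x≡q (trans (sym y≡q) y≡p))
        not-q (second x≡p _)  _   = x≢p x≡p
        not-q (other x≢q _ y≡x) y≡q = x≢q (trans (sym y≡x) y≡q)

    -- The common point sits at a uniformly random pair of player i: exchanging d i with another pair
    -- of i is a symmetry of the random placement.
    ε-symmetric : ∀ i p → own p ≡ i → ε i ≡ 𝔼 (𝔅 n) (Ψ plain₀ (fixing i p) i)
    ε-symmetric i p own≡i = begin
      𝔼 (𝔅 n) (Ψ (base false) (λ b → base b i) i)
        -- Moving `τ i` into the placement of all players turns the common point into the true slot
        -- of `d i`; for the other players nothing changes, by `plain₀-τ`.
        ≡⟨ 𝔼-cong (𝔅 n) (λ v → Ψ-cong (base false) plain₀ (λ b → base b i) (fixing i (d i)) i v (Vec.map (τ i ⟨$⟩ʳ_) v)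
             (λ j _ P → trans (prob-cong (λ β x → trans (plain₀-τ j j β x) (sym (plain₀-τ j i β x))) v P)
                              (sym (prob-translate (plain₀ j) (τ i) v P)))
             (λ b P → sym (prob-translate (fixing i (d i) b) (τ i) v P))) ⟩
      𝔼 (𝔅 n) (λ v → Ψ plain₀ (fixing i (d i)) i (Vec.map (τ i ⟨$⟩ʳ_) v))
        ≡⟨ 𝔼-𝔅-translate (τ i) (Ψ plain₀ (fixing i (d i)) i) ⟩
      𝔼 (𝔅 n) (Ψ plain₀ (fixing i (d i)) i)
        ≡⟨ sym (𝔼-𝔅-translate σ (Ψ plain₀ (fixing i (d i)) i)) ⟩
      𝔼 (𝔅 n) (λ v → Ψ plain₀ (fixing i (d i)) i (Vec.map (σ ⟨$⟩ʳ_) v))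
        ≡⟨ 𝔼-cong (𝔅 n) (λ v → Ψ-cong plain₀ plain₀ (fixing i (d i)) (fixing i p) i (Vec.map (σ ⟨$⟩ʳ_) v) v
             (λ j j≢i P → trans (prob-translate (plain₀ j) σ v P)
               (prob-cong (λ β x → plain-exchange-other j (λ eq → j≢i (trans (sym eq) (own-d i)))
                                     (λ eq → j≢i (trans (sym eq) own≡i)) (β [ d j ]≔ᵛ false) x) v P))
             (λ b P → trans (prob-translate (fixing i (d i) b) σ v P) (exchanged b v P))) ⟩
      𝔼 (𝔅 n) (Ψ plain₀ (fixing i p) i) ∎
      where
      open ≡-Reasoning
      π′ : Permutation′ S
      π′ = Perm.transpose (d i) p
      σ : Permutation′ n
      σ = exchange (d i) p
      cancel : ∀ (ρ : Permutation′ S) β → permute-bits ρ (permute-bits (Perm.flip ρ) β) ≡ β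
      cancel ρ β = trans (Vecₚ.tabulate-cong λ x → trans (Vecₚ.lookup∘tabulate _ (ρ ⟨$⟩ʳ x))
                     (cong (lookup β) (Perm.inverseˡ ρ))) (Vecₚ.tabulate∘lookup β)
      exchanged : ∀ b v P → prob (λ β → fixing i (d i) b β ∘ (σ ⟨$⟩ʳ_)) v P ≡ prob (fixing i p b) v P
      -- The exchange becomes a permutation of the coins, which moves the fixed coin from `d i` to
      -- `p` and is absorbed by their uniformity.
      exchanged b v P = trans
        (prob-cong (λ β x → trans (plain-exchange (trans (own-d i) (sym own≡i)) i (β [ d i ]≔ᵛ b) x)
                                  (cong (λ γ → plain i γ x) (permute-update (d i) p β b))) v P)
        (𝔼-bits-reindex (permute-bits π′) (permute-bits (Perm.flip π′)) (cancel π′) (cancel (Perm.flip π′))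
          (λ β → ⟦ P (tabulate (fixing i p b β ∘ lookup v)) ⟧))

    -- By symmetry each of the `s i` pairs of player `i` contributes the same amount `ε i`, while
    -- the information bound covers all pairs together.
    ε-bound : ∀ (c : Fin K → ℕ) → Bounded c π → ∀ i → ι (s i) * ε i ≤ 8ℚ * ι (c i)
    ε-bound c bounded i = begin
      ι (s i) * ε i
        ≡⟨ trans (*-comm (ι (s i)) (ε i)) (cong (ε i *_) (trans (cong ι (sym (size-owner s i)))
             (sym (∑-size (λ p → does (own p Finₚ.≟ i)))))) ⟩
      ε i * ∑ (λ p → ⟦ does (own p Finₚ.≟ i) ⟧)
        ≡⟨ sym (∑-*ˡ (ε i) (λ p → ⟦ does (own p Finₚ.≟ i) ⟧)) ⟩
      ∑ (λ p → ε i * ⟦ does (own p Finₚ.≟ i) ⟧)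
        ≤⟨ ∑-mono (λ p → owned p (own p Finₚ.≟ i)) ⟩
      ∑ (λ p → 𝔼 (𝔅 n) (Ψ plain₀ (fixing i p) i))
        ≡⟨ sym (𝔼-∑ (𝔅 n) (λ p → Ψ plain₀ (fixing i p) i)) ⟩
      𝔼 (𝔅 n) (λ v → ∑ (λ p → Ψ plain₀ (fixing i p) i v))
        ≤⟨ 𝔼-mono (𝔅 n) information ⟩
      𝔼 (𝔅 n) (λ _ → 8ℚ * ι (c i))
        ≡⟨ 𝔼-const (𝔅 n) (8ℚ * ι (c i)) ⟩
      8ℚ * ι (c i) ∎
      where
      open ≤-Reasoning
      owned : ∀ p (o : Dec (own p ≡ i)) → ε i * ⟦ does o ⟧ ≤ 𝔼 (𝔅 n) (Ψ plain₀ (fixing i p) i)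
      owned p (yes own≡i) = ≤-reflexive (trans (*-identityʳ (ε i)) (ε-symmetric i p own≡i))
      owned p (no _)      = subst (_≤ 𝔼 (𝔅 n) (Ψ plain₀ (fixing i p) i)) (sym (*-zeroʳ (ε i)))
                              (0≤𝔼 (𝔅 n) (0≤Ψ plain₀ (fixing i p) i))
      -- The information bound concerns fair coins, so the designated coin of player `i` is
      -- released. Since `Ψ` overwrites factor `i`, its value stays the same.
      free : Fin K → Family
      free = plain₀ [ i ≔ plain i ]
      information : ∀ v → ∑ (λ p → Ψ plain₀ (fixing i p) i v) ≤ 8ℚ * ι (c i)
      information v = subst (_≤ 8ℚ * ι (c i))
        (∑-cong λ p → Ψ-cong free plain₀ (fixing i p) (fixing i p) i v v
           (λ j j≢i P → cong (λ g → prob g v P) (updateAt-minimal j i plain₀ j≢i)) (λ _ _ → refl))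
        (leafSum-info i (measure free v) (λ j → prob-additive (free j) v) (λ j → 0≤prob (free j) v)
          (λ j → prob-total (free j) v) coins (sample free v) (measure-sampled free v)
          (λ β → tabulate (plain i β ∘ lookup v)) (λ P → cong (λ g → prob g v P) (updateAt-updates i plain₀))
          π (c i) (λ ω → bounded (read ∘ sample free v ω) i))

    -- Error probabilities and the final estimate.

    error : Bool → ℚ
    error b = 𝔼 (𝔅 n) (λ v → leafSum π everything (λ o R → ⟦ does (o 𝔹.≟ not b) ⟧ * volume (measure (base b) v) R))

    error-run : ∀ b → error b ≡
      𝔼 coins (λ ω → 𝔼 (𝔅 n) (λ v → ⟦ does (run π (read ∘ sample (base b) v ω) 𝔹.≟ not b) ⟧))
    error-run b = trans (𝔼-cong (𝔅 n) transcript)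
      (𝔼-swap (𝔅 n) coins (λ v ω → ⟦ does (run π (read ∘ sample (base b) v ω) 𝔹.≟ not b) ⟧))
      where
      open ≡-Reasoning
      wrong : Bool → ℚ
      wrong o = ⟦ does (o 𝔹.≟ not b) ⟧
      transcript : ∀ v → leafSum π everything (λ o R → wrong o * volume (measure (base b) v) R) ≡
                   𝔼 coins (λ ω → wrong (run π (read ∘ sample (base b) v ω)))
      transcript v = begin
        leafSum π everything (λ o R → wrong o * volume (measure (base b) v) R)
          ≡⟨ leafSum-cong π everything (λ o R → trans (cong (wrong o *_) (measure-sampled (base b) v R))
               (sym (𝔼-*ˡ coins (wrong o) (λ ω → inside R (sample (base b) v ω))))) ⟩
        leafSum π everything (λ o R → 𝔼 coins (λ ω → wrong o * inside R (sample (base b) v ω)))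
          ≡⟨ leafSum-𝔼 coins π everything (λ ω o R → wrong o * inside R (sample (base b) v ω)) ⟩
        𝔼 coins (λ ω → leafSum π everything (λ o R → wrong o * inside R (sample (base b) v ω)))
          ≡⟨ 𝔼-cong coins (λ ω → trans (leafSum-run wrong π everything (sample (base b) v ω))
               (trans (cong (wrong (run π (read ∘ sample (base b) v ω)) *_) (inside-everything (sample (base b) v ω)))
                      (*-identityʳ (wrong (run π (read ∘ sample (base b) v ω)))))) ⟩
        𝔼 coins (λ ω → wrong (run π (read ∘ sample (base b) v ω))) ∎

    -- For each fixed outcome of the coins the random placement alone makes the input uniform on its
    -- orbit, so the average over the coins is that of a constant.
    error₀ : error false ≡ frac (length (filter (λ X → run π X 𝔹.≟ true) (supp0 s))) (length (supp0 {K} {n} s))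
    error₀ = trans (error-run false) (trans
      (𝔼-cong coins λ ω → sym (output-frequency (orbit₀ s) π true (λ i → base false i (lookup ω i))
        (F0-base (lookup ω) , Fs-base false (lookup ω))))
      (𝔼-const coins _))

    error₁ : error true ≡ frac (length (filter (λ X → run π X 𝔹.≟ false) (supp1 s))) (length (supp1 {K} {n} s))
    error₁ = trans (error-run true) (trans
      (𝔼-cong coins λ ω → sym (output-frequency (orbit₁ s) π false (λ i → base true i (lookup ω i))
        (F1-base (lookup ω) , Fs-base true (lookup ω))))
      (𝔼-const coins _))

    leafTotal-volume : ∀ ϑ → (∀ i → Additive {K} (ϑ i)) → (∀ i → ϑ i (λ _ → true) ≡ 1ℚ) → leafTotal (volume ϑ) ≡ 1ℚ
    leafTotal-volume ϑ add total = trans (leafSum-volume ϑ add π everything) (∏-1 (λ i → ϑ i (λ _ → true)) total)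

    module _ (v : Placement) where

      θ₀ θ₁ θₘ : Measures {K}
      θ₀ = measure (base false) v
      θ₁ = measure (base true) v
      θₘ i P = mid (θ₀ i P) (θ₁ i P)

      θₘ-additive : ∀ i → Additive {K} (θₘ i)
      θₘ-additive i P Q = trans (lem (θ₀ i (P ∩ ∁ Q)) (θ₁ i (P ∩ ∁ Q)) (θ₀ i (P ∩ Q)) (θ₁ i (P ∩ Q)))
        (cong₂ mid (prob-additive (base false i) v P Q) (prob-additive (base true i) v P Q))
        where
        lem : ∀ a b c d → ½ * (a + b) + ½ * (c + d) ≡ ½ * ((a + c) + (b + d))
        lem = solve-∀ ℚ-ring

      flipped : Fin K → Rect K → ℚ
      flipped i R = ∏ ((λ j → θ₀ j (R j)) [ i ≔ θ₁ i (R i) ])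

      twisted : Fin K → Rect K → ℚ
      twisted i R = ∏ ((λ j → θ₀ j (R j)) [ i ≔ tri (θ₀ i (R i)) (θ₁ i (R i)) ])

      total₀ : leafTotal (volume θ₀) ≡ 1ℚ
      total₀ = leafTotal-volume θ₀ (λ i → prob-additive (base false i) v) (λ i → prob-total (base false i) v)

      totalₘ : leafTotal (volume θₘ) ≡ 1ℚ
      totalₘ = leafTotal-volume θₘ θₘ-additive
        (λ i → cong₂ mid (prob-total (base false i) v) (prob-total (base true i) v))

      total-flipped : ∀ i → leafTotal (flipped i) ≡ 1ℚ
      total-flipped i = trans (leafSum-cong π everything λ _ R → sym (volume-replace θ₀ i (θ₁ i) R))
        (leafTotal-volume (θ₀ [ i ≔ θ₁ i ]) (λ j → at j (Additive {K}) (prob-additive (base false j) v) (prob-additive (base true i) v))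
          (λ j → at j (λ θ → θ (λ _ → true) ≡ 1ℚ) (prob-total (base false j) v) (prob-total (base true i) v)))
        where
        at : ∀ j (T : (Event → ℚ) → Set) → T (θ₀ j) → T (θ₁ i) → T ((θ₀ [ i ≔ θ₁ i ]) j)
        at j T t₀ t₁ with j Finₚ.≟ i
        ... | yes refl = subst T (sym (updateAt-updates i θ₀)) t₁
        ... | no j≢i   = subst T (sym (updateAt-minimal j i θ₀ j≢i)) t₀

      total-twisted : ∀ i → leafTotal (twisted i) ≡ Ψ (base false) (λ b → base b i) i v
      total-twisted i = leafSum-cong π everything λ _ R →
        sym (volume-replace θ₀ i (discrepancy (λ b → base b i) v) R)

      value : Rect K → ℚ
      value R = leaf-value (λ i → θ₀ i (R i)) (λ i → θ₁ i (R i))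

      -- The products for the first world, for the midpoints and for one flipped player all total 1,
      -- so the corrections vanish.
      value-total : leafTotal value ≡ ½ - 10ℚ * ∑ (λ i → Ψ (base false) (λ b → base b i) i v)
      value-total = begin
        leafTotal value
          ≡⟨ leafSum-cong π everything (λ _ R → lem₁ (volume θ₀ R) (volume θₘ R) (flips R) (twists R)) ⟩
        leafTotal (λ R → (½ + 8ℚ) * volume θ₀ R + (- 8ℚ * volume θₘ R + (4ℚ * flips R + - 10ℚ * twists R)))
          ≡⟨ trans (leafTotal-+ _ _) (cong₂ _+_ (leafTotal-* (½ + 8ℚ) (volume θ₀))
               (trans (leafTotal-+ _ _) (cong₂ _+_ (leafTotal-* (- 8ℚ) (volume θₘ))
                 (trans (leafTotal-+ _ _) (cong₂ _+_ (leafTotal-* 4ℚ flips) (leafTotal-* (- 10ℚ) twists)))))) ⟩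
        (½ + 8ℚ) * leafTotal (volume θ₀) + (- 8ℚ * leafTotal (volume θₘ) + (4ℚ * leafTotal flips + - 10ℚ * leafTotal twists))
          ≡⟨ cong₂ (λ x y → (½ + 8ℚ) * x + y) total₀
               (cong₂ (λ x y → - 8ℚ * x + y) totalₘ (cong₂ (λ x y → 4ℚ * x + - 10ℚ * y) total-flips total-twists)) ⟩
        (½ + 8ℚ) * 1ℚ + (- 8ℚ * 1ℚ + (4ℚ * 0ℚ + - 10ℚ * b))
          ≡⟨ lem₂ b ⟩
        ½ - 10ℚ * b ∎
        where
        open ≡-Reasoning
        flips twists : Rect K → ℚ
        flips R = ∑ (λ i → flipped i R - volume θ₀ R)
        twists R = ∑ (λ i → twisted i R)
        b : ℚ
        b = ∑ (λ i → Ψ (base false) (λ b → base b i) i v)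
        leafTotal-+ : ∀ X Y → leafTotal (λ R → X R + Y R) ≡ leafTotal X + leafTotal Y
        leafTotal-+ X Y = leafSum-+ π everything (λ _ → X) (λ _ → Y)
        leafTotal-* : ∀ c X → leafTotal (λ R → c * X R) ≡ c * leafTotal X
        leafTotal-* c X = leafSum-*ˡ π everything c (λ _ → X)
        lem₁ : ∀ x m a b → ½ * x - 8ℚ * (m - x) + 4ℚ * a - 10ℚ * b
               ≡ (½ + 8ℚ) * x + (- 8ℚ * m + (4ℚ * a + - 10ℚ * b))
        lem₁ = solve-∀ ℚ-ring
        lem₂ : ∀ b → (½ + 8ℚ) * 1ℚ + (- 8ℚ * 1ℚ + (4ℚ * 0ℚ + - 10ℚ * b)) ≡ ½ - 10ℚ * b
        lem₂ = solve-∀ ℚ-ring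
        lem₃ : ∀ x y → x - y ≡ x + - 1ℚ * y
        lem₃ = solve-∀ ℚ-ring
        total-flips : leafTotal flips ≡ 0ℚ
        total-flips = trans (leafSum-∑ π everything (λ i _ R → flipped i R - volume θ₀ R))
          (trans (∑-cong λ i → trans (leafSum-cong π everything λ _ R → lem₃ (flipped i R) (volume θ₀ R))
                   (trans (leafTotal-+ (flipped i) (λ R → - 1ℚ * volume θ₀ R))
                     (cong₂ _+_ (total-flipped i) (trans (leafTotal-* (- 1ℚ) (volume θ₀)) (cong (- 1ℚ *_) total₀)))))
                 (∑-0 K))
        total-twists : leafTotal twists ≡ b
        total-twists = trans (leafSum-∑ π everything (λ i _ → twisted i)) (∑-cong total-twisted)

      -- A leaf answers wrongly in exactly one of the two worlds, and `leaf-value` bounds its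
      -- probability from below in both.
      value≤error : ∀ o R → value R ≤
        ⟦ does (o 𝔹.≟ true) ⟧ * volume θ₀ R + ⟦ does (o 𝔹.≟ false) ⟧ * volume θ₁ R
      value≤error true  R = ≤-trans (leaf-value≤∏₀ _ _ (λ i → 0≤prob (base false i) v (R i)) (λ i → 0≤prob (base true i) v (R i)))
        (≤-reflexive (lem (volume θ₀ R) (volume θ₁ R)))
        where
        lem : ∀ x y → x ≡ 1ℚ * x + 0ℚ * y
        lem = solve-∀ ℚ-ring
      value≤error false R = ≤-trans (leaf-value≤∏₁ _ _ (λ i → 0≤prob (base false i) v (R i)) (λ i → 0≤prob (base true i) v (R i)))
        (≤-reflexive (lem (volume θ₀ R) (volume θ₁ R)))
        where
        lem : ∀ x y → y ≡ 0ℚ * x + 1ℚ * y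
        lem = solve-∀ ℚ-ring

    error-bound : ½ - 10ℚ * ∑ ε ≤ error false + error true
    error-bound = begin
      ½ - 10ℚ * ∑ ε
        ≡⟨ expectation ⟩
      𝔼 (𝔅 n) (λ v → leafTotal (value v))
        ≤⟨ 𝔼-mono (𝔅 n) (λ v → leafSum-mono π everything (value≤error v)) ⟩
      𝔼 (𝔅 n) (λ v → leafSum π everything (λ o R →
        ⟦ does (o 𝔹.≟ true) ⟧ * volume (θ₀ v) R + ⟦ does (o 𝔹.≟ false) ⟧ * volume (θ₁ v) R))
        ≡⟨ trans (𝔼-cong (𝔅 n) λ v → leafSum-+ π everything (λ o R → ⟦ does (o 𝔹.≟ true) ⟧ * volume (θ₀ v) R)
             (λ o R → ⟦ does (o 𝔹.≟ false) ⟧ * volume (θ₁ v) R)) (𝔼-+ (𝔅 n) _ _) ⟩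
      error false + error true ∎
      where
      open ≤-Reasoning
      leak : Placement → ℚ
      leak v = ∑ (λ i → Ψ (base false) (λ b → base b i) i v)
      lem : ∀ b → ½ - 10ℚ * b ≡ ½ + - 10ℚ * b
      lem = solve-∀ ℚ-ring
      expectation : ½ - 10ℚ * ∑ ε ≡ 𝔼 (𝔅 n) (λ v → leafTotal (value v))
      expectation = sym (trans (𝔼-cong (𝔅 n) λ v → trans (value-total v) (lem (leak v)))
        (trans (𝔼-+ (𝔅 n) (λ _ → ½) (λ v → - 10ℚ * leak v))
          (trans (cong₂ _+_ (𝔼-const (𝔅 n) ½) (trans (𝔼-*ˡ (𝔅 n) (- 10ℚ) leak)
                   (cong (- 10ℚ *_) (𝔼-∑ (𝔅 n) (λ i → Ψ (base false) (λ b → base b i) i)))))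
                 (sym (lem (∑ ε))))))

    ε≤ : ∀ (c : Fin K → ℕ) → Bounded c π → ∀ i → ε i ≤ 8ℚ * frac (c i) (s i)
    ε≤ c bounded i = cancel (s i) (1≤s i) (ε-bound c bounded i)
      where
      cancel : ∀ m → 1 ℕ.≤ m → ι m * ε i ≤ 8ℚ * ι (c i) → ε i ≤ 8ℚ * frac (c i) m
      cancel (suc m) _ le = *-cancel-≤ (ι (suc m)) (<-≤-trans (positive⁻¹ 1ℚ) (+-mono-≤ {1ℚ} {1ℚ} ≤-refl (ι-mono {0} {m} z≤n)))
        (≤-trans le (≤-reflexive (trans (cong (8ℚ *_) (sym (frac-* (c i) m))) (lem (frac (c i) (suc m)) (ι (suc m))))))
        where
        lem : ∀ x y → 8ℚ * (x * y) ≡ y * (8ℚ * x)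
        lem = solve-∀ ℚ-ring

    communication-bound : ∀ (c : Fin K → ℕ) → Bounded c π → errorD s π ≤ ℤ.+ 1 / 100 →
                          ℤ.+ 1 / 200 ≤ ∑ (λ i → frac (c i) (s i))
    communication-bound c bounded small = ≤-by
      -- From `e₀ + e₁ ≥ ½ - 10 ∑ ε`, `e₀ + e₁ ≤ 1/50` and `∑ ε ≤ 8 F` follows `80 F ≥ 12/25`, that
      -- is `F ≥ 3/500`; the summand `1/1000` is the slack above `1/200`.
      (ℤ.+ 1 / 80 * (e₀ + e₁ - (½ - 10ℚ * ∑ ε)) + ℤ.+ 1 / 40 * (ℤ.+ 1 / 100 - (½ * e₀ + ½ * e₁))
        + ℤ.+ 1 / 8 * (8ℚ * F - ∑ ε) + ℤ.+ 1 / 1000)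
      (lem e₀ e₁ (∑ ε) F)
      (0≤+ (0≤+ (0≤+ (0≤* (nonNegative⁻¹ (ℤ.+ 1 / 80)) (0≤diff error-bound))
                     (0≤* (nonNegative⁻¹ (ℤ.+ 1 / 40)) (0≤diff small′)))
                (0≤* (nonNegative⁻¹ (ℤ.+ 1 / 8)) (0≤diff leak≤)))
           (nonNegative⁻¹ (ℤ.+ 1 / 1000)))
      where
      e₀ e₁ F : ℚ
      e₀ = error false
      e₁ = error true
      F = ∑ (λ i → frac (c i) (s i))
      small′ : ½ * e₀ + ½ * e₁ ≤ ℤ.+ 1 / 100
      small′ = subst (_≤ ℤ.+ 1 / 100) (sym (cong₂ (λ x y → ½ * x + ½ * y) error₀ error₁)) small
      leak≤ : ∑ ε ≤ 8ℚ * F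
      leak≤ = subst (∑ ε ≤_) (∑-*ˡ 8ℚ (λ i → frac (c i) (s i))) (∑-mono (ε≤ c bounded))
      lem : ∀ e₀ e₁ l F → F - ℤ.+ 1 / 200 ≡
        ℤ.+ 1 / 80 * (e₀ + e₁ - (½ - 10ℚ * l)) + ℤ.+ 1 / 40 * (ℤ.+ 1 / 100 - (½ * e₀ + ½ * e₁))
          + ℤ.+ 1 / 8 * (8ℚ * F - l) + ℤ.+ 1 / 1000
      lem = solve-∀ ℚ-ring

pairs-fit : ∀ S {n} → 2 ℕ.* S ℕ.≤ n → S ℕ.+ (S ℕ.+ (n ℕ.∸ 2 ℕ.* S)) ≡ n
pairs-fit S {n} 2S≤n = trans (sym (ℕₚ.+-assoc S S (n ℕ.∸ 2 ℕ.* S)))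
  (trans (cong (λ m → S ℕ.+ m ℕ.+ (n ℕ.∸ 2 ℕ.* S)) (sym (ℕₚ.+-identityʳ S))) (ℕₚ.m+[n∸m]≡n 2S≤n))

theorem2p13 : Σ ℚ (λ c → (0ℚ < c) ×
    ((k n : ℕ) → k ℕ.≥ 1 → n ℕ.≥ 1 →
    (s : Fin k → ℕ) → (∀ i → s i ℕ.≥ 1) → 2 ℕ.* sumℕ s ℕ.≤ n →
    (cs : Fin k → ℕ) → (Π : Protocol k n) → Bounded cs Π →
    errorD s Π ≤ (ℤ.+ 1 / 100) →
    c ≤ sumℚ (λ i → frac (cs i) (s i))))
theorem2p13 = ℤ.+ 1 / 200 , positive⁻¹ (ℤ.+ 1 / 200) , λ where
  -- The `n ∸ 2 * sumℕ s` points left over by the pairs are the spare ones; this puts `n` in the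
  -- form in which the worlds are built.
  (suc k) n _ _ s 1≤s 2S≤n → subst
    (λ n → (cs : Fin (suc k) → ℕ) (Π : Protocol (suc k) n) → Bounded cs Π → errorD s Π ≤ ℤ.+ 1 / 100 →
           ℤ.+ 1 / 200 ≤ sumℚ (λ i → frac (cs i) (s i)))
    (pairs-fit (sumℕ s) 2S≤n)
    (λ cs Π → Bound.communication-bound s 1≤s (n ℕ.∸ 2 ℕ.* sumℕ s) Π cs)
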